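{- Let $T=(V,E)$ be a tree on $n$ vertices and let $f=\{i,j\}$ be a pair of distinct vertices of $T$ with $f\notin E$, i.e. $d_{i,j}=d>1$. Let $B=E\cup\{f\}$ and let $N=\mathrm{Min4PC}_T[B,B]$ be the $n\times n$ principal submatrix of $\mathrm{Min4PC}_T$ whose rows and columns are indexed by $B$. Write $\det(xI-N)=\sum_{k=0}^n a_kx^k$. Then the sequence $|a_0|,|a_1|,\ldots,|a_{n-2}|$ is unimodal and log-concave. Moreover, if $|a_t|=\max_{0\le k\le n-2}|a_k|$, then $\lfloor \frac{n-2}{3}\rfloor\le t\le \lceil\frac{n+1}{3}\rceil$.
   Context: For a tree $T$, $d_{i,j}$ denotes the distance (number of edges on the path) between vertices $i,j$. Let $\mathcal{V}_2$ be the set of 2-element subsets of $V$. The matrix $\mathrm{Min4PC}_T$ is the $\binom n2\times\binom n2$ matrix with rows and columns indexed by $\mathcal{V}_2$ whose entry in row $\{i,j\}$ and column $\{k,l\}$ is $\min\{d_{i,l}+d_{j,k},\ d_{i,k}+d_{j,l},\ d_{i,j}+d_{k,l}\}$. Edges of $T$ are regarded as elements of $\mathcal{V}_2$. A sequence $a_0,\dots,a_m$ is unimodal if there is an index $k$ with $a_{j-1}\le a_j$ for $j\le k$ and $a_j\ge a_{j+1}$ for $j\ge k$; it is log-concave if $a_i^2\ge a_{i-1}a_{i+1}$ for $1\le i\le m-1$. -}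

module Defs where

open import Algebra.Bundles.Raw using (RawRing)
import Algebra.Definitions.RawMonoid as RawMonoidDefs
import Algebra.Definitions.RawSemiring as RawSemiringDefs
open import Data.Fin.Base using (Fin; zero; suc; toℕ; punchIn; _<_)
open import Data.Fin.Properties using (_≟_; _<?_)
open import Data.Integer.Base as ℤ using (ℤ; +_; 0ℤ; 1ℤ; ∣_∣)
open import Data.List.Base as List using (List; []; _∷_; allFin; cartesianProduct; filter; mapMaybe)
open import Data.List.Relation.Unary.Unique.Propositional using (Unique)
open import Data.Maybe.Base as Maybe using (Maybe)
open import Data.Nat.Base as ℕ using (ℕ; zero; suc; _+_; _*_; _∸_; _^_; _⊓_; _≤_; NonZero)
open import Data.Nat.DivMod using (_/_)
open import Data.Product.Base using (_×_; _,_; ∃-syntax)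
open import Level using (0ℓ)
open import Relation.Binary.Construct.Closure.ReflexiveTransitive using (Star; ε; _◅_)
open import Relation.Binary.Core using (Rel)
open import Relation.Binary.Definitions using (Decidable; Irreflexive; Symmetric)
open import Relation.Binary.PropositionalEquality using (_≡_)
open import Relation.Nullary.Decidable using (yes; no; dec⇒maybe)
open import Relation.Nullary.Negation using (¬_)

record Graph (n : ℕ) : Set₁ where
  field
    Adj    : Rel (Fin n) 0ℓ
    adj?   : Decidable Adj
    symm   : Symmetric Adj
    irrefl : Irreflexive _≡_ Adj

  Walk : Rel (Fin n) 0ℓ
  Walk = Star Adj

  vertices : ∀ {u v} → Walk u v → List (Fin n)
  vertices {u} ε       = u ∷ []
  vertices {u} (_ ◅ w) = u ∷ vertices w

  edgeCount : ∀ {u v} → Walk u v → ℕ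
  edgeCount ε       = 0
  edgeCount (_ ◅ w) = suc (edgeCount w)

  record Path (u v : Fin n) : Set where
    field
      walk     : Walk u v
      distinct : Unique (vertices walk)

  -- The cycle start, …, end, start.  At least two edges from start to end
  -- means at least three vertices.
  record Cycle : Set where
    field
      {start end} : Fin n
      path        : Path start end
      long        : 2 ≤ edgeCount (Path.walk path)
      closing     : Adj end start

record Tree (n : ℕ) : Set₁ where
  field
    graph     : Graph n
    connected : ∀ u v → Graph.Path graph u v
    acyclic   : ¬ Graph.Cycle graph

  open Graph graph public

  -- In a tree the path between two vertices is unique, so the choice made
  -- by `connected` is immaterial.
  dist : Fin n → Fin n → ℕ
  dist u v = edgeCount (Path.walk (connected u v))

-- {fst , snd}, listed in increasing order.
record V₂ (n : ℕ) : Set where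
  constructor pair
  field
    fst snd : Fin n
    fst<snd : fst < snd

allV₂ : ∀ n → List (V₂ n)
allV₂ n = mapMaybe toV₂ (cartesianProduct (allFin n) (allFin n))
  where
  toV₂ : Fin n × Fin n → Maybe (V₂ n)
  toV₂ (i , j) = Maybe.map (pair i j) (dec⇒maybe (i <? j))

module _ {n : ℕ} (T : Tree n) where
  open Tree T
  open V₂

  IsEdge : V₂ n → Set
  IsEdge e = Adj (fst e) (snd e)

  edges : List (V₂ n)
  edges = filter (λ e → adj? (fst e) (snd e)) (allV₂ n)

  Min4PC : V₂ n → V₂ n → ℕ
  Min4PC (pair i j _) (pair k l _) =
    (dist i l + dist j k) ⊓ (dist i k + dist j l) ⊓ (dist i j + dist k l)

-- a₀ ∷ a₁ ∷ … ∷ aₘ ∷ [] is a₀ + a₁x + … + aₘxᵐ; trailing zeros are allowed.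
Poly : Set
Poly = List ℤ

coeff : Poly → ℕ → ℤ
coeff []      _       = 0ℤ
coeff (a ∷ p) zero    = a
coeff (a ∷ p) (suc k) = coeff p k

_+ₚ_ : Poly → Poly → Poly
[]      +ₚ q       = q
(a ∷ p) +ₚ []      = a ∷ p
(a ∷ p) +ₚ (b ∷ q) = (a ℤ.+ b) ∷ (p +ₚ q)

-ₚ_ : Poly → Poly
-ₚ_ = List.map (λ a → ℤ.- a)

_*ₚ_ : Poly → Poly → Poly
[]      *ₚ q = []
(a ∷ p) *ₚ q = List.map (a ℤ.*_) q +ₚ (0ℤ ∷ (p *ₚ q))

constₚ : ℤ → Poly
constₚ a = a ∷ []

X : Poly
X = 0ℤ ∷ 1ℤ ∷ []

ℤ[X] : RawRing 0ℓ 0ℓ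
ℤ[X] = record
  { Carrier = Poly
  ; _≈_     = λ p q → ∀ k → coeff p k ≡ coeff q k
  ; _+_     = _+ₚ_
  ; _*_     = _*ₚ_
  ; -_      = -ₚ_
  ; 0#      = []
  ; 1#      = constₚ 1ℤ
  }

Matrix : ∀ {a} → Set a → ℕ → Set a
Matrix A m = Fin m → Fin m → A

module _ {c ℓ} (R : RawRing c ℓ) where
  private
    module R = RawRing R
    open RawMonoidDefs R.+-rawMonoid using (sum)
    open RawSemiringDefs R.rawSemiring using () renaming (_^_ to _^ᴿ_)

  -- Laplace expansion along the first row.
  det : ∀ {m} → Matrix R.Carrier m → R.Carrier
  det {zero}  M = R.1#
  det {suc m} M = sum λ j →
    ((R.- R.1#) ^ᴿ toℕ j) R.* (M zero j R.* det λ i k → M (suc i) (punchIn j k))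

-- xI − N
charMatrix : ∀ {m} → Matrix ℤ m → Matrix Poly m
charMatrix N i j with i ≟ j
... | yes _ = X +ₚ (-ₚ constₚ (N i j))
... | no  _ = -ₚ constₚ (N i j)

charPoly : ∀ {m} → Matrix ℤ m → Poly
charPoly N = det ℤ[X] (charMatrix N)

-- M[S,S], with rows and columns in the order in which S lists its elements.
principalSubmatrix : ∀ {a} {I : Set a} → (I → I → ℕ) → (S : List I) → Matrix ℤ (List.length S)
principalSubmatrix M S i j = + M (List.lookup S i) (List.lookup S j)

-- E ∪ {f} for f ∉ E, listed without repetition.  It has n elements, since a
-- tree on n vertices has n − 1 edges.
edgesAnd : ∀ {n} → Tree n → V₂ n → List (V₂ n)
edgesAnd T f = f ∷ edges T

absCoeff : ∀ {m} → Matrix ℤ m → ℕ → ℕ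
absCoeff N k = ∣ coeff (charPoly N) k ∣

-- In the next three definitions a finite sequence a 0, …, a m is given by a
-- function on ℕ together with its last index m.

Unimodal : (ℕ → ℕ) → ℕ → Set
Unimodal a m = ∃[ k ] k ≤ m
  × (∀ j → suc j ≤ k → a j ≤ a (suc j))
  × (∀ j → k ≤ j → suc j ≤ m → a (suc j) ≤ a j)

LogConcave : (ℕ → ℕ) → ℕ → Set
LogConcave a m = ∀ i → suc (suc i) ≤ m → a i * a (suc (suc i)) ≤ a (suc i) ^ 2

IsMaxAt : (ℕ → ℕ) → ℕ → ℕ → Set
IsMaxAt a m t = t ≤ m × (∀ k → k ≤ m → a k ≤ a t)

⌈_/_⌉ : (m k : ℕ) → .{{NonZero k}} → ℕ
⌈ m / k ⌉ = (m + (k ∸ 1)) / k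

{-# OPTIONS --safe #-}
-- Write m = n − 1 for the number of edges and d for the distance of f.  Any two distinct
-- edges give the entry 2, and f together with an edge e gives d − 1 or d + 1 according to
-- whether e lies on the path of f, which has d edges.  So N is 2(J − I) bordered by a
-- vector v with d entries d − 1 and m − d entries d + 1, and eliminating the border gives
--   det(x I − N) = −(x + 2)ᵐ⁻² (c₀ + c₁ x + 2(m − 2) x² − x³),
--   c₀ = 2m(d − 1)²,  c₁ = 4(m − 1) + Σ v².
-- Every multiplication by x + 2 keeps the coefficients log-concave and positive except at
-- the two top places.  The coefficients of (x + 2)ᵐ⁻² grow up to about (m − 2)/3 and then
-- decrease, which confines the maximum of the product to the stated interval.
module Submission where

open import Algebra.Bundles using (CommutativeRing; Semiring)
import Algebra.Definitions.RawSemiring as RawSemiringDefs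
import Algebra.Properties.AbelianGroup as AbelianGroupProperties
import Algebra.Properties.CommutativeMonoid.Sum as CommutativeMonoidSum
import Algebra.Properties.Group as GroupProperties
import Algebra.Properties.Ring as RingProperties
import Algebra.Solver.Ring as RingSolver
import Algebra.Solver.Ring.AlmostCommutativeRing as ACR
open import Data.Bool.Base using (Bool; true; false; not)
import Data.Bool.Properties as Bool
open import Data.Fin.Base as Fin using (Fin; zero; suc; toℕ; punchIn; inject₁)
import Data.Fin.Properties as Fin
open import Data.Integer.Base as ℤ using (ℤ; +_; -[1+_]; 0ℤ; 1ℤ; ∣_∣)
import Data.Integer.Properties as ℤ
import Data.Integer.Tactic.RingSolver as ℤ-Solver
open import Data.List.Base as List using (List; []; _∷_)
import Data.List.Membership.DecPropositional as DecMembership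
open import Data.List.Membership.Propositional using (_∈_; _∉_)
import Data.List.Membership.Propositional.Properties as ∈
import Data.List.Properties as List
open import Data.List.Relation.Unary.All as All using (All; []; _∷_)
open import Data.List.Relation.Unary.AllPairs using ([]; _∷_)
open import Data.List.Relation.Unary.Any as Any using (here; there)
import Data.List.Relation.Unary.Any.Properties as Any
open import Data.List.Relation.Unary.Unique.Propositional using (Unique)
import Data.List.Relation.Unary.Unique.Propositional.Properties as Unique
open import Data.Maybe.Base as Maybe using (Maybe; just; nothing)
open import Data.Nat.Base as ℕ using (ℕ; zero; suc; z≤n; s≤s; z<s)
import Data.Nat.DivMod as ℕ
import Data.Nat.Properties as ℕ
import Data.Nat.Tactic.RingSolver as ℕ-Solver
open import Data.Product.Base using (_×_; _,_; ∃-syntax; proj₁; proj₂)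
open import Data.Sum.Base using (_⊎_; inj₁; inj₂)
open import Function.Base using (_∘_; id)
open import Function.Bundles using (mk⇔)
open import Level using (0ℓ)
open import Relation.Binary.Construct.Closure.ReflexiveTransitive using (ε; _◅_; _◅◅_)
open import Relation.Binary.Definitions using (tri<; tri≈; tri>)
open import Relation.Binary.PropositionalEquality as ≡ using (_≡_; _≢_; refl; sym; trans; cong; cong₂; subst; module ≡-Reasoning)
open import Relation.Nullary.Decidable using (yes; no; does; dec-true; dec-false; does-⇔; dec⇒maybe)
open import Relation.Nullary.Negation using (¬_; contradiction)
open import Defs

-- The ring of integer polynomials

-- Eliminating the border means taking the Schur complement x - vᵀ((x + 2)I - 2J)⁻¹v, whose
-- denominators are x + 2 and x + 2 - 2m. Polynomials are coefficient lists here, with no field of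
-- fractions, so columns are scaled instead of divided and the surplus factors are cancelled at the
-- end. They are monic of degree one, hence not zero divisors.
--
-- The obstacle to plain positivity is the term -x³. Its neighbour 2(m - 2)x² is exactly used up by
-- the m - 2 factors x + 2, so the product ends in 0, -1 and is positive below; this is why the
-- sequence stops at n - 2. For the maximum the parts c₀, c₁x and 2(m - 2)x² - x³ are compared
-- separately. Their products are shifted against each other by up to two places, which makes the
-- stated interval wider than a single index.
--
-- On the tree, every vertex is coded by the side of each edge on which it lies. Distance becomes
-- Hamming distance, and an entry in the row of f depends only on whether the edge separates the
-- ends of f.

infix 4 _≋_
_≋_ : Poly → Poly → Set
p ≋ q = ∀ k → coeff p k ≡ coeff q k

coeff-+ₚ : ∀ p q k → coeff (p +ₚ q) k ≡ coeff p k ℤ.+ coeff q k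
coeff-+ₚ []      q       k       = sym (ℤ.+-identityˡ _)
coeff-+ₚ (a ∷ p) []      k       = sym (ℤ.+-identityʳ _)
coeff-+ₚ (a ∷ p) (b ∷ q) zero    = refl
coeff-+ₚ (a ∷ p) (b ∷ q) (suc k) = coeff-+ₚ p q k

coeff-scale : ∀ a p k → coeff (List.map (a ℤ.*_) p) k ≡ a ℤ.* coeff p k
coeff-scale a []      k       = sym (ℤ.*-zeroʳ a)
coeff-scale a (b ∷ p) zero    = refl
coeff-scale a (b ∷ p) (suc k) = coeff-scale a p k

coeff--ₚ : ∀ p k → coeff (-ₚ p) k ≡ ℤ.- coeff p k
coeff--ₚ []      k       = refl
coeff--ₚ (a ∷ p) zero    = refl
coeff--ₚ (a ∷ p) (suc k) = coeff--ₚ p k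

coeff-*ₚ-zero : ∀ a p q → coeff ((a ∷ p) *ₚ q) 0 ≡ a ℤ.* coeff q 0
coeff-*ₚ-zero a p q = trans (coeff-+ₚ (List.map (a ℤ.*_) q) _ 0)
  (trans (ℤ.+-identityʳ _) (coeff-scale a q 0))

coeff-*ₚ-suc : ∀ a p q k → coeff ((a ∷ p) *ₚ q) (suc k) ≡ a ℤ.* coeff q (suc k) ℤ.+ coeff (p *ₚ q) k
coeff-*ₚ-suc a p q k = trans (coeff-+ₚ (List.map (a ℤ.*_) q) _ (suc k))
  (cong (ℤ._+ _) (coeff-scale a q (suc k)))

*ₚ-congˡ : ∀ p {q r} → q ≋ r → p *ₚ q ≋ p *ₚ r
*ₚ-congˡ []              q≋r k       = refl
*ₚ-congˡ (a ∷ p) {q} {r} q≋r zero    = trans (coeff-*ₚ-zero a p q)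
  (trans (cong (a ℤ.*_) (q≋r 0)) (sym (coeff-*ₚ-zero a p r)))
*ₚ-congˡ (a ∷ p) {q} {r} q≋r (suc k) = trans (coeff-*ₚ-suc a p q k)
  (trans (cong₂ ℤ._+_ (cong (a ℤ.*_) (q≋r (suc k))) (*ₚ-congˡ p q≋r k)) (sym (coeff-*ₚ-suc a p r k)))

*ₚ-zeroʳ : ∀ p → p *ₚ [] ≋ []
*ₚ-zeroʳ []      k       = refl
*ₚ-zeroʳ (a ∷ p) zero    = refl
*ₚ-zeroʳ (a ∷ p) (suc k) = *ₚ-zeroʳ p k

-- `_*ₚ_` recurses on its left factor. This and the next lemma give the same recursion on the right
-- factor, which is what commutativity needs.
coeff-*ₚ-∷-zero : ∀ p b q → coeff (p *ₚ (b ∷ q)) 0 ≡ b ℤ.* coeff p 0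
coeff-*ₚ-∷-zero []      b q = sym (ℤ.*-zeroʳ b)
coeff-*ₚ-∷-zero (a ∷ p) b q = trans (coeff-*ₚ-zero a p (b ∷ q)) (ℤ.*-comm a b)

coeff-*ₚ-∷-suc : ∀ p b q k → coeff (p *ₚ (b ∷ q)) (suc k) ≡ b ℤ.* coeff p (suc k) ℤ.+ coeff (p *ₚ q) k
coeff-*ₚ-∷-suc []      b q k = sym (trans (ℤ.+-identityʳ _) (ℤ.*-zeroʳ b))
coeff-*ₚ-∷-suc (a ∷ p) b q zero = begin
  coeff ((a ∷ p) *ₚ (b ∷ q)) 1                ≡⟨ coeff-*ₚ-suc a p (b ∷ q) 0 ⟩
  a ℤ.* coeff q 0 ℤ.+ coeff (p *ₚ (b ∷ q)) 0  ≡⟨ ℤ.+-comm (a ℤ.* coeff q 0) _ ⟩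
  coeff (p *ₚ (b ∷ q)) 0 ℤ.+ a ℤ.* coeff q 0  ≡⟨ cong₂ ℤ._+_ (coeff-*ₚ-∷-zero p b q) (sym (coeff-*ₚ-zero a p q)) ⟩
  b ℤ.* coeff p 0 ℤ.+ coeff ((a ∷ p) *ₚ q) 0  ∎
  where open ≡-Reasoning
coeff-*ₚ-∷-suc (a ∷ p) b q (suc k) = begin
  coeff ((a ∷ p) *ₚ (b ∷ q)) (suc (suc k))
    ≡⟨ coeff-*ₚ-suc a p (b ∷ q) (suc k) ⟩
  a ℤ.* coeff q (suc k) ℤ.+ coeff (p *ₚ (b ∷ q)) (suc k)
    ≡⟨ cong (ℤ._+_ (a ℤ.* coeff q (suc k))) (coeff-*ₚ-∷-suc p b q k) ⟩
  a ℤ.* coeff q (suc k) ℤ.+ (b ℤ.* coeff p (suc k) ℤ.+ coeff (p *ₚ q) k)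
    ≡⟨ swap (a ℤ.* coeff q (suc k)) (b ℤ.* coeff p (suc k)) (coeff (p *ₚ q) k) ⟩
  b ℤ.* coeff p (suc k) ℤ.+ (a ℤ.* coeff q (suc k) ℤ.+ coeff (p *ₚ q) k)
    ≡⟨ cong (ℤ._+_ (b ℤ.* coeff p (suc k))) (coeff-*ₚ-suc a p q k) ⟨
  b ℤ.* coeff p (suc k) ℤ.+ coeff ((a ∷ p) *ₚ q) (suc k) ∎
  where
  open ≡-Reasoning
  swap : ∀ x y z → x ℤ.+ (y ℤ.+ z) ≡ y ℤ.+ (x ℤ.+ z)
  swap = ℤ-Solver.solve-∀

*ₚ-comm : ∀ p q → p *ₚ q ≋ q *ₚ p
*ₚ-comm []      q k       = sym (*ₚ-zeroʳ q k)
*ₚ-comm (a ∷ p) q zero    = trans (coeff-*ₚ-zero a p q) (sym (coeff-*ₚ-∷-zero q a p))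
*ₚ-comm (a ∷ p) q (suc k) = trans (coeff-*ₚ-suc a p q k)
  (trans (cong (ℤ._+_ (a ℤ.* coeff q (suc k))) (*ₚ-comm p q k)) (sym (coeff-*ₚ-∷-suc q a p k)))

-- Equal polynomials may be lists of different lengths, because of trailing zeros. Congruence in the
-- left factor is therefore carried over from the right one by commutativity.
*ₚ-cong : ∀ {p q r s} → p ≋ q → r ≋ s → p *ₚ r ≋ q *ₚ s
*ₚ-cong {p} {q} {r} {s} p≋q r≋s k = trans (*ₚ-congˡ p r≋s k)
  (trans (*ₚ-comm p s k) (trans (*ₚ-congˡ s p≋q k) (*ₚ-comm s q k)))

*ₚ-distribˡ : ∀ p q r → p *ₚ (q +ₚ r) ≋ (p *ₚ q) +ₚ (p *ₚ r)
*ₚ-distribˡ []      q r k = refl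
*ₚ-distribˡ (a ∷ p) q r zero = begin
  coeff ((a ∷ p) *ₚ (q +ₚ r)) 0                        ≡⟨ coeff-*ₚ-zero a p (q +ₚ r) ⟩
  a ℤ.* coeff (q +ₚ r) 0                               ≡⟨ cong (a ℤ.*_) (coeff-+ₚ q r 0) ⟩
  a ℤ.* (coeff q 0 ℤ.+ coeff r 0)                      ≡⟨ ℤ.*-distribˡ-+ a _ _ ⟩
  a ℤ.* coeff q 0 ℤ.+ a ℤ.* coeff r 0                  ≡⟨ cong₂ ℤ._+_ (coeff-*ₚ-zero a p q) (coeff-*ₚ-zero a p r) ⟨
  coeff ((a ∷ p) *ₚ q) 0 ℤ.+ coeff ((a ∷ p) *ₚ r) 0    ≡⟨ coeff-+ₚ ((a ∷ p) *ₚ q) ((a ∷ p) *ₚ r) 0 ⟨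
  coeff (((a ∷ p) *ₚ q) +ₚ ((a ∷ p) *ₚ r)) 0           ∎
  where open ≡-Reasoning
*ₚ-distribˡ (a ∷ p) q r (suc k) = begin
  coeff ((a ∷ p) *ₚ (q +ₚ r)) (suc k)
    ≡⟨ coeff-*ₚ-suc a p (q +ₚ r) k ⟩
  a ℤ.* coeff (q +ₚ r) (suc k) ℤ.+ coeff (p *ₚ (q +ₚ r)) k
    ≡⟨ cong₂ (λ u v → a ℤ.* u ℤ.+ v) (coeff-+ₚ q r (suc k))
        (trans (*ₚ-distribˡ p q r k) (coeff-+ₚ (p *ₚ q) (p *ₚ r) k)) ⟩
  a ℤ.* (coeff q (suc k) ℤ.+ coeff r (suc k)) ℤ.+ (coeff (p *ₚ q) k ℤ.+ coeff (p *ₚ r) k)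
    ≡⟨ shuffle a (coeff q (suc k)) (coeff r (suc k)) (coeff (p *ₚ q) k) (coeff (p *ₚ r) k) ⟩
  (a ℤ.* coeff q (suc k) ℤ.+ coeff (p *ₚ q) k) ℤ.+ (a ℤ.* coeff r (suc k) ℤ.+ coeff (p *ₚ r) k)
    ≡⟨ cong₂ ℤ._+_ (coeff-*ₚ-suc a p q k) (coeff-*ₚ-suc a p r k) ⟨
  coeff ((a ∷ p) *ₚ q) (suc k) ℤ.+ coeff ((a ∷ p) *ₚ r) (suc k)
    ≡⟨ coeff-+ₚ ((a ∷ p) *ₚ q) ((a ∷ p) *ₚ r) (suc k) ⟨
  coeff (((a ∷ p) *ₚ q) +ₚ ((a ∷ p) *ₚ r)) (suc k) ∎
  where
  open ≡-Reasoning
  shuffle : ∀ a b c d e → a ℤ.* (b ℤ.+ c) ℤ.+ (d ℤ.+ e) ≡ (a ℤ.* b ℤ.+ d) ℤ.+ (a ℤ.* c ℤ.+ e)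
  shuffle = ℤ-Solver.solve-∀

+ₚ-cong : ∀ {p q r s} → p ≋ q → r ≋ s → p +ₚ r ≋ q +ₚ s
+ₚ-cong {p} {q} {r} {s} p≋q r≋s k =
  trans (coeff-+ₚ p r k) (trans (cong₂ ℤ._+_ (p≋q k) (r≋s k)) (sym (coeff-+ₚ q s k)))

*ₚ-distribʳ : ∀ r p q → (p +ₚ q) *ₚ r ≋ (p *ₚ r) +ₚ (q *ₚ r)
*ₚ-distribʳ r p q k = trans (*ₚ-comm (p +ₚ q) r k) (trans (*ₚ-distribˡ r p q k)
  (+ₚ-cong {r *ₚ p} {p *ₚ r} {r *ₚ q} {q *ₚ r} (*ₚ-comm r p) (*ₚ-comm r q) k))

scale-*ₚ : ∀ a p q → List.map (a ℤ.*_) p *ₚ q ≋ List.map (a ℤ.*_) (p *ₚ q)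
scale-*ₚ a []      q k    = refl
scale-*ₚ a (b ∷ p) q zero = begin
  coeff (List.map (a ℤ.*_) (b ∷ p) *ₚ q) 0    ≡⟨ coeff-*ₚ-zero (a ℤ.* b) (List.map (a ℤ.*_) p) q ⟩
  a ℤ.* b ℤ.* coeff q 0                       ≡⟨ ℤ.*-assoc a b _ ⟩
  a ℤ.* (b ℤ.* coeff q 0)                     ≡⟨ cong (a ℤ.*_) (coeff-*ₚ-zero b p q) ⟨
  a ℤ.* coeff ((b ∷ p) *ₚ q) 0                ≡⟨ coeff-scale a ((b ∷ p) *ₚ q) 0 ⟨
  coeff (List.map (a ℤ.*_) ((b ∷ p) *ₚ q)) 0  ∎
  where open ≡-Reasoning
scale-*ₚ a (b ∷ p) q (suc k) = begin
  coeff (List.map (a ℤ.*_) (b ∷ p) *ₚ q) (suc k)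
    ≡⟨ coeff-*ₚ-suc (a ℤ.* b) (List.map (a ℤ.*_) p) q k ⟩
  a ℤ.* b ℤ.* coeff q (suc k) ℤ.+ coeff (List.map (a ℤ.*_) p *ₚ q) k
    ≡⟨ cong₂ ℤ._+_ (ℤ.*-assoc a b _) (trans (scale-*ₚ a p q k) (coeff-scale a (p *ₚ q) k)) ⟩
  a ℤ.* (b ℤ.* coeff q (suc k)) ℤ.+ a ℤ.* coeff (p *ₚ q) k
    ≡⟨ ℤ.*-distribˡ-+ a _ _ ⟨
  a ℤ.* (b ℤ.* coeff q (suc k) ℤ.+ coeff (p *ₚ q) k)
    ≡⟨ cong (a ℤ.*_) (coeff-*ₚ-suc b p q k) ⟨
  a ℤ.* coeff ((b ∷ p) *ₚ q) (suc k)
    ≡⟨ coeff-scale a ((b ∷ p) *ₚ q) (suc k) ⟨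
  coeff (List.map (a ℤ.*_) ((b ∷ p) *ₚ q)) (suc k) ∎
  where open ≡-Reasoning

shift-*ₚ : ∀ p q → (0ℤ ∷ p) *ₚ q ≋ 0ℤ ∷ (p *ₚ q)
shift-*ₚ p q zero    = coeff-*ₚ-zero 0ℤ p q
shift-*ₚ p q (suc k) = trans (coeff-*ₚ-suc 0ℤ p q k) (ℤ.+-identityˡ _)

*ₚ-assoc : ∀ p q r → (p *ₚ q) *ₚ r ≋ p *ₚ (q *ₚ r)
*ₚ-assoc []      q r k = refl
*ₚ-assoc (a ∷ p) q r k = trans (*ₚ-distribʳ r (List.map (a ℤ.*_) q) (0ℤ ∷ (p *ₚ q)) k)
  (+ₚ-cong {List.map (a ℤ.*_) q *ₚ r} {List.map (a ℤ.*_) (q *ₚ r)}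
           {(0ℤ ∷ (p *ₚ q)) *ₚ r} {0ℤ ∷ (p *ₚ (q *ₚ r))}
           (scale-*ₚ a q r) shifted k)
  where
  shifted : (0ℤ ∷ (p *ₚ q)) *ₚ r ≋ 0ℤ ∷ (p *ₚ (q *ₚ r))
  shifted zero    = shift-*ₚ (p *ₚ q) r zero
  shifted (suc k) = trans (shift-*ₚ (p *ₚ q) r (suc k)) (*ₚ-assoc p q r k)

*ₚ-identityˡ : ∀ p → constₚ 1ℤ *ₚ p ≋ p
*ₚ-identityˡ p zero    = trans (coeff-*ₚ-zero 1ℤ [] p) (ℤ.*-identityˡ _)
*ₚ-identityˡ p (suc k) = trans (coeff-*ₚ-suc 1ℤ [] p k) (trans (ℤ.+-identityʳ _) (ℤ.*-identityˡ _))

+ₚ-comm : ∀ p q → p +ₚ q ≋ q +ₚ p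
+ₚ-comm p q k = trans (coeff-+ₚ p q k) (trans (ℤ.+-comm (coeff p k) _) (sym (coeff-+ₚ q p k)))

+ₚ-assoc : ∀ p q r → (p +ₚ q) +ₚ r ≋ p +ₚ (q +ₚ r)
+ₚ-assoc p q r k = begin
  coeff ((p +ₚ q) +ₚ r) k                     ≡⟨ coeff-+ₚ (p +ₚ q) r k ⟩
  coeff (p +ₚ q) k ℤ.+ coeff r k              ≡⟨ cong (ℤ._+ coeff r k) (coeff-+ₚ p q k) ⟩
  coeff p k ℤ.+ coeff q k ℤ.+ coeff r k       ≡⟨ ℤ.+-assoc (coeff p k) _ _ ⟩
  coeff p k ℤ.+ (coeff q k ℤ.+ coeff r k)     ≡⟨ cong (ℤ._+_ (coeff p k)) (coeff-+ₚ q r k) ⟨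
  coeff p k ℤ.+ coeff (q +ₚ r) k              ≡⟨ coeff-+ₚ p (q +ₚ r) k ⟨
  coeff (p +ₚ (q +ₚ r)) k                     ∎
  where open ≡-Reasoning

-ₚ-inverseʳ : ∀ p → p +ₚ (-ₚ p) ≋ []
-ₚ-inverseʳ p k = trans (coeff-+ₚ p (-ₚ p) k)
  (trans (cong (ℤ._+_ (coeff p k)) (coeff--ₚ p k)) (ℤ.+-inverseʳ (coeff p k)))

-ₚ-cong : ∀ {p q} → p ≋ q → -ₚ p ≋ -ₚ q
-ₚ-cong {p} {q} p≋q k = trans (coeff--ₚ p k) (trans (cong ℤ.-_ (p≋q k)) (sym (coeff--ₚ q k)))

polyRing : CommutativeRing 0ℓ 0ℓ
polyRing = record
  { Carrier = Poly ; _≈_ = _≋_ ; _+_ = _+ₚ_ ; _*_ = _*ₚ_ ; -_ = -ₚ_ ; 0# = [] ; 1# = constₚ 1ℤ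
  ; isCommutativeRing = record
    { isRing = record
      { +-isAbelianGroup = record
        { isGroup = record
          { isMonoid = record
            { isSemigroup = record
              { isMagma = record
                { isEquivalence = record
                  { refl  = λ _ → refl
                  ; sym   = λ p≋q k → sym (p≋q k)
                  ; trans = λ p≋q q≋r k → trans (p≋q k) (q≋r k)
                  }
                ; ∙-cong = λ {p} {q} {r} {s} → +ₚ-cong {p} {q} {r} {s}
                }
              ; assoc = +ₚ-assoc
              }
            ; identity = (λ _ _ → refl) , λ p → +ₚ-comm p []
            }
          ; inverse = (λ p k → trans (+ₚ-comm (-ₚ p) p k) (-ₚ-inverseʳ p k)) , -ₚ-inverseʳ
          ; ⁻¹-cong = λ {p} {q} → -ₚ-cong {p} {q}
          }
        ; comm = +ₚ-comm
        }
      ; *-cong = λ {p} {q} {r} {s} → *ₚ-cong {p} {q} {r} {s}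
      ; *-assoc = *ₚ-assoc
      ; *-identity = *ₚ-identityˡ , λ p k → trans (*ₚ-comm p _ k) (*ₚ-identityˡ p k)
      ; distrib = *ₚ-distribˡ , *ₚ-distribʳ
      }
    ; *-comm = *ₚ-comm
    }
  }

almostPolyRing : ACR.AlmostCommutativeRing 0ℓ 0ℓ
almostPolyRing = ACR.fromCommutativeRing polyRing

constₚ-homo : ℤ.+-*-rawRing ACR.-Raw-AlmostCommutative⟶ almostPolyRing
constₚ-homo = record
  { ⟦_⟧    = constₚ
  ; +-homo = λ _ _ _ → refl
  ; *-homo = λ { a b zero → sym (ℤ.+-identityʳ _) ; a b (suc k) → refl }
  ; -‿homo = λ _ _ → refl
  ; 0-homo = λ { zero → refl ; (suc k) → refl }
  ; 1-homo = λ _ → refl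
  }

constₚ-≟ : ∀ a b → Maybe (constₚ a ≋ constₚ b)
constₚ-≟ a b = Maybe.map (λ a≡b k → cong (λ c → coeff (constₚ c) k) a≡b) (dec⇒maybe (a ℤ.≟ b))

module Poly-Solver = RingSolver ℤ.+-*-rawRing almostPolyRing constₚ-homo constₚ-≟

coeff-linear-zero : ∀ c p → coeff ((c ∷ 1ℤ ∷ []) *ₚ p) 0 ≡ c ℤ.* coeff p 0
coeff-linear-zero c p = coeff-*ₚ-zero c (1ℤ ∷ []) p

coeff-linear-suc : ∀ c p k → coeff ((c ∷ 1ℤ ∷ []) *ₚ p) (suc k) ≡ c ℤ.* coeff p (suc k) ℤ.+ coeff p k
coeff-linear-suc c p k = trans (coeff-*ₚ-suc c (1ℤ ∷ []) p k)
  (cong (ℤ._+_ (c ℤ.* coeff p (suc k))) (*ₚ-identityˡ p k))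

-- If (X + c) p = 0 then pₖ = −c pₖ₊₁, and the coefficients vanish from the top down.
linear-nonZeroDivisor : ∀ c p → (c ∷ 1ℤ ∷ []) *ₚ p ≋ [] → p ≋ []
linear-nonZeroDivisor c p eq = vanish p (λ k → trans (sym (coeff-linear-suc c p k)) (eq (suc k)))
  where
  vanish : ∀ p → (∀ k → c ℤ.* coeff p (suc k) ℤ.+ coeff p k ≡ 0ℤ) → p ≋ []
  vanish []      rec k       = refl
  vanish (a ∷ p) rec (suc k) = vanish p (λ j → rec (suc j)) k
  vanish (a ∷ p) rec zero    = begin
    a                           ≡⟨ ℤ.+-identityˡ a ⟨
    0ℤ ℤ.+ a                    ≡⟨ cong (ℤ._+ a) (trans (cong (c ℤ.*_) (vanish p (λ j → rec (suc j)) 0)) (ℤ.*-zeroʳ c)) ⟨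
    c ℤ.* coeff p 0 ℤ.+ a       ≡⟨ rec 0 ⟩
    0ℤ                          ∎
    where open ≡-Reasoning

-- Stands in for division by a monic linear polynomial; it is applied to `X+2` and to the
-- polynomials `w m`.
linear-cancelˡ : ∀ c p q → (c ∷ 1ℤ ∷ []) *ₚ p ≋ (c ∷ 1ℤ ∷ []) *ₚ q → p ≋ q
linear-cancelˡ c p q eq k = ℤ.i-j≡0⇒i≡j (coeff p k) (coeff q k) (begin
  coeff p k ℤ.- coeff q k    ≡⟨ cong (ℤ._+_ (coeff p k)) (coeff--ₚ q k) ⟨
  coeff p k ℤ.+ coeff (-ₚ q) k  ≡⟨ coeff-+ₚ p (-ₚ q) k ⟨
  coeff (p +ₚ (-ₚ q)) k      ≡⟨ linear-nonZeroDivisor c (p +ₚ (-ₚ q)) difference k ⟩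
  0ℤ                         ∎)
  where
  open ≡-Reasoning
  open Poly-Solver
  l = c ∷ 1ℤ ∷ []
  difference : l *ₚ (p +ₚ (-ₚ q)) ≋ []
  difference k = trans (solve 3 (λ l p q → l :* (p :+ (:- q)) := l :* p :+ (:- (l :* q))) (λ _ → refl) l p q k)
    (trans (+ₚ-cong {l *ₚ p} {l *ₚ q} eq (λ _ → refl) k) (-ₚ-inverseʳ (l *ₚ q) k))

-- Determinants and column operations

-- The transposition of the neighbours `l` and `l + 1`. For neighbours the effect on the minors of a
-- Laplace expansion is easy to follow.
swapAt : ∀ {m} → Fin m → Fin (suc m) → Fin (suc m)
swapAt zero    zero          = suc zero
swapAt zero    (suc zero)    = zero
swapAt zero    (suc (suc j)) = suc (suc j)
swapAt (suc l) zero          = zero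
swapAt (suc l) (suc j)       = suc (swapAt l j)

swapAt-involutive : ∀ {m} (l : Fin m) j → swapAt l (swapAt l j) ≡ j
swapAt-involutive zero    zero          = refl
swapAt-involutive zero    (suc zero)    = refl
swapAt-involutive zero    (suc (suc j)) = refl
swapAt-involutive (suc l) zero          = refl
swapAt-involutive (suc l) (suc j)       = cong suc (swapAt-involutive l j)

swapAt-inject₁ : ∀ {m} (l : Fin m) → swapAt l (inject₁ l) ≡ suc l
swapAt-inject₁ zero    = refl
swapAt-inject₁ (suc l) = cong suc (swapAt-inject₁ l)

-- What a swap does to the minor that omits column `j`. If `j` is one of the swapped columns, the
-- minor is unchanged and only the sign moves by one place; otherwise the minor undergoes a swap of
-- its own, at `l′`.
data SwapView {m} (l : Fin (suc m)) (j : Fin (suc (suc m))) : Set where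
  moved : (toℕ (swapAt l j) ≡ suc (toℕ j)) ⊎ (toℕ j ≡ suc (toℕ (swapAt l j))) →
          (∀ k → swapAt l (punchIn (swapAt l j) k) ≡ punchIn j k) → SwapView l j
  fixed : swapAt l j ≡ j → (l′ : Fin m) →
          (∀ k → swapAt l (punchIn j k) ≡ punchIn j (swapAt l′ k)) → SwapView l j

swapView : ∀ {m} (l : Fin (suc m)) j → SwapView l j
swapView zero zero = moved (inj₁ refl) λ { zero → refl ; (suc k) → refl }
swapView zero (suc zero) = moved (inj₂ refl) λ { zero → refl ; (suc k) → refl }
swapView {suc m} zero (suc (suc j)) =
  fixed refl zero λ { zero → refl ; (suc zero) → refl ; (suc (suc k)) → refl }
swapView {suc m} (suc l) zero = fixed refl l λ _ → refl
swapView {suc m} (suc l) (suc j) with swapView l j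
... | moved (inj₁ eq) p = moved (inj₁ (cong suc eq)) λ { zero → refl ; (suc k) → cong suc (p k) }
... | moved (inj₂ eq) p = moved (inj₂ (cong suc eq)) λ { zero → refl ; (suc k) → cong suc (p k) }
... | fixed eq l′ p     = fixed (cong suc eq) (suc l′) λ { zero → refl ; (suc k) → cong suc (p k) }

module Determinant {c ℓ} (R : CommutativeRing c ℓ) where
  open CommutativeRing R hiding (zero) renaming (refl to ≈-refl; sym to ≈-sym; trans to ≈-trans)
  open CommutativeMonoidSum +-commutativeMonoid using (sum; sum-cong-≋)
  open RawSemiringDefs (Semiring.rawSemiring semiring) using (_^_)
  open GroupProperties +-group using (identityʳ-unique)
  open AbelianGroupProperties +-abelianGroup using (⁻¹-∙-comm; ε⁻¹≈ε; ⁻¹-involutive)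
  open RingProperties ring using (-‿distribˡ-*; -‿distribʳ-*)
  open import Algebra.Properties.CommutativeSemigroup +-commutativeSemigroup
    using () renaming (interchange to +-interchange)
  open import Algebra.Properties.CommutativeSemigroup *-commutativeSemigroup using (x∙yz≈y∙xz)
  open import Relation.Binary.Reasoning.Setoid setoid

  D : ∀ {m} → Matrix Carrier m → Carrier
  D = det rawRing

  minor : ∀ {m} → Matrix Carrier (suc m) → Fin (suc m) → Matrix Carrier m
  minor M j i k = M (suc i) (punchIn j k)

  sign : ℕ → Carrier
  sign k = (- 1#) ^ k

  det-cong : ∀ {m} (M M′ : Matrix Carrier m) → (∀ i j → M i j ≈ M′ i j) → D M ≈ D M′
  det-cong {zero}  M M′ M≈M′ = ≈-refl
  det-cong {suc m} M M′ M≈M′ = sum-cong-≋ λ j → *-congˡ {sign (toℕ j)}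
    (*-cong (M≈M′ zero j) (det-cong (minor M j) (minor M′ j) λ i k → M≈M′ (suc i) (punchIn j k)))

  sum-swapAt : ∀ {m} (l : Fin m) (f : Fin (suc m) → Carrier) → sum f ≈ sum (f ∘ swapAt l)
  sum-swapAt zero f = begin
    f zero + (f (suc zero) + rest)  ≈⟨ +-assoc _ _ _ ⟨
    f zero + f (suc zero) + rest    ≈⟨ +-congʳ (+-comm _ _) ⟩
    f (suc zero) + f zero + rest    ≈⟨ +-assoc _ _ _ ⟩
    f (suc zero) + (f zero + rest)  ∎
    where rest = sum λ j → f (suc (suc j))
  sum-swapAt (suc l) f = +-congˡ (sum-swapAt l (f ∘ suc))

  sum-neg : ∀ {m} (f : Fin m → Carrier) → sum (λ j → - f j) ≈ - sum f
  sum-neg {zero}  f = ≈-sym ε⁻¹≈ε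
  sum-neg {suc m} f = ≈-trans (+-congˡ (sum-neg (f ∘ suc))) (⁻¹-∙-comm _ _)

  sum-zero : ∀ {m} (f : Fin m → Carrier) → (∀ j → f j ≈ 0#) → sum f ≈ 0#
  sum-zero {zero}  f f≈0 = ≈-refl
  sum-zero {suc m} f f≈0 = ≈-trans (+-cong (f≈0 zero) (sum-zero (f ∘ suc) (f≈0 ∘ suc))) (+-identityˡ _)

  sign-suc : ∀ k → sign (suc k) ≈ - sign k
  sign-suc k = ≈-trans (≈-sym (-‿distribˡ-* 1# _)) (-‿cong (*-identityˡ _))

  sign-moved : ∀ {i j} → i ≡ suc j ⊎ j ≡ suc i → sign i ≈ - sign j
  sign-moved {j = j} (inj₁ refl) = sign-suc j
  sign-moved {i} (inj₂ refl) = ≈-trans (≈-sym (⁻¹-involutive _)) (-‿cong (≈-sym (sign-suc i)))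

  -- Reindexing the Laplace sum by the swap itself matches it term by term with the original: the
  -- sign changes in the moved terms, the minor, by induction, in the fixed ones.
  det-swapAt : ∀ {m} (l : Fin m) (M : Matrix Carrier (suc m)) → D (λ i j → M i (swapAt l j)) ≈ - D M
  det-swapAt {suc m} l M = begin
    D M′                                      ≈⟨ sum-swapAt l (term M′) ⟩
    sum (λ j → term M′ (swapAt l j))          ≈⟨ sum-cong-≋ (λ j → swapped j (swapView l j)) ⟩
    sum (λ j → - term M j)                    ≈⟨ sum-neg (term M) ⟩
    - D M                                     ∎
    where
    M′ : Matrix Carrier (suc (suc m))
    M′ i j = M i (swapAt l j)

    term : Matrix Carrier (suc (suc m)) → Fin (suc (suc m)) → Carrier
    term M j = sign (toℕ j) * (M zero j * D (minor M j))

    head : ∀ j → M′ zero (swapAt l j) ≈ M zero j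
    head j = reflexive (cong (M zero) (swapAt-involutive l j))

    swapped : ∀ j → SwapView l j → term M′ (swapAt l j) ≈ - term M j
    swapped j (moved far same) = begin
      sign (toℕ (swapAt l j)) * (M′ zero (swapAt l j) * D (minor M′ (swapAt l j)))
        ≈⟨ *-cong (sign-moved far) (*-cong (head j)
             (det-cong (minor M′ (swapAt l j)) (minor M j) λ i k → reflexive (cong (M (suc i)) (same k)))) ⟩
      - sign (toℕ j) * (M zero j * D (minor M j))
        ≈⟨ -‿distribˡ-* _ _ ⟨
      - term M j ∎
    swapped j (fixed eq l′ same) = begin
      sign (toℕ (swapAt l j)) * (M′ zero (swapAt l j) * D (minor M′ (swapAt l j)))
        ≈⟨ *-cong (reflexive (cong (sign ∘ toℕ) eq)) (*-cong (head j) (begin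
             D (minor M′ (swapAt l j))
               ≈⟨ det-cong (minor M′ (swapAt l j)) (λ i k → minor M j i (swapAt l′ k)) (λ i k → reflexive (cong (M (suc i))
                    (trans (cong (λ t → swapAt l (punchIn t k)) eq) (same k)))) ⟩
             D (λ i k → minor M j i (swapAt l′ k))
               ≈⟨ det-swapAt l′ (minor M j) ⟩
             - D (minor M j) ∎)) ⟩
      sign (toℕ j) * (M zero j * - D (minor M j))
        ≈⟨ *-congˡ (-‿distribʳ-* _ _) ⟨
      sign (toℕ j) * - (M zero j * D (minor M j))
        ≈⟨ -‿distribʳ-* _ _ ⟨
      - term M j ∎

  -- Antisymmetry would give only D = -D, which does not force D = 0 in every commutative ring.
  -- Instead the first two Laplace terms cancel, and each other minor again begins with two equal
  -- columns.
  det-equalCols₀₁ : ∀ {m} (M : Matrix Carrier (suc (suc m))) →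
    (∀ i → M i zero ≈ M i (suc zero)) → D M ≈ 0#
  det-equalCols₀₁ {m} M eq = begin
    1# * (M zero zero * D (minor M zero)) + ((- 1#) * 1# * (M zero (suc zero) * D (minor M (suc zero))) + rest)
      ≈⟨ +-cong (*-identityˡ _) (+-cong (*-cong (*-identityʳ _)
           (*-cong (≈-sym (eq zero)) (det-cong (minor M (suc zero)) (minor M zero) minors))) (sum-zero _ (others eq))) ⟩
    t + ((- 1#) * t + 0#)  ≈⟨ +-congˡ (+-identityʳ _) ⟩
    t + (- 1#) * t         ≈⟨ +-congˡ (≈-trans (≈-sym (-‿distribˡ-* 1# t)) (-‿cong (*-identityˡ t))) ⟩
    t + - t                ≈⟨ -‿inverseʳ t ⟩
    0#                     ∎
    where
    t = M zero zero * D (minor M zero)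
    rest = sum λ (j : Fin m) → sign (toℕ (Fin.suc (Fin.suc j))) * (M zero (suc (suc j)) * D (minor M (suc (suc j))))
    minors : ∀ i k → minor M (suc zero) i k ≈ minor M zero i k
    minors i zero    = eq (suc i)
    minors i (suc k) = ≈-refl
    others : (∀ i → M i zero ≈ M i (suc zero)) → ∀ (j : Fin m) →
      sign (toℕ (Fin.suc (Fin.suc j))) * (M zero (suc (suc j)) * D (minor M (suc (suc j)))) ≈ 0#
    others eq j = ≈-trans (*-congˡ (≈-trans (*-congˡ (vanishes j M eq)) (zeroʳ _))) (zeroʳ _)
      where
      vanishes : ∀ {m} (j : Fin m) (M : Matrix Carrier (suc (suc m))) →
        (∀ i → M i zero ≈ M i (suc zero)) → D (minor M (suc (suc j))) ≈ 0#
      vanishes {suc m} j M eq = det-equalCols₀₁ (minor M (suc (suc j))) λ i → eq (suc i)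

  det-equalCols : ∀ {m} (k : Fin m) (M : Matrix Carrier (suc m)) →
    (∀ i → M i zero ≈ M i (suc k)) → D M ≈ 0#
  det-equalCols k = go k (toℕ k) refl
    where
    -- The second column of the pair walks left by adjacent swaps until it is next to the first.
    -- `inject₁ k` is not a subterm of `suc k`, so the recursion runs on the number `t`.
    go : ∀ {m} (k : Fin m) t → toℕ k ≡ t → (M : Matrix Carrier (suc m)) →
      (∀ i → M i zero ≈ M i (suc k)) → D M ≈ 0#
    go zero    _       _    M eq = det-equalCols₀₁ M eq
    go (suc k) (suc t) refl M eq = begin
      D M      ≈⟨ ⁻¹-involutive _ ⟨
      - - D M  ≈⟨ -‿cong (det-swapAt (suc k) M) ⟨
      - D M′   ≈⟨ -‿cong (go (inject₁ k) t (Fin.toℕ-inject₁ k) M′ λ i →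
                    ≈-trans (eq i) (reflexive (cong (λ j → M i (suc j)) (sym (swapAt-inject₁ k))))) ⟩
      - 0#     ≈⟨ ε⁻¹≈ε ⟩
      0#       ∎
      where M′ = λ i j → M i (swapAt (suc k) j)

  replaceCol₀ : ∀ {m} → (Fin (suc m) → Carrier) → Matrix Carrier (suc m) → Matrix Carrier (suc m)
  replaceCol₀ c M i zero    = c i
  replaceCol₀ c M i (suc k) = M i (suc k)

  minor-replaceCol₀ : ∀ {m} c (M : Matrix Carrier (suc (suc m))) j →
    D (minor (replaceCol₀ c M) (suc j)) ≈ D (replaceCol₀ (c ∘ suc) (minor M (suc j)))
  minor-replaceCol₀ c M j = det-cong (minor (replaceCol₀ c M) (suc j)) (replaceCol₀ (c ∘ suc) (minor M (suc j))) λ { i zero → ≈-refl ; i (suc k) → ≈-refl }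

  sum-linear : ∀ {m} α (f g h : Fin m → Carrier) → (∀ j → h j ≈ α * f j + g j) →
    sum h ≈ α * sum f + sum g
  sum-linear {zero}  α f g h eq = ≈-sym (≈-trans (+-identityʳ _) (zeroʳ _))
  sum-linear {suc m} α f g h eq = begin
    h zero + sum (h ∘ suc)
      ≈⟨ +-cong (eq zero) (sum-linear α (f ∘ suc) (g ∘ suc) (h ∘ suc) (eq ∘ suc)) ⟩
    (α * f zero + g zero) + (α * sum (f ∘ suc) + sum (g ∘ suc))
      ≈⟨ +-interchange _ _ _ _ ⟩
    (α * f zero + α * sum (f ∘ suc)) + sum g
      ≈⟨ +-congʳ (distribˡ _ _ _) ⟨
    α * sum f + sum g ∎

  det-replaceCol₀-linear : ∀ {m} α a b (M : Matrix Carrier (suc m)) →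
    D (replaceCol₀ (λ i → α * a i + b i) M) ≈ α * D (replaceCol₀ a M) + D (replaceCol₀ b M)
  minor-replaceCol₀-linear : ∀ {m} α a b (M : Matrix Carrier (suc m)) (j : Fin m) →
    D (minor (replaceCol₀ (λ i → α * a i + b i) M) (suc j)) ≈
    α * D (minor (replaceCol₀ a M) (suc j)) + D (minor (replaceCol₀ b M) (suc j))

  det-replaceCol₀-linear {m} α a b M = sum-linear α (term a) (term b) (term λ i → α * a i + b i) λ
    { zero    → begin
      1# * ((α * a zero + b zero) * t)               ≈⟨ *-congˡ (distribʳ t _ _) ⟩
      1# * (α * a zero * t + b zero * t)             ≈⟨ distribˡ _ _ _ ⟩
      1# * (α * a zero * t) + 1# * (b zero * t)      ≈⟨ +-congʳ (*-congˡ (*-assoc _ _ _)) ⟩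
      1# * (α * (a zero * t)) + 1# * (b zero * t)    ≈⟨ +-congʳ (x∙yz≈y∙xz _ _ _) ⟩
      α * (1# * (a zero * t)) + 1# * (b zero * t)    ∎
    ; (suc j) → let s = sign (toℕ (Fin.suc j)) ; e = M zero (suc j)
                    x = D (minor (replaceCol₀ a M) (suc j)) ; y = D (minor (replaceCol₀ b M) (suc j)) in begin
      s * (e * D (minor (replaceCol₀ (λ i → α * a i + b i) M) (suc j)))
        ≈⟨ *-congˡ (*-congˡ (minor-replaceCol₀-linear α a b M j)) ⟩
      s * (e * (α * x + y))              ≈⟨ *-congˡ (distribˡ _ _ _) ⟩
      s * (e * (α * x) + e * y)          ≈⟨ distribˡ _ _ _ ⟩
      s * (e * (α * x)) + s * (e * y)    ≈⟨ +-congʳ (*-congˡ (x∙yz≈y∙xz _ _ _)) ⟩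
      s * (α * (e * x)) + s * (e * y)    ≈⟨ +-congʳ (x∙yz≈y∙xz _ _ _) ⟩
      α * (s * (e * x)) + s * (e * y)    ∎
    }
    where
    term : (Fin (suc m) → Carrier) → Fin (suc m) → Carrier
    term c j = sign (toℕ j) * (replaceCol₀ c M zero j * D (minor (replaceCol₀ c M) j))
    t = D (minor M zero)

  minor-replaceCol₀-linear {suc m} α a b M j = begin
    D (minor (replaceCol₀ (λ i → α * a i + b i) M) (suc j))
      ≈⟨ minor-replaceCol₀ _ M j ⟩
    D (replaceCol₀ (λ i → α * a (suc i) + b (suc i)) (minor M (suc j)))
      ≈⟨ det-replaceCol₀-linear α (a ∘ suc) (b ∘ suc) (minor M (suc j)) ⟩
    α * D (replaceCol₀ (a ∘ suc) (minor M (suc j))) + D (replaceCol₀ (b ∘ suc) (minor M (suc j)))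
      ≈⟨ +-cong (*-congˡ (minor-replaceCol₀ a M j)) (minor-replaceCol₀ b M j) ⟨
    α * D (minor (replaceCol₀ a M) (suc j)) + D (minor (replaceCol₀ b M) (suc j)) ∎

  replaceCol₀-cong : ∀ {m} a b (M : Matrix Carrier (suc m)) → (∀ i → a i ≈ b i) →
    D (replaceCol₀ a M) ≈ D (replaceCol₀ b M)
  replaceCol₀-cong a b M a≈b = det-cong (replaceCol₀ a M) (replaceCol₀ b M) λ { i zero → a≈b i ; i (suc k) → ≈-refl }

  -- Linearity in the first column, applied to 0 = 1 · 0 + 0, gives z = z + z.
  det-zeroCol₀ : ∀ {m} (M : Matrix Carrier (suc m)) → (∀ i → M i zero ≈ 0#) → D M ≈ 0#
  det-zeroCol₀ M M≈0 = begin
    D M                             ≈⟨ det-cong M (replaceCol₀ (λ _ → 0#) M) (λ { i zero → M≈0 i ; i (suc k) → ≈-refl }) ⟩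
    D (replaceCol₀ (λ _ → 0#) M)    ≈⟨ identityʳ-unique z z (≈-sym doubled) ⟩
    0#                              ∎
    where
    z = D (replaceCol₀ (λ _ → 0#) M)
    doubled : z ≈ z + z
    doubled = begin
      z                                         ≈⟨ replaceCol₀-cong _ _ M (λ _ → ≈-trans (+-identityʳ _) (*-identityˡ _)) ⟨
      D (replaceCol₀ (λ _ → 1# * 0# + 0#) M)    ≈⟨ det-replaceCol₀-linear 1# (λ _ → 0#) (λ _ → 0#) M ⟩
      1# * z + z                                ≈⟨ +-congʳ (*-identityˡ z) ⟩
      z + z                                     ∎

  -- Each further column contributes a determinant with a repeated column. Allowing any multiple `α`
  -- of the first column keeps elimination free of division.
  det-combineCols : ∀ {m} α (β : Fin m → Carrier) (M : Matrix Carrier (suc m)) →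
    D (replaceCol₀ (λ i → α * M i zero + sum λ k → β k * M i (suc k)) M) ≈ α * D M
  det-combineCols {m} α β M = begin
    D (replaceCol₀ (λ i → α * M i zero + sum λ k → β k * M i (suc k)) M)
      ≈⟨ det-replaceCol₀-linear α _ _ M ⟩
    α * D (replaceCol₀ (λ i → M i zero) M) + D (replaceCol₀ (λ i → sum λ k → β k * M i (suc k)) M)
      ≈⟨ +-cong (*-congˡ (det-cong (replaceCol₀ (λ i → M i zero) M) M λ { i zero → ≈-refl ; i (suc k) → ≈-refl })) (others β (λ k → k)) ⟩
    α * D M + 0#
      ≈⟨ +-identityʳ _ ⟩
    α * D M ∎
    where
    -- The selection `κ` of columns is general so that summands can be peeled off while `M` stays
    -- fixed.
    others : ∀ {q} (β : Fin q → Carrier) (κ : Fin q → Fin m) →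
      D (replaceCol₀ (λ i → sum λ k → β k * M i (suc (κ k))) M) ≈ 0#
    others {zero}  β κ = det-zeroCol₀ (replaceCol₀ (λ _ → 0#) M) λ _ → ≈-refl
    others {suc q} β κ = begin
      D (replaceCol₀ (λ i → sum λ k → β k * M i (suc (κ k))) M)
        ≈⟨ det-replaceCol₀-linear (β zero) _ _ M ⟩
      β zero * D (replaceCol₀ (λ i → M i (suc (κ zero))) M)
        + D (replaceCol₀ (λ i → sum λ k → β (suc k) * M i (suc (κ (suc k)))) M)
        ≈⟨ +-cong (≈-trans (*-congˡ (det-equalCols (κ zero) (replaceCol₀ (λ i → M i (suc (κ zero))) M) λ _ → ≈-refl)) (zeroʳ _))
             (others (β ∘ suc) (κ ∘ suc)) ⟩
      0# + 0#
        ≈⟨ +-identityʳ _ ⟩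
      0# ∎

  -- Every minor other than the one at the corner keeps the first column without its top entry, and
  -- that column is zero.
  det-expandCol₀ : ∀ {m} (M : Matrix Carrier (suc m)) → (∀ i → M (suc i) zero ≈ 0#) →
    D M ≈ M zero zero * D (minor M zero)
  det-expandCol₀ {m} M M≈0 = ≈-trans (+-cong (*-identityˡ _) (sum-zero (term ∘ suc) λ j →
    ≈-trans (*-congˡ (≈-trans (*-congˡ (vanishes j M M≈0)) (zeroʳ _))) (zeroʳ _))) (+-identityʳ _)
    where
    term : Fin (suc m) → Carrier
    term j = sign (toℕ j) * (M zero j * D (minor M j))
    vanishes : ∀ {m} (j : Fin m) (M : Matrix Carrier (suc m)) → (∀ i → M (suc i) zero ≈ 0#) →
      D (minor M (suc j)) ≈ 0#
    vanishes {suc m} j M M≈0 = det-zeroCol₀ (minor M (suc j)) M≈0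

-- The determinant of y I - b J with a border

module Bordered {c ℓ} (R : CommutativeRing c ℓ)
  (φ : ℤ.+-*-rawRing ACR.-Raw-AlmostCommutative⟶ ACR.fromCommutativeRing R)
  (x y b : CommutativeRing.Carrier R) where

  open CommutativeRing R hiding (zero) renaming (refl to ≈-refl; sym to ≈-sym; trans to ≈-trans)
  open CommutativeMonoidSum +-commutativeMonoid using (sum; sum-cong-≋)
  open RawSemiringDefs (Semiring.rawSemiring semiring) using (_^_)
  open Determinant R
  open import Relation.Binary.Reasoning.Setoid setoid

  private
    ⟦⟧-≟ : ∀ i j → Maybe (ACR._-Raw-AlmostCommutative⟶_.⟦_⟧ φ i ≈ ACR._-Raw-AlmostCommutative⟶_.⟦_⟧ φ j)
    ⟦⟧-≟ i j = Maybe.map (λ i≡j → reflexive (cong (ACR._-Raw-AlmostCommutative⟶_.⟦_⟧ φ) i≡j)) (dec⇒maybe (i ℤ.≟ j))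

    module Solver = RingSolver ℤ.+-*-rawRing (ACR.fromCommutativeRing R) φ ⟦⟧-≟
    open Solver using (solve; _:+_; _:*_; :-_; _:=_)

  fromℕ : ℕ → Carrier
  fromℕ m = sum {m} λ _ → 1#

  sum-const : ∀ m d → sum {m} (λ _ → d) ≈ fromℕ m * d
  sum-const zero    d = ≈-sym (zeroˡ d)
  sum-const (suc m) d = begin
    d + sum {m} (λ _ → d)   ≈⟨ +-cong (≈-sym (*-identityˡ d)) (sum-const m d) ⟩
    1# * d + fromℕ m * d    ≈⟨ distribʳ d 1# (fromℕ m) ⟨
    (1# + fromℕ m) * d      ∎

  -- Given by recursion and not by comparing indices, so that deleting the first row and column
  -- yields the next smaller matrix by computation.
  yI-bJ : ∀ {m} → Matrix Carrier m
  yI-bJ zero    zero    = y + - b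
  yI-bJ zero    (suc j) = - b
  yI-bJ (suc i) zero    = - b
  yI-bJ (suc i) (suc j) = yI-bJ i j

  bordered : ∀ {m} → (Fin m → Carrier) → Matrix Carrier (suc m)
  bordered v zero    zero    = x
  bordered v zero    (suc j) = - v j
  bordered v (suc i) zero    = - v i
  bordered v (suc i) (suc j) = yI-bJ i j

  sum-*-neg : ∀ {m} (f g : Fin m → Carrier) → sum (λ k → f k * - g k) ≈ - sum (λ k → f k * g k)
  sum-*-neg f g = ≈-trans (sum-cong-≋ λ k → solve 2 (λ f g → f :* (:- g) := :- (f :* g)) ≈-refl (f k) (g k))
    (sum-neg (λ k → f k * g k))

  sum-*-const : ∀ {m} d (f : Fin m → Carrier) → sum (λ k → f k * d) ≈ d * sum f
  sum-*-const {zero}  d f = ≈-sym (zeroʳ d)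
  sum-*-const {suc m} d f = ≈-trans (+-cong (*-comm _ _) (sum-*-const d (f ∘ suc))) (≈-sym (distribˡ d _ _))

  yI-bJ-row : ∀ {m} (β : Fin m → Carrier) i → sum (λ k → β k * yI-bJ i k) ≈ y * β i + - (b * sum β)
  yI-bJ-row β zero = begin
    β zero * (y + - b) + sum (λ k → β (suc k) * - b)
      ≈⟨ +-congˡ (sum-*-const (- b) (β ∘ suc)) ⟩
    β zero * (y + - b) + - b * sum (β ∘ suc)
      ≈⟨ solve 4 (λ y b β₀ s → β₀ :* (y :+ (:- b)) :+ (:- b) :* s := y :* β₀ :+ (:- (b :* (β₀ :+ s))))
           ≈-refl y b (β zero) (sum (β ∘ suc)) ⟩
    y * β zero + - (b * sum β) ∎
  yI-bJ-row β (suc i) = begin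
    β zero * - b + sum (λ k → β (suc k) * yI-bJ i k)
      ≈⟨ +-congˡ (yI-bJ-row (β ∘ suc) i) ⟩
    β zero * - b + (y * β (suc i) + - (b * sum (β ∘ suc)))
      ≈⟨ solve 5 (λ y b β₀ βᵢ s → β₀ :* (:- b) :+ (y :* βᵢ :+ (:- (b :* s))) := y :* βᵢ :+ (:- (b :* (β₀ :+ s))))
           ≈-refl y b (β zero) (β (suc i)) (sum (β ∘ suc)) ⟩
    y * β (suc i) + - (b * sum β) ∎

  -- The common row sum of the `m` by `m` matrix `yI-bJ`, that is, its eigenvalue on the all-ones
  -- vector.
  w : ℕ → Carrier
  w m = y + - (fromℕ m * b)

  onesCol : ∀ m → Carrier
  onesCol m = D (replaceCol₀ (λ _ → 1#) (yI-bJ {suc m}))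

  -- Adding all other columns to the first turns it into the constant column of row sums.
  det-yI-bJ-onesCol : ∀ m → D (yI-bJ {suc m}) ≈ w (suc m) * onesCol m
  det-yI-bJ-onesCol m = begin
    D A′
      ≈⟨ *-identityˡ _ ⟨
    1# * D A′
      ≈⟨ det-combineCols 1# (λ _ → 1#) A′ ⟨
    D (replaceCol₀ (λ i → 1# * A′ i zero + sum (λ k → 1# * A′ i (suc k))) A′)
      ≈⟨ replaceCol₀-cong _ _ A′ column ⟩
    D (replaceCol₀ (λ _ → w (suc m) * 1# + 0#) A′)
      ≈⟨ det-replaceCol₀-linear (w (suc m)) _ _ A′ ⟩
    w (suc m) * onesCol m + D (replaceCol₀ (λ _ → 0#) A′)
      ≈⟨ +-congˡ (det-zeroCol₀ (replaceCol₀ (λ _ → 0#) A′) λ _ → ≈-refl) ⟩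
    w (suc m) * onesCol m + 0#
      ≈⟨ +-identityʳ _ ⟩
    w (suc m) * onesCol m ∎
    where
    A′ = yI-bJ {suc m}
    column : ∀ i → sum (λ k → 1# * A′ i k) ≈ w (suc m) * 1# + 0#
    column i = begin
      sum (λ k → 1# * A′ i k)                 ≈⟨ yI-bJ-row (λ _ → 1#) i ⟩
      y * 1# + - (b * fromℕ (suc m))          ≈⟨ +-cong (*-identityʳ y) (-‿cong (*-comm b _)) ⟩
      w (suc m)                               ≈⟨ *-identityʳ _ ⟨
      w (suc m) * 1#                          ≈⟨ +-identityʳ _ ⟨
      w (suc m) * 1# + 0#                     ∎

  -- Subtracting all other columns from `w m` times the column of ones leaves zero below the corner,
  -- since `w m` is the row sum of the smaller matrix, and w + m b = y in the corner.
  onesCol-yI-bJ : ∀ m → w m * onesCol m ≈ y * D (yI-bJ {m})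
  onesCol-yI-bJ m = begin
    w m * D Z
      ≈⟨ det-combineCols (w m) (λ _ → - 1#) Z ⟨
    D (replaceCol₀ (λ i → w m * 1# + sum (λ k → - 1# * yI-bJ {suc m} i (suc k))) Z)
      ≈⟨ det-expandCol₀ (replaceCol₀ (λ i → w m * 1# + sum (λ k → - 1# * yI-bJ {suc m} i (suc k))) Z) below ⟩
    (w m * 1# + sum {m} (λ k → - 1# * - b)) * D (yI-bJ {m})
      ≈⟨ *-congʳ top ⟩
    y * D (yI-bJ {m}) ∎
    where
    Z = replaceCol₀ (λ _ → 1#) (yI-bJ {suc m})
    top : w m * 1# + sum {m} (λ k → - 1# * - b) ≈ y
    top = begin
      w m * 1# + sum {m} (λ k → - 1# * - b)
        ≈⟨ +-cong (*-identityʳ _) (sum-const m _) ⟩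
      w m + fromℕ m * (- 1# * - b)
        ≈⟨ +-congˡ (*-congˡ (solve 2 (λ o b → (:- o) :* (:- b) := o :* b) ≈-refl 1# b)) ⟩
      w m + fromℕ m * (1# * b)
        ≈⟨ +-congˡ (*-congˡ (*-identityˡ b)) ⟩
      w m + fromℕ m * b
        ≈⟨ solve 2 (λ y t → y :+ (:- t) :+ t := y) ≈-refl y (fromℕ m * b) ⟩
      y ∎
    below : ∀ i → w m * 1# + sum (λ k → - 1# * yI-bJ i k) ≈ 0#
    below i = begin
      w m * 1# + sum (λ k → - 1# * yI-bJ i k)
        ≈⟨ +-congˡ (yI-bJ-row (λ _ → - 1#) i) ⟩
      w m * 1# + (y * - 1# + - (b * sum {m} (λ _ → - 1#)))
        ≈⟨ +-congˡ (+-congˡ (-‿cong (*-congˡ (sum-neg {m} (λ _ → 1#))))) ⟩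
      w m * 1# + (y * - 1# + - (b * - fromℕ m))
        ≈⟨ solve 4 (λ y s b o → (y :+ (:- (s :* b))) :* o :+ (y :* (:- o) :+ (:- (b :* (:- s))))
                     := s :* b :+ (:- (s :* b :* o))) ≈-refl y (fromℕ m) b 1# ⟩
      fromℕ m * b + - (fromℕ m * b * 1#)
        ≈⟨ +-congˡ (-‿cong (*-identityʳ _)) ⟩
      fromℕ m * b + - (fromℕ m * b)
        ≈⟨ -‿inverseʳ _ ⟩
      0# ∎

  Cancellable : Carrier → Set _
  Cancellable a = ∀ p q → a * p ≈ a * q → p ≈ q

  -- Passing through `onesCol` relates consecutive sizes: `w m` times the determinant of size m + 1
  -- is `w (suc m) * y` times that of size m. Cancelling `w m` gives the induction.
  det-yI-bJ : (∀ m → Cancellable (w m)) → ∀ m → D (yI-bJ {suc m}) ≈ w (suc m) * y ^ m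
  det-yI-bJ cancel zero    = begin
    1# * ((y + - b) * 1#) + 0#   ≈⟨ ≈-trans (+-identityʳ _) (*-identityˡ _) ⟩
    (y + - b) * 1#               ≈⟨ *-congʳ (+-congˡ (-‿cong (≈-sym (≈-trans (*-congʳ (+-identityʳ 1#)) (*-identityˡ b))))) ⟩
    w 1 * 1#                     ∎
  det-yI-bJ cancel (suc m) = cancel (suc m) _ _ (begin
    w (suc m) * D (yI-bJ {suc (suc m)})                  ≈⟨ *-congˡ (det-yI-bJ-onesCol (suc m)) ⟩
    w (suc m) * (w (suc (suc m)) * onesCol (suc m))  ≈⟨ solve 3 (λ u v z → u :* (v :* z) := v :* (u :* z)) ≈-refl (w (suc m)) (w (suc (suc m))) (onesCol (suc m)) ⟩
    w (suc (suc m)) * (w (suc m) * onesCol (suc m))  ≈⟨ *-congˡ (onesCol-yI-bJ (suc m)) ⟩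
    w (suc (suc m)) * (y * D (yI-bJ {suc m}))            ≈⟨ *-congˡ (*-congˡ (det-yI-bJ cancel m)) ⟩
    w (suc (suc m)) * (y * (w (suc m) * y ^ m))      ≈⟨ solve 4 (λ u v y z → v :* (y :* (u :* z)) := u :* (v :* (y :* z))) ≈-refl (w (suc m)) (w (suc (suc m))) y (y ^ m) ⟩
    w (suc m) * (w (suc (suc m)) * (y * y ^ m))      ∎)

  -- `y * w m` times the Schur complement x - vᵀ(yI - bJ)⁻¹v, where P = Σ v², S = Σ v and the
  -- inverse is (I + (b / w) J) / y.
  cubic : ℕ → Carrier → Carrier → Carrier
  cubic m P S = x * y * w m + - (w m * P + b * (S * S))

  -- The combination of columns making the first column vanish below the corner is
  -- read off from the solution z = w v + b S 1 of (y I − b J) z = y w v.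
  det-bordered-yI-bJ : ∀ {m} (v : Fin m → Carrier) →
    y * w m * D (bordered v) ≈ cubic m (sum λ k → v k * v k) (sum v) * D (yI-bJ {m})
  det-bordered-yI-bJ {m} v = begin
    y * w m * D M
      ≈⟨ det-combineCols (y * w m) z M ⟨
    D (replaceCol₀ (λ i → y * w m * M i zero + sum (λ k → z k * M i (suc k))) M)
      ≈⟨ det-expandCol₀ (replaceCol₀ (λ i → y * w m * M i zero + sum (λ k → z k * M i (suc k))) M) below ⟩
    (y * w m * x + sum (λ k → z k * - v k)) * D (yI-bJ {m})
      ≈⟨ *-congʳ top ⟩
    cubic m P S * D (yI-bJ {m}) ∎
    where
    M = bordered v
    S = sum v
    P = sum λ k → v k * v k
    z = λ k → w m * v k + b * S
    sum-z : sum z ≈ w m * S + fromℕ m * (b * S)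
    sum-z = ≈-trans (sum-linear (w m) v (λ _ → b * S) z (λ _ → ≈-refl)) (+-congˡ (sum-const m (b * S)))
    sum-zv : sum (λ k → z k * v k) ≈ w m * P + b * S * S
    sum-zv = ≈-trans (sum-linear (w m) (λ k → v k * v k) (λ k → v k * (b * S)) _ λ k →
        solve 3 (λ w v t → (w :* v :+ t) :* v := w :* (v :* v) :+ v :* t) ≈-refl (w m) (v k) (b * S))
      (+-congˡ (sum-*-const (b * S) v))
    top : y * w m * x + sum (λ k → z k * - v k) ≈ cubic m P S
    top = begin
      y * w m * x + sum (λ k → z k * - v k)    ≈⟨ +-congˡ (sum-*-neg z v) ⟩
      y * w m * x + - sum (λ k → z k * v k)    ≈⟨ +-congˡ (-‿cong sum-zv) ⟩
      y * w m * x + - (w m * P + b * S * S)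
        ≈⟨ solve 6 (λ x y w P b S → y :* w :* x :+ (:- (w :* P :+ b :* S :* S))
                     := x :* y :* w :+ (:- (w :* P :+ b :* (S :* S)))) ≈-refl x y (w m) P b S ⟩
      cubic m P S ∎
    below : ∀ i → y * w m * - v i + sum (λ k → z k * yI-bJ i k) ≈ 0#
    below i = begin
      y * w m * - v i + sum (λ k → z k * yI-bJ i k)
        ≈⟨ +-congˡ (yI-bJ-row z i) ⟩
      y * w m * - v i + (y * z i + - (b * sum z))
        ≈⟨ +-congˡ (+-congˡ (-‿cong (*-congˡ sum-z))) ⟩
      y * w m * - v i + (y * z i + - (b * (w m * S + fromℕ m * (b * S))))
        -- Unfolding `w` is what makes this vanish: the terms in b S carry the factor y - w - m b =
        -- 0.
        ≈⟨ solve 5 (λ y s b v S → let w = y :+ (:- (s :* b)) in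
             y :* w :* (:- v) :+ (y :* (w :* v :+ b :* S) :+ (:- (b :* (w :* S :+ s :* (b :* S)))))
               := y :+ (:- y)) ≈-refl y (fromℕ m) b (v i) S ⟩
      y + - y
        ≈⟨ -‿inverseʳ y ⟩
      0# ∎

  -- The determinant of the inner block supplies w yᵐ⁺¹, and cancelling the factor y w on the left
  -- leaves yᵐ.
  det-bordered : Cancellable y → (∀ m → Cancellable (w m)) → ∀ {m} (v : Fin (suc (suc m)) → Carrier) →
    D (bordered v) ≈ y ^ m * cubic (suc (suc m)) (sum λ k → v k * v k) (sum v)
  det-bordered cancel-y cancel {m} v = cancel-y _ _ (cancel (suc (suc m)) _ _ (begin
    w′ * (y * D (bordered v))         ≈⟨ solve 3 (λ w y d → w :* (y :* d) := y :* w :* d) ≈-refl w′ y (D (bordered v)) ⟩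
    y * w′ * D (bordered v)           ≈⟨ det-bordered-yI-bJ v ⟩
    Q * D (yI-bJ {suc (suc m)})           ≈⟨ *-congˡ (det-yI-bJ cancel (suc m)) ⟩
    Q * (w′ * (y * y ^ m))            ≈⟨ solve 4 (λ Q w y z → Q :* (w :* (y :* z)) := w :* (y :* (z :* Q))) ≈-refl Q w′ y (y ^ m) ⟩
    w′ * (y * (y ^ m * Q))            ∎))
    where
    w′ = w (suc (suc m))
    Q = cubic (suc (suc m)) (sum λ k → v k * v k) (sum v)

-- The characteristic polynomial and its cubic factor

open CommutativeMonoidSum ℤ.+-0-commutativeMonoid using () renaming (sum to sumℤ)

X+2 : Poly
X+2 = + 2 ∷ 1ℤ ∷ []

open CommutativeRing polyRing using () renaming (+-commutativeMonoid to +ₚ-commutativeMonoid; semiring to polySemiring)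
open CommutativeMonoidSum +ₚ-commutativeMonoid using () renaming (sum to sumₚ)
open Bordered polyRing constₚ-homo X X+2 (constₚ (+ 2)) using (bordered; det-bordered; w; cubic; fromℕ; yI-bJ)
open RawSemiringDefs (Semiring.rawSemiring polySemiring) using () renaming (_^_ to _^ₚ_)

sum-constₚ : ∀ {m} (v : Fin m → ℤ) → sumₚ (λ k → constₚ (v k)) ≋ constₚ (sumℤ v)
sum-constₚ {zero}  v zero    = refl
sum-constₚ {zero}  v (suc k) = refl
sum-constₚ {suc m} v = +ₚ-cong {constₚ (v zero)} {constₚ (v zero)} {sumₚ (constₚ ∘ v ∘ suc)} {constₚ (sumℤ (v ∘ suc))} (λ _ → refl) (sum-constₚ (v ∘ suc))

sumℤ-1 : ∀ m → sumℤ {m} (λ _ → 1ℤ) ≡ + m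
sumℤ-1 zero    = refl
sumℤ-1 (suc m) = cong (ℤ._+_ 1ℤ) (sumℤ-1 m)

fromℕ-constₚ : ∀ m → fromℕ m ≋ constₚ (+ m)
fromℕ-constₚ m k = trans (sum-constₚ {m} (λ _ → 1ℤ) k) (cong (λ a → coeff (constₚ a) k) (sumℤ-1 m))

-- The constant term 2 - 2m of `w m`, in the unreduced shape that list arithmetic produces.
slope : ℕ → ℤ
slope m = + 2 ℤ.+ ℤ.- (+ m ℤ.* + 2 ℤ.+ 0ℤ)

w-linear : ∀ m → w m ≋ slope m ∷ 1ℤ ∷ []
w-linear m = +ₚ-cong {X+2} {X+2} { -ₚ (fromℕ m *ₚ constₚ (+ 2))} { -ₚ (constₚ (+ m) *ₚ constₚ (+ 2))} (λ _ → refl)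
  (-ₚ-cong {fromℕ m *ₚ constₚ (+ 2)} {constₚ (+ m) *ₚ constₚ (+ 2)}
    (*ₚ-cong {fromℕ m} {constₚ (+ m)} {constₚ (+ 2)} {constₚ (+ 2)} (fromℕ-constₚ m) (λ _ → refl)))

w-cancellable : ∀ m p q → w m *ₚ p ≋ w m *ₚ q → p ≋ q
w-cancellable m p q eq = linear-cancelˡ (slope m) p q λ k →
  trans (sym (w* p k)) (trans (eq k) (w* q k))
  where
  w* : ∀ r → w m *ₚ r ≋ (slope m ∷ 1ℤ ∷ []) *ₚ r
  w* r = *ₚ-cong {w m} {slope m ∷ 1ℤ ∷ []} {r} {r} (w-linear m) (λ _ → refl)

cubic-coeffs : ∀ m P S p s → P ≋ constₚ p → S ≋ constₚ s →
  cubic m P S ≋ (slope m ℤ.* (ℤ.- p) ℤ.- + 2 ℤ.* (s ℤ.* s)) ∷ (slope m ℤ.* + 2 ℤ.- p) ∷ (slope m ℤ.+ + 2) ∷ 1ℤ ∷ []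
cubic-coeffs m P S p s P≋p S≋s k = trans (regroup k) (trans (substitute k) (coefficients k))
  where
  open Poly-Solver
  b = constₚ (+ 2)
  l = slope m ∷ 1ℤ ∷ []
  -- Collecting the linear factor `w m` lets every coefficient be read off from the rule for
  -- products with a linear polynomial.
  regroup : cubic m P S ≋ (w m *ₚ ((X *ₚ X+2) +ₚ (-ₚ P))) +ₚ (-ₚ (b *ₚ (S *ₚ S)))
  regroup = solve 6 (λ x y w P b S → x :* y :* w :+ (:- (w :* P :+ b :* (S :* S)))
    := w :* (x :* y :+ (:- P)) :+ (:- (b :* (S :* S)))) (λ _ → refl) X X+2 (w m) P b S
  substitute : (w m *ₚ ((X *ₚ X+2) +ₚ (-ₚ P))) +ₚ (-ₚ (b *ₚ (S *ₚ S))) ≋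
               (l *ₚ ((X *ₚ X+2) +ₚ (-ₚ constₚ p))) +ₚ (-ₚ (b *ₚ (constₚ s *ₚ constₚ s)))
  substitute = +ₚ-cong {w m *ₚ ((X *ₚ X+2) +ₚ (-ₚ P))} {l *ₚ ((X *ₚ X+2) +ₚ (-ₚ constₚ p))}
                       { -ₚ (b *ₚ (S *ₚ S))} { -ₚ (b *ₚ (constₚ s *ₚ constₚ s))}
    (*ₚ-cong {w m} {l} {(X *ₚ X+2) +ₚ (-ₚ P)} {(X *ₚ X+2) +ₚ (-ₚ constₚ p)} (w-linear m)
      (+ₚ-cong {X *ₚ X+2} {X *ₚ X+2} { -ₚ P} { -ₚ constₚ p} (λ _ → refl) (-ₚ-cong {P} {constₚ p} P≋p)))
    (-ₚ-cong {b *ₚ (S *ₚ S)} {b *ₚ (constₚ s *ₚ constₚ s)} (*ₚ-congˡ b {S *ₚ S} {constₚ s *ₚ constₚ s} (*ₚ-cong {S} {constₚ s} {S} {constₚ s} S≋s S≋s)))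
  q = (X *ₚ X+2) +ₚ (-ₚ constₚ p)
  r = -ₚ (b *ₚ (constₚ s *ₚ constₚ s))
  coefficients : (l *ₚ q) +ₚ r ≋
    (slope m ℤ.* (ℤ.- p) ℤ.- + 2 ℤ.* (s ℤ.* s)) ∷ (slope m ℤ.* + 2 ℤ.- p) ∷ (slope m ℤ.+ + 2) ∷ 1ℤ ∷ []
  coefficients 0 = trans (coeff-+ₚ (l *ₚ q) r 0) (trans (cong (ℤ._+ coeff r 0) (coeff-linear-zero (slope m) q)) (eq (slope m) p s))
    where
    eq : ∀ c p s → c ℤ.* (0ℤ ℤ.+ ℤ.- p) ℤ.+ ℤ.- (+ 2 ℤ.* (s ℤ.* s ℤ.+ 0ℤ) ℤ.+ 0ℤ) ≡ c ℤ.* (ℤ.- p) ℤ.- + 2 ℤ.* (s ℤ.* s)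
    eq = ℤ-Solver.solve-∀
  coefficients 1 = trans (coeff-+ₚ (l *ₚ q) r 1) (trans (cong (ℤ._+ 0ℤ) (coeff-linear-suc (slope m) q 0)) (eq (slope m) p))
    where
    eq : ∀ c p → c ℤ.* + 2 ℤ.+ (0ℤ ℤ.+ ℤ.- p) ℤ.+ 0ℤ ≡ c ℤ.* + 2 ℤ.- p
    eq = ℤ-Solver.solve-∀
  coefficients 2 = trans (coeff-+ₚ (l *ₚ q) r 2) (trans (cong (ℤ._+ 0ℤ) (coeff-linear-suc (slope m) q 1)) (eq (slope m)))
    where
    eq : ∀ c → c ℤ.* 1ℤ ℤ.+ + 2 ℤ.+ 0ℤ ≡ c ℤ.+ + 2
    eq = ℤ-Solver.solve-∀
  coefficients 3 = trans (coeff-+ₚ (l *ₚ q) r 3) (trans (cong (ℤ._+ 0ℤ) (coeff-linear-suc (slope m) q 2)) (eq (slope m)))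
    where
    eq : ∀ c → c ℤ.* 0ℤ ℤ.+ 1ℤ ℤ.+ 0ℤ ≡ 1ℤ
    eq = ℤ-Solver.solve-∀
  coefficients (suc (suc (suc (suc k)))) =
    trans (coeff-+ₚ (l *ₚ q) r (4 ℕ.+ k)) (trans (cong (ℤ._+ 0ℤ) (coeff-linear-suc (slope m) q (3 ℕ.+ k))) (eq (slope m)))
    where
    eq : ∀ c → c ℤ.* 0ℤ ℤ.+ 0ℤ ℤ.+ 0ℤ ≡ 0ℤ
    eq = ℤ-Solver.solve-∀

-- The inner block of xI - N has diagonal x = (x + 2) - 2 and -2 elsewhere, so it is (x + 2)I - 2J.
charPoly-bordered : ∀ {k} (N : Matrix ℤ (3 ℕ.+ k)) (v : Fin (2 ℕ.+ k) → ℤ) →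
  N zero zero ≡ 0ℤ → (∀ j → N zero (suc j) ≡ v j) → (∀ i → N (suc i) zero ≡ v i) →
  (∀ i → N (suc i) (suc i) ≡ 0ℤ) → (∀ i j → i ≢ j → N (suc i) (suc j) ≡ + 2) →
  charPoly N ≋ (X+2 ^ₚ k) *ₚ cubic (2 ℕ.+ k) (sumₚ λ i → constₚ (v i) *ₚ constₚ (v i)) (sumₚ (constₚ ∘ v))
charPoly-bordered {k} N v corner row col diag offDiag j =
  trans (Determinant.det-cong polyRing (charMatrix N) (bordered (constₚ ∘ v)) entries j)
    (det-bordered (linear-cancelˡ (+ 2)) w-cancellable (constₚ ∘ v) j)
  where
  yI-bJ-diag : ∀ {m} (i : Fin m) → yI-bJ i i ≡ X
  yI-bJ-diag zero    = refl
  yI-bJ-diag (suc i) = yI-bJ-diag i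
  yI-bJ-offDiag : ∀ {m} (i j : Fin m) → i ≢ j → yI-bJ i j ≡ -ₚ constₚ (+ 2)
  yI-bJ-offDiag zero    zero    i≢j = contradiction refl i≢j
  yI-bJ-offDiag zero    (suc j) i≢j = refl
  yI-bJ-offDiag (suc i) zero    i≢j = refl
  yI-bJ-offDiag (suc i) (suc j) i≢j = yI-bJ-offDiag i j (i≢j ∘ cong suc)
  entries : ∀ i j → charMatrix N i j ≋ bordered (constₚ ∘ v) i j
  entries i j k with i Fin.≟ j
  entries zero    zero    k | yes _ rewrite corner = refl
  entries (suc i) (suc i) k | yes refl rewrite diag i | yI-bJ-diag i = refl
  entries zero    zero    k | no ≢ = contradiction refl ≢
  entries zero    (suc j) k | no _ rewrite row j = refl
  entries (suc i) zero    k | no _ rewrite col i = refl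
  entries (suc i) (suc j) k | no ≢ rewrite offDiag i j (≢ ∘ cong suc) | yI-bJ-offDiag i j (≢ ∘ cong suc) = refl

-- Here `δ` is the 0-1 indicator of the edges on the path of f, so d + 1 - 2δ takes the values d - 1
-- and d + 1.
sum-border : ∀ {m} d (v δ : Fin m → ℤ) → (∀ i → v i ≡ d ℤ.+ 1ℤ ℤ.- + 2 ℤ.* δ i) →
  sumℤ v ≡ + m ℤ.* (d ℤ.+ 1ℤ) ℤ.- + 2 ℤ.* sumℤ δ
sum-border {zero}  d v δ v≡ = refl
sum-border {suc m} d v δ v≡ = trans (cong₂ ℤ._+_ (v≡ zero) (sum-border d (v ∘ suc) (δ ∘ suc) (v≡ ∘ suc)))
  (eq (+ m) d (δ zero) (sumℤ (δ ∘ suc)))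
  where
  eq : ∀ m d e s → (d ℤ.+ 1ℤ ℤ.- + 2 ℤ.* e) ℤ.+ (m ℤ.* (d ℤ.+ 1ℤ) ℤ.- + 2 ℤ.* s) ≡
    (1ℤ ℤ.+ m) ℤ.* (d ℤ.+ 1ℤ) ℤ.- + 2 ℤ.* (e ℤ.+ s)
  eq = ℤ-Solver.solve-∀

-- Since δ² = δ, the square v² = (d + 1)² - 4dδ is again linear in δ. The `+ 0ℤ` is what the product
-- of two constant polynomials leaves behind.
sum-border² : ∀ {m} d (v δ : Fin m → ℤ) → (∀ i → v i ≡ d ℤ.+ 1ℤ ℤ.- + 2 ℤ.* δ i) → (∀ i → δ i ℤ.* δ i ≡ δ i) →
  sumℤ (λ i → v i ℤ.* v i ℤ.+ 0ℤ) ≡ + m ℤ.* ((d ℤ.+ 1ℤ) ℤ.* (d ℤ.+ 1ℤ)) ℤ.- + 4 ℤ.* d ℤ.* sumℤ δ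
sum-border² {zero}  d v δ v≡ δ² = eq d
  where
  eq : ∀ d → 0ℤ ≡ 0ℤ ℤ.* ((d ℤ.+ 1ℤ) ℤ.* (d ℤ.+ 1ℤ)) ℤ.- + 4 ℤ.* d ℤ.* 0ℤ
  eq = ℤ-Solver.solve-∀
sum-border² {suc m} d v δ v≡ δ² = trans (cong₂ ℤ._+_ square (sum-border² d (v ∘ suc) (δ ∘ suc) (v≡ ∘ suc) (δ² ∘ suc)))
  (eq (+ m) d (δ zero) (sumℤ (δ ∘ suc)))
  where
  eq : ∀ m d e s → ((d ℤ.+ 1ℤ) ℤ.* (d ℤ.+ 1ℤ) ℤ.- + 4 ℤ.* d ℤ.* e) ℤ.+ (m ℤ.* ((d ℤ.+ 1ℤ) ℤ.* (d ℤ.+ 1ℤ)) ℤ.- + 4 ℤ.* d ℤ.* s) ≡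
    (1ℤ ℤ.+ m) ℤ.* ((d ℤ.+ 1ℤ) ℤ.* (d ℤ.+ 1ℤ)) ℤ.- + 4 ℤ.* d ℤ.* (e ℤ.+ s)
  eq = ℤ-Solver.solve-∀
  expand : ∀ d e → (d ℤ.+ 1ℤ ℤ.- + 2 ℤ.* e) ℤ.* (d ℤ.+ 1ℤ ℤ.- + 2 ℤ.* e) ℤ.+ 0ℤ ≡
    (d ℤ.+ 1ℤ) ℤ.* (d ℤ.+ 1ℤ) ℤ.- + 4 ℤ.* (d ℤ.+ 1ℤ) ℤ.* e ℤ.+ + 4 ℤ.* (e ℤ.* e)
  expand = ℤ-Solver.solve-∀
  collect : ∀ d e → (d ℤ.+ 1ℤ) ℤ.* (d ℤ.+ 1ℤ) ℤ.- + 4 ℤ.* (d ℤ.+ 1ℤ) ℤ.* e ℤ.+ + 4 ℤ.* e ≡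
    (d ℤ.+ 1ℤ) ℤ.* (d ℤ.+ 1ℤ) ℤ.- + 4 ℤ.* d ℤ.* e
  collect = ℤ-Solver.solve-∀
  square : v zero ℤ.* v zero ℤ.+ 0ℤ ≡ (d ℤ.+ 1ℤ) ℤ.* (d ℤ.+ 1ℤ) ℤ.- + 4 ℤ.* d ℤ.* δ zero
  square = begin
    v zero ℤ.* v zero ℤ.+ 0ℤ  ≡⟨ cong (λ t → t ℤ.* t ℤ.+ 0ℤ) (v≡ zero) ⟩
    _                         ≡⟨ expand d (δ zero) ⟩
    (d ℤ.+ 1ℤ) ℤ.* (d ℤ.+ 1ℤ) ℤ.- + 4 ℤ.* (d ℤ.+ 1ℤ) ℤ.* δ zero ℤ.+ + 4 ℤ.* (δ zero ℤ.* δ zero)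
      ≡⟨ cong (λ t → (d ℤ.+ 1ℤ) ℤ.* (d ℤ.+ 1ℤ) ℤ.- + 4 ℤ.* (d ℤ.+ 1ℤ) ℤ.* δ zero ℤ.+ + 4 ℤ.* t) (δ² zero) ⟩
    _                         ≡⟨ collect d (δ zero) ⟩
    (d ℤ.+ 1ℤ) ℤ.* (d ℤ.+ 1ℤ) ℤ.- + 4 ℤ.* d ℤ.* δ zero ∎
    where open ≡-Reasoning

negCubic : ℕ → ℕ → ℕ → Poly
negCubic c₀ c₁ k = + c₀ ∷ + c₁ ∷ + (2 ℕ.* k) ∷ -[1+ 0 ] ∷ []

-- The number of edges is m = k + 2 = d + g, where d = suc d′.
constantTerm : ℕ → ℕ → ℕ
constantTerm k d′ = 2 ℕ.* (2 ℕ.+ k) ℕ.* (d′ ℕ.* d′)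

linearTerm : ℕ → ℕ → ℕ → ℕ
linearTerm k d′ g = 4 ℕ.* (1 ℕ.+ k) ℕ.+ (suc d′ ℕ.* (d′ ℕ.* d′) ℕ.+ g ℕ.* ((2 ℕ.+ d′) ℕ.* (2 ℕ.+ d′)))

charPoly-factored : ∀ {m} k (N : Matrix ℤ (suc m)) (v δ : Fin m → ℤ) d′ g →
  N zero zero ≡ 0ℤ → (∀ j → N zero (suc j) ≡ v j) → (∀ i → N (suc i) zero ≡ v i) →
  (∀ i → N (suc i) (suc i) ≡ 0ℤ) → (∀ i j → i ≢ j → N (suc i) (suc j) ≡ + 2) →
  (∀ i → v i ≡ + suc d′ ℤ.+ 1ℤ ℤ.- + 2 ℤ.* δ i) → (∀ i → δ i ℤ.* δ i ≡ δ i) →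
  sumℤ δ ≡ + suc d′ → m ≡ 2 ℕ.+ k → m ≡ suc d′ ℕ.+ g →
  charPoly N ≋ -ₚ ((X+2 ^ₚ k) *ₚ negCubic (constantTerm k d′) (linearTerm k d′ g) k)
charPoly-factored k N v δ d′ g corner row col diag offDiag v≡ δ² Σδ refl m≡ j = begin
  coeff (charPoly N) j
    ≡⟨ charPoly-bordered N v corner row col diag offDiag j ⟩
  coeff ((X+2 ^ₚ k) *ₚ cubic m P S) j
    ≡⟨ *ₚ-congˡ (X+2 ^ₚ k) {cubic m P S} { -ₚ K} (λ i → trans (cubic-coeffs m P S p s
         (sum-constₚ (λ i → v i ℤ.* v i ℤ.+ 0ℤ)) (sum-constₚ v) i) (coefficients i)) j ⟩
  coeff ((X+2 ^ₚ k) *ₚ (-ₚ K)) j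
    ≡⟨ Poly-Solver.solve 2 (λ q r → q :* (:- r) := :- (q :* r)) (λ _ → refl) (X+2 ^ₚ k) K j ⟩
  coeff (-ₚ ((X+2 ^ₚ k) *ₚ K)) j ∎
  where
  open ≡-Reasoning
  open Poly-Solver using (_:*_; :-_; _:=_)
  m = 2 ℕ.+ k
  P = sumₚ λ i → constₚ (v i) *ₚ constₚ (v i)
  S = sumₚ (constₚ ∘ v)
  K = negCubic (constantTerm k d′) (linearTerm k d′ g) k
  p = sumℤ λ i → v i ℤ.* v i ℤ.+ 0ℤ
  s = sumℤ v
  d = + suc d′
  p≡ : p ≡ + m ℤ.* ((d ℤ.+ 1ℤ) ℤ.* (d ℤ.+ 1ℤ)) ℤ.- + 4 ℤ.* d ℤ.* d
  p≡ = trans (sum-border² d v δ v≡ δ²) (cong (λ t → + m ℤ.* ((d ℤ.+ 1ℤ) ℤ.* (d ℤ.+ 1ℤ)) ℤ.- + 4 ℤ.* d ℤ.* t) Σδ)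
  s≡ : s ≡ + m ℤ.* (d ℤ.+ 1ℤ) ℤ.- + 2 ℤ.* d
  s≡ = trans (sum-border d v δ v≡) (cong (λ t → + m ℤ.* (d ℤ.+ 1ℤ) ℤ.- + 2 ℤ.* t) Σδ)
  c₀≡ : + constantTerm k d′ ≡ + 2 ℤ.* + m ℤ.* (+ d′ ℤ.* + d′)
  c₀≡ = trans (ℤ.pos-* (2 ℕ.* m) (d′ ℕ.* d′)) (cong₂ ℤ._*_ (ℤ.pos-* 2 m) (ℤ.pos-* d′ d′))
  c₁≡ : + linearTerm k d′ g ≡ + 4 ℤ.* + (1 ℕ.+ k) ℤ.+ (+ suc d′ ℤ.* (+ d′ ℤ.* + d′) ℤ.+ + g ℤ.* (+ (2 ℕ.+ d′) ℤ.* + (2 ℕ.+ d′)))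
  c₁≡ = cong₂ ℤ._+_ (ℤ.pos-* 4 (1 ℕ.+ k)) (cong₂ ℤ._+_
    (trans (ℤ.pos-* (suc d′) (d′ ℕ.* d′)) (cong (ℤ._*_ (+ suc d′)) (ℤ.pos-* d′ d′)))
    (trans (ℤ.pos-* g _) (cong (ℤ._*_ (+ g)) (ℤ.pos-* (2 ℕ.+ d′) (2 ℕ.+ d′)))))
  -- Once `g` is expressed through `k` and `d′`, the comparison of linear coefficients is an
  -- identity in two free variables.
  g≡ : + g ≡ + 2 ℤ.+ + k ℤ.- 1ℤ ℤ.- + d′
  g≡ = trans (eq (+ d′) (+ g)) (cong (λ t → t ℤ.- 1ℤ ℤ.- + d′) (sym (cong +_ m≡)))
    where
    eq : ∀ d g → g ≡ 1ℤ ℤ.+ d ℤ.+ g ℤ.- 1ℤ ℤ.- d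
    eq = ℤ-Solver.solve-∀
  coefficients : ((slope m ℤ.* (ℤ.- p) ℤ.- + 2 ℤ.* (s ℤ.* s)) ∷ (slope m ℤ.* + 2 ℤ.- p) ∷ (slope m ℤ.+ + 2) ∷ 1ℤ ∷ []) ≋ -ₚ K
  coefficients 0 = begin
    slope m ℤ.* (ℤ.- p) ℤ.- + 2 ℤ.* (s ℤ.* s)
      ≡⟨ cong₂ (λ p s → slope m ℤ.* (ℤ.- p) ℤ.- + 2 ℤ.* (s ℤ.* s)) p≡ s≡ ⟩
    _ ≡⟨ eq (+ m) (+ d′) ⟩
    ℤ.- (+ 2 ℤ.* + m ℤ.* (+ d′ ℤ.* + d′))
      ≡⟨ cong ℤ.-_ (sym c₀≡) ⟩
    ℤ.- (+ constantTerm k d′) ∎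
    where
    -- In (2m - 2)p - 2s² the terms in m²(d + 1)² and 8d² cancel; -2m((d + 1)² - 4d) = -2m(d - 1)²
    -- remains.
    eq : ∀ m d′ → let d = 1ℤ ℤ.+ d′ ; c = + 2 ℤ.+ ℤ.- (m ℤ.* + 2 ℤ.+ 0ℤ) ; p = m ℤ.* ((d ℤ.+ 1ℤ) ℤ.* (d ℤ.+ 1ℤ)) ℤ.- + 4 ℤ.* d ℤ.* d
                      s = m ℤ.* (d ℤ.+ 1ℤ) ℤ.- + 2 ℤ.* d in
      c ℤ.* (ℤ.- p) ℤ.- + 2 ℤ.* (s ℤ.* s) ≡ ℤ.- (+ 2 ℤ.* m ℤ.* (d′ ℤ.* d′))
    eq = ℤ-Solver.solve-∀
  coefficients 1 = begin
    slope m ℤ.* + 2 ℤ.- p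
      ≡⟨ cong (λ p → slope m ℤ.* + 2 ℤ.- p) p≡ ⟩
    _ ≡⟨ eq (+ k) (+ d′) ⟩
    ℤ.- (+ 4 ℤ.* + (1 ℕ.+ k) ℤ.+ (+ suc d′ ℤ.* (+ d′ ℤ.* + d′) ℤ.+ (+ 2 ℤ.+ + k ℤ.- 1ℤ ℤ.- + d′) ℤ.* (+ (2 ℕ.+ d′) ℤ.* + (2 ℕ.+ d′))))
      ≡⟨ cong (λ g → ℤ.- (+ 4 ℤ.* + (1 ℕ.+ k) ℤ.+ (+ suc d′ ℤ.* (+ d′ ℤ.* + d′) ℤ.+ g ℤ.* (+ (2 ℕ.+ d′) ℤ.* + (2 ℕ.+ d′))))) (sym g≡) ⟩
    _ ≡⟨ cong ℤ.-_ (sym c₁≡) ⟩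
    ℤ.- (+ linearTerm k d′ g) ∎
    where
    eq : ∀ k d′ → let d = 1ℤ ℤ.+ d′ ; m = + 2 ℤ.+ k ; c = + 2 ℤ.+ ℤ.- (m ℤ.* + 2 ℤ.+ 0ℤ) ; p = m ℤ.* ((d ℤ.+ 1ℤ) ℤ.* (d ℤ.+ 1ℤ)) ℤ.- + 4 ℤ.* d ℤ.* d in
      c ℤ.* + 2 ℤ.- p ≡ ℤ.- (+ 4 ℤ.* (1ℤ ℤ.+ k) ℤ.+ (d ℤ.* (d′ ℤ.* d′) ℤ.+ (+ 2 ℤ.+ k ℤ.- 1ℤ ℤ.- d′) ℤ.* ((+ 2 ℤ.+ d′) ℤ.* (+ 2 ℤ.+ d′))))
    eq = ℤ-Solver.solve-∀
  coefficients 2 = trans (eq (+ k)) (cong ℤ.-_ (sym (ℤ.pos-* 2 k)))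
    where
    eq : ∀ k → + 2 ℤ.+ ℤ.- ((+ 2 ℤ.+ k) ℤ.* + 2 ℤ.+ 0ℤ) ℤ.+ + 2 ≡ ℤ.- (+ 2 ℤ.* k)
    eq = ℤ-Solver.solve-∀
  coefficients 3 = refl
  coefficients (suc (suc (suc (suc i)))) = refl

open import Data.Nat.Base using (_+_; _*_; _∸_; _^_; _≤_; _<_; _⊓_)
open import Data.Nat.DivMod using (_/_)

-- Log-concavity and unimodality

-- Multiply the two inequalities and cancel `q * r`.
cross-≤ : ∀ p q r t → 0 < q → 0 < r → p * r ≤ q * q → q * t ≤ r * r → p * t ≤ q * r
cross-≤ p q@(suc _) r@(suc _) t _ _ pr≤qq qt≤rr = ℕ.*-cancelˡ-≤ (q * r) (begin
  q * r * (p * t)      ≡⟨ eq₁ p q r t ⟩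
  p * r * (q * t)      ≤⟨ ℕ.*-mono-≤ pr≤qq qt≤rr ⟩
  q * q * (r * r)      ≡⟨ eq₂ q r ⟩
  q * r * (q * r)      ∎)
  where
  open ℕ.≤-Reasoning
  eq₁ : ∀ p q r t → q * r * (p * t) ≡ p * r * (q * t)
  eq₁ = ℕ-Solver.solve-∀
  eq₂ : ∀ q r → q * q * (r * r) ≡ q * r * (q * r)
  eq₂ = ℕ-Solver.solve-∀

-- Only the two top places can fail to be positive: 2z at `s + 1` and -1 at `s + 2`. Positivity
-- stops at `s`, while log-concavity includes the triple ending at `s + 1`, whose last term may be
-- 0.
record Shape (a : ℕ → ℤ) (s z : ℕ) : Set where
  field
    nonNeg     : ∀ j → j ≤ suc s → a j ≡ + ∣ a j ∣
    positive   : ∀ j → j ≤ s → 0 < ∣ a j ∣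
    next       : a (suc s) ≡ + (2 * z)
    last       : a (suc (suc s)) ≡ ℤ.- 1ℤ
    beyond     : ∀ j → a (3 + s + j) ≡ 0ℤ
    logConcave : ∀ i → suc i ≤ s → ∣ a i ∣ * ∣ a (suc (suc i)) ∣ ≤ ∣ a (suc i) ∣ * ∣ a (suc i) ∣

-- For consecutive p, q, r, t the claim is (2q + p)(2t + r) ≤ (2r + q)². It follows termwise from qt
-- ≤ r², pt ≤ qr and pr ≤ q². In the topmost triple the new coefficient 2z is bounded by the old
-- one, 2z + 2, one place lower.
shape-step : ∀ {a b s z} → b 0 ≡ + 2 ℤ.* a 0 → (∀ j → b (suc j) ≡ + 2 ℤ.* a (suc j) ℤ.+ a j) →
  Shape a s (suc z) → Shape b (suc s) z
shape-step {a} {b} {s} {z} b-zero b-suc sh = record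
  { nonNeg     = nonNeg′
  ; positive   = positive′
  ; next       = next′
  ; last       = last′
  ; beyond     = λ j → trans (b-suc (3 + s + j)) (trans (cong₂ (λ u v → + 2 ℤ.* u ℤ.+ v)
                   (trans (cong a (sym (ℕ.+-suc (3 + s) j))) (beyond (suc j))) (beyond j)) refl)
  ; logConcave = logConcave′
  }
  where
  open Shape sh
  α β : ℕ → ℕ
  α j = ∣ a j ∣
  β j = ∣ b j ∣
  b₀ : b 0 ≡ + (2 * α 0)
  b₀ = trans b-zero (trans (cong (ℤ._*_ (+ 2)) (nonNeg 0 z≤n)) (sym (ℤ.pos-* 2 (α 0))))
  bₛ : ∀ j → j ≤ s → b (suc j) ≡ + (2 * α (suc j) + α j)
  bₛ j j≤s = trans (b-suc j) (cong₂ ℤ._+_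
    (trans (cong (ℤ._*_ (+ 2)) (nonNeg (suc j) (s≤s j≤s))) (sym (ℤ.pos-* 2 (α (suc j)))))
    (nonNeg j (ℕ.m≤n⇒m≤1+n j≤s)))
  β₀ : β 0 ≡ 2 * α 0
  β₀ = cong ∣_∣ b₀
  βₛ : ∀ j → j ≤ s → β (suc j) ≡ 2 * α (suc j) + α j
  βₛ j j≤s = cong ∣_∣ (bₛ j j≤s)
  next′ : b (suc (suc s)) ≡ + (2 * z)
  next′ = trans (b-suc (suc s)) (trans (cong₂ (λ u v → + 2 ℤ.* u ℤ.+ v) last (trans next (ℤ.pos-* 2 (suc z))))
    (trans (eq (+ z)) (sym (ℤ.pos-* 2 z))))
    where
    eq : ∀ z → + 2 ℤ.* (ℤ.- 1ℤ) ℤ.+ + 2 ℤ.* (1ℤ ℤ.+ z) ≡ + 2 ℤ.* z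
    eq = ℤ-Solver.solve-∀
  last′ : b (suc (suc (suc s))) ≡ ℤ.- 1ℤ
  last′ = trans (b-suc (suc (suc s))) (cong₂ (λ u v → + 2 ℤ.* u ℤ.+ v)
    (trans (cong a (sym (ℕ.+-identityʳ (3 + s)))) (beyond 0)) last)
  nonNeg′ : ∀ j → j ≤ suc (suc s) → b j ≡ + β j
  nonNeg′ zero    _ = trans b₀ (cong +_ (sym β₀))
  nonNeg′ (suc j) (s≤s j≤1+s) with ℕ.m≤n⇒m<n∨m≡n j≤1+s
  ... | inj₁ (s≤s j≤s) = trans (bₛ j j≤s) (cong +_ (sym (βₛ j j≤s)))
  ... | inj₂ refl      = trans next′ (cong +_ (sym (cong ∣_∣ next′)))
  positive′ : ∀ j → j ≤ suc s → 0 < β j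
  positive′ zero    _         = subst (0 <_) (sym β₀) (ℕ.<-≤-trans (positive 0 z≤n) (ℕ.m≤n*m (α 0) 2))
  positive′ (suc j) (s≤s j≤s) = subst (0 <_) (sym (βₛ j j≤s)) (ℕ.<-≤-trans (positive j j≤s) (ℕ.m≤n+m (α j) _))
  square : ∀ q r → (2 * r + q) * (2 * r + q) ≡ 4 * (r * r) + 2 * (q * r) + 2 * (q * r) + q * q
  square = ℕ-Solver.solve-∀
  β-next≤ : β (suc (suc s)) ≤ α (suc s)
  β-next≤ = ≡.subst₂ _≤_ (sym (cong ∣_∣ next′)) (sym (cong ∣_∣ next)) (ℕ.*-monoʳ-≤ 2 (ℕ.n≤1+n z))
  open ℕ.≤-Reasoning
  logConcave′ : ∀ i → suc i ≤ suc s → β i * β (suc (suc i)) ≤ β (suc i) * β (suc i)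
  logConcave′ zero (s≤s _) with ℕ.m≤n⇒m<n∨m≡n (z≤n {s})
  ... | inj₁ 1≤s = begin
    β 0 * β 2
      ≡⟨ cong₂ _*_ β₀ (βₛ 1 1≤s) ⟩
    2 * α 0 * (2 * α 2 + α 1)
      ≡⟨ eq (α 0) (α 1) (α 2) ⟩
    4 * (α 0 * α 2) + 2 * (α 0 * α 1)
      ≤⟨ ℕ.+-monoˡ-≤ (2 * (α 0 * α 1)) (ℕ.*-monoʳ-≤ 4 (logConcave 0 1≤s)) ⟩
    4 * (α 1 * α 1) + 2 * (α 0 * α 1)
      ≤⟨ ℕ.≤-trans (ℕ.m≤m+n _ (2 * (α 0 * α 1))) (ℕ.m≤m+n _ (α 0 * α 0)) ⟩
    4 * (α 1 * α 1) + 2 * (α 0 * α 1) + 2 * (α 0 * α 1) + α 0 * α 0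
      ≡⟨ square (α 0) (α 1) ⟨
    (2 * α 1 + α 0) * (2 * α 1 + α 0)
      ≡⟨ cong₂ _*_ (βₛ 0 z≤n) (βₛ 0 z≤n) ⟨
    β 1 * β 1 ∎
    where
    eq : ∀ p q r → 2 * p * (2 * r + q) ≡ 4 * (p * r) + 2 * (p * q)
    eq = ℕ-Solver.solve-∀
  ... | inj₂ refl = begin
    β 0 * β 2
      ≤⟨ ℕ.*-mono-≤ (ℕ.≤-reflexive β₀) β-next≤ ⟩
    2 * α 0 * α 1
      ≤⟨ ℕ.≤-trans (ℕ.≤-reflexive (ℕ.*-assoc 2 (α 0) (α 1))) (ℕ.≤-trans (ℕ.m≤n+m _ (4 * (α 1 * α 1)))
           (ℕ.≤-trans (ℕ.m≤m+n _ (2 * (α 0 * α 1))) (ℕ.m≤m+n _ (α 0 * α 0)))) ⟩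
    4 * (α 1 * α 1) + 2 * (α 0 * α 1) + 2 * (α 0 * α 1) + α 0 * α 0
      ≡⟨ square (α 0) (α 1) ⟨
    (2 * α 1 + α 0) * (2 * α 1 + α 0)
      ≡⟨ cong₂ _*_ (βₛ 0 z≤n) (βₛ 0 z≤n) ⟨
    β 1 * β 1 ∎
  logConcave′ (suc i) (s≤s 1+i≤s) with ℕ.m≤n⇒m<n∨m≡n 1+i≤s
  ... | inj₁ 2+i≤s = begin
    β (suc i) * β (3 + i)
      ≡⟨ cong₂ _*_ (βₛ i (ℕ.<⇒≤ 1+i≤s)) (βₛ (2 + i) 2+i≤s) ⟩
    (2 * q + p) * (2 * t + r)
      ≡⟨ eq p q r t ⟩
    4 * (q * t) + 2 * (p * t) + 2 * (q * r) + p * r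
      ≤⟨ ℕ.+-mono-≤ (ℕ.+-monoˡ-≤ (2 * (q * r)) (ℕ.+-mono-≤
           (ℕ.*-monoʳ-≤ 4 (logConcave (suc i) 2+i≤s))
           (ℕ.*-monoʳ-≤ 2 (cross-≤ p q r t (positive (suc i) 1+i≤s) (positive (2 + i) 2+i≤s)
             (logConcave i 1+i≤s) (logConcave (suc i) 2+i≤s))))) (logConcave i 1+i≤s) ⟩
    4 * (r * r) + 2 * (q * r) + 2 * (q * r) + q * q
      ≡⟨ square q r ⟨
    (2 * r + q) * (2 * r + q)
      ≡⟨ cong₂ _*_ (βₛ (suc i) 1+i≤s) (βₛ (suc i) 1+i≤s) ⟨
    β (2 + i) * β (2 + i) ∎
    where
    p = α i
    q = α (suc i)
    r = α (2 + i)
    t = α (3 + i)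
    eq : ∀ p q r t → (2 * q + p) * (2 * t + r) ≡ 4 * (q * t) + 2 * (p * t) + 2 * (q * r) + p * r
    eq = ℕ-Solver.solve-∀
  ... | inj₂ refl = begin
    β (suc i) * β (3 + i)
      ≤⟨ ℕ.*-mono-≤ (ℕ.≤-reflexive (βₛ i (ℕ.n≤1+n i))) β-next≤ ⟩
    (2 * q + p) * r
      ≡⟨ eq p q r ⟩
    2 * (q * r) + p * r
      ≤⟨ ℕ.+-mono-≤ (ℕ.m≤n+m (2 * (q * r)) (4 * (r * r) + 2 * (q * r))) (logConcave i ℕ.≤-refl) ⟩
    4 * (r * r) + 2 * (q * r) + 2 * (q * r) + q * q
      ≡⟨ square q r ⟨
    (2 * r + q) * (2 * r + q)
      ≡⟨ cong₂ _*_ (βₛ (suc i) ℕ.≤-refl) (βₛ (suc i) ℕ.≤-refl) ⟨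
    β (2 + i) * β (2 + i) ∎
    where
    p = α i
    q = α (suc i)
    r = α (2 + i)
    eq : ∀ p q r → (2 * q + p) * r ≡ 2 * (q * r) + p * r
    eq = ℕ-Solver.solve-∀

-- Each factor X + 2 moves the coefficient 2z one place up and lowers z by one, so z = 0 is reached
-- after N factors (the matrix has trace zero).
shape-product : ∀ c₀ c₁ N k z → 0 < c₀ → 0 < c₁ → c₀ * (2 * N) ≤ c₁ * c₁ → k + z ≡ N →
  Shape (coeff ((X+2 ^ₚ k) *ₚ negCubic c₀ c₁ N)) (suc k) z
shape-product c₀ c₁ N zero z 0<c₀ 0<c₁ lc refl = shape-≋ (λ j → sym (*ₚ-identityˡ (negCubic c₀ c₁ N) j)) record
  { nonNeg     = λ { 0 _ → refl ; 1 _ → refl ; 2 _ → refl ; (suc (suc (suc _))) (s≤s (s≤s ())) }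
  ; positive   = λ { 0 _ → 0<c₀ ; 1 _ → 0<c₁ ; (suc (suc _)) (s≤s ()) }
  ; next       = refl
  ; last       = refl
  ; beyond     = λ _ → refl
  ; logConcave = λ { 0 _ → lc ; (suc _) (s≤s ()) }
  }
  where
  shape-≋ : ∀ {a b s z} → (∀ j → a j ≡ b j) → Shape a s z → Shape b s z
  shape-≋ {a} {b} a≡b sh = record
    { nonNeg     = λ j j≤ → trans (sym (a≡b j)) (trans (nonNeg j j≤) (cong +_ (cong ∣_∣ (a≡b j))))
    ; positive   = λ j j≤ → subst (0 <_) (cong ∣_∣ (a≡b j)) (positive j j≤)
    ; next       = trans (sym (a≡b _)) next
    ; last       = trans (sym (a≡b _)) last
    ; beyond     = λ j → trans (sym (a≡b _)) (beyond j)
    ; logConcave = λ i i≤ → ≡.subst₂ _≤_ (cong₂ _*_ (cong ∣_∣ (a≡b i)) (cong ∣_∣ (a≡b (2 + i))))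
        (cong₂ _*_ (cong ∣_∣ (a≡b (suc i))) (cong ∣_∣ (a≡b (suc i)))) (logConcave i i≤)
    }
    where open Shape sh
shape-product c₀ c₁ N (suc k) z 0<c₀ 0<c₁ lc k+z≡N = shape-step
  (trans (*ₚ-assoc X+2 (X+2 ^ₚ k) K 0) (coeff-linear-zero (+ 2) ((X+2 ^ₚ k) *ₚ K)))
  (λ j → trans (*ₚ-assoc X+2 (X+2 ^ₚ k) K (suc j)) (coeff-linear-suc (+ 2) ((X+2 ^ₚ k) *ₚ K) j))
  (shape-product c₀ c₁ N k (suc z) 0<c₀ 0<c₁ lc (trans (ℕ.+-suc k z) k+z≡N))
  where K = negCubic c₀ c₁ N

-- Once the sequence descends it keeps descending: from aₘ₊₁ ≤ aₘ follows aₘ aₘ₊₂ ≤ aₘ₊₁² ≤ aₘ aₘ₊₁,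
-- and the positive aₘ cancels. If the peak is still the last term, one comparison decides where it
-- goes.
logConcave⇒unimodal : ∀ a m → (∀ j → j ≤ m → 0 < a j) → LogConcave a m → Unimodal a m
logConcave⇒unimodal a zero    pos lc = 0 , z≤n , (λ _ ()) , λ _ _ ()
logConcave⇒unimodal a (suc m) pos lc
  with logConcave⇒unimodal a m (λ j → pos j ∘ ℕ.m≤n⇒m≤1+n) (λ i → lc i ∘ ℕ.m≤n⇒m≤1+n)
... | k , k≤m , up , down with ℕ.m≤n⇒m<n∨m≡n k≤m
...   | inj₂ refl with ℕ.≤-total (a k) (a (suc k))
...     | inj₁ aₖ≤ = suc k , ℕ.≤-refl , up′ , λ j k<j j<k → contradiction (ℕ.≤-trans k<j (ℕ.s≤s⁻¹ j<k)) (ℕ.<-irrefl refl)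
  where
  up′ : ∀ j → suc j ≤ suc k → a j ≤ a (suc j)
  up′ j (s≤s j≤k) with ℕ.m≤n⇒m<n∨m≡n j≤k
  ... | inj₁ j<k  = up j j<k
  ... | inj₂ refl = aₖ≤
...     | inj₂ aₖ≥ = k , ℕ.n≤1+n k , up , down′
  where
  down′ : ∀ j → k ≤ j → suc j ≤ suc k → a (suc j) ≤ a j
  down′ j k≤j (s≤s j≤k) with refl ← ℕ.≤-antisym j≤k k≤j = aₖ≥
logConcave⇒unimodal a (suc (suc m)) pos lc | k , k≤m , up , down | inj₁ (s≤s k≤m′) = k , ℕ.m≤n⇒m≤1+n k≤m , up , down′
  where
  down′ : ∀ j → k ≤ j → suc j ≤ suc (suc m) → a (suc j) ≤ a j
  down′ j k≤j (s≤s j≤) with ℕ.m≤n⇒m<n∨m≡n j≤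
  ... | inj₁ j<   = down j k≤j j<
  ... | inj₂ refl = ℕ.*-cancelˡ-≤ (a m) {{ℕ.>-nonZero (pos m (ℕ.m≤n⇒m≤1+n (ℕ.n≤1+n m)))}} (begin
    a m * a (suc (suc m))   ≤⟨ lc m ℕ.≤-refl ⟩
    a (suc m) ^ 2           ≡⟨ cong (a (suc m) *_) (ℕ.*-identityʳ _) ⟩
    a (suc m) * a (suc m)   ≤⟨ ℕ.*-monoˡ-≤ (a (suc m)) (down m k≤m′ ℕ.≤-refl) ⟩
    a m * a (suc m)         ∎)
    where open ℕ.≤-Reasoning

-- Location of the maximum

-- The numbers C(N, k) 2ᴺ⁻ᵏ, by their Pascal recursion.
power : ℕ → ℕ → ℕ
power zero    zero    = 1
power zero    (suc k) = 0
power (suc N) zero    = 2 * power N zero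
power (suc N) (suc k) = 2 * power N (suc k) + power N k

coeff-X+2^ : ∀ N k → coeff (X+2 ^ₚ N) k ≡ + power N k
coeff-X+2^ zero    zero    = refl
coeff-X+2^ zero    (suc k) = refl
coeff-X+2^ (suc N) zero    = trans (coeff-linear-zero (+ 2) (X+2 ^ₚ N))
  (trans (cong (ℤ._*_ (+ 2)) (coeff-X+2^ N 0)) (sym (ℤ.pos-* 2 (power N 0))))
coeff-X+2^ (suc N) (suc k) = trans (coeff-linear-suc (+ 2) (X+2 ^ₚ N) k)
  (cong₂ ℤ._+_ (trans (cong (ℤ._*_ (+ 2)) (coeff-X+2^ N (suc k))) (sym (ℤ.pos-* 2 (power N (suc k))))) (coeff-X+2^ N k))

-- Coefficient by coefficient, this is the differential equation (x + 2)P′ = N P of P = (x + 2)ᴺ.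
power-ratio : ∀ N k → 2 * suc k * power N (suc k) + k * power N k ≡ N * power N k
power-ratio zero    zero    = refl
power-ratio zero    (suc k) = cong₂ _+_ (ℕ.*-zeroʳ (2 * suc (suc k))) (ℕ.*-zeroʳ k)
power-ratio (suc N) zero    = begin
  2 * (2 * power N 1 + power N 0) + 0   ≡⟨ eq₁ (power N 1) (power N 0) ⟩
  2 * (2 * power N 1 + 0) + 2 * power N 0  ≡⟨ cong (λ t → 2 * t + 2 * power N 0) (power-ratio N 0) ⟩
  2 * (N * power N 0) + 2 * power N 0   ≡⟨ eq₂ N (power N 0) ⟩
  suc N * (2 * power N 0)               ∎
  where
  open ≡-Reasoning
  eq₁ : ∀ p q → 2 * (2 * p + q) + 0 ≡ 2 * (2 * p + 0) + 2 * q
  eq₁ = ℕ-Solver.solve-∀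
  eq₂ : ∀ N q → 2 * (N * q) + 2 * q ≡ (1 + N) * (2 * q)
  eq₂ = ℕ-Solver.solve-∀
power-ratio (suc N) (suc k) = begin
  2 * (2 + k) * (2 * p₂ + p₁) + (1 + k) * (2 * p₁ + p₀)
    ≡⟨ eq₁ k p₀ p₁ p₂ ⟩
  2 * (2 * (2 + k) * p₂ + (1 + k) * p₁) + (2 * (1 + k) * p₁ + k * p₀) + (2 * p₁ + p₀)
    ≡⟨ cong₂ (λ t u → 2 * t + u + (2 * p₁ + p₀)) (power-ratio N (suc k)) (power-ratio N k) ⟩
  2 * (N * p₁) + N * p₀ + (2 * p₁ + p₀)
    ≡⟨ eq₂ N p₀ p₁ ⟩
  (1 + N) * (2 * p₁ + p₀) ∎
  where
  open ≡-Reasoning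
  p₀ = power N k
  p₁ = power N (suc k)
  p₂ = power N (suc (suc k))
  eq₁ : ∀ k p₀ p₁ p₂ → 2 * (2 + k) * (2 * p₂ + p₁) + (1 + k) * (2 * p₁ + p₀) ≡
    2 * (2 * (2 + k) * p₂ + (1 + k) * p₁) + (2 * (1 + k) * p₁ + k * p₀) + (2 * p₁ + p₀)
  eq₁ = ℕ-Solver.solve-∀
  eq₂ : ∀ N p₀ p₁ → 2 * (N * p₁) + N * p₀ + (2 * p₁ + p₀) ≡ (1 + N) * (2 * p₁ + p₀)
  eq₂ = ℕ-Solver.solve-∀

power-positive : ∀ N k → k ≤ N → 0 < power N k
power-positive zero    zero    _         = z<s
power-positive (suc N) zero    _         = ℕ.<-≤-trans (power-positive N 0 z≤n) (ℕ.m≤n*m _ 2)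
power-positive (suc N) (suc k) (s≤s k≤N) = ℕ.<-≤-trans (power-positive N k k≤N) (ℕ.m≤n+m _ _)

-- With N = k + e the ratio of consecutive coefficients is e / (2k + 2), free of subtraction. The
-- four comparisons below weigh `e` against 2k + 2.
power-ratio′ : ∀ k e → 2 * suc k * power (k + e) (suc k) ≡ e * power (k + e) k
power-ratio′ k e = ℕ.+-cancelʳ-≡ (k * power (k + e) k) _ _
  (trans (power-ratio (k + e) k) (eq k e (power (k + e) k)))
  where
  eq : ∀ k e p → (k + e) * p ≡ e * p + k * p
  eq = ℕ-Solver.solve-∀

power-increasing : ∀ k e → 2 * suc k ≤ e → power (k + e) k ≤ power (k + e) (suc k)
power-increasing k e 2k+2≤e = ℕ.*-cancelˡ-≤ (2 * suc k) (begin
  2 * suc k * power (k + e) k         ≤⟨ ℕ.*-monoˡ-≤ _ 2k+2≤e ⟩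
  e * power (k + e) k                 ≡⟨ power-ratio′ k e ⟨
  2 * suc k * power (k + e) (suc k)   ∎)
  where open ℕ.≤-Reasoning

power-increasing-< : ∀ k e → 2 * suc k < e → power (k + e) k < power (k + e) (suc k)
power-increasing-< k e 2k+2<e = ℕ.*-cancelˡ-< (2 * suc k) _ _ (begin-strict
  2 * suc k * power (k + e) k         <⟨ ℕ.*-monoˡ-< _ {{ℕ.>-nonZero (power-positive (k + e) k (ℕ.m≤m+n k e))}} 2k+2<e ⟩
  e * power (k + e) k                 ≡⟨ power-ratio′ k e ⟨
  2 * suc k * power (k + e) (suc k)   ∎)
  where open ℕ.≤-Reasoning

power-decreasing : ∀ k e → e ≤ 2 * suc k → power (k + e) (suc k) ≤ power (k + e) k
power-decreasing k e e≤2k+2 = ℕ.*-cancelˡ-≤ (2 * suc k) (begin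
  2 * suc k * power (k + e) (suc k)   ≡⟨ power-ratio′ k e ⟩
  e * power (k + e) k                 ≤⟨ ℕ.*-monoˡ-≤ _ e≤2k+2 ⟩
  2 * suc k * power (k + e) k         ∎)
  where open ℕ.≤-Reasoning

power-decreasing-< : ∀ k e → e < 2 * suc k → power (k + e) (suc k) < power (k + e) k
power-decreasing-< k e e<2k+2 = ℕ.*-cancelˡ-< (2 * suc k) _ _ (begin-strict
  2 * suc k * power (k + e) (suc k)   ≡⟨ power-ratio′ k e ⟩
  e * power (k + e) k                 <⟨ ℕ.*-monoˡ-< _ {{ℕ.>-nonZero (power-positive (k + e) k (ℕ.m≤m+n k e))}} e<2k+2 ⟩
  2 * suc k * power (k + e) k         ∎)
  where open ℕ.≤-Reasoning

-- Multiplication by x, on coefficient sequences.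
shift : (ℕ → ℕ) → ℕ → ℕ
shift f zero    = 0
shift f (suc k) = f k

coeff-product : ∀ c₀ c₁ M N j → let p = power N in
  coeff ((X+2 ^ₚ N) *ₚ negCubic c₀ c₁ M) j ℤ.+ + shift (shift (shift p)) j ≡
  + (c₀ * p j + (c₁ * shift p j + 2 * M * shift (shift p) j))
coeff-product c₀ c₁ M N j = trans (cong (ℤ._+ + shift (shift (shift p)) j) (*ₚ-comm (X+2 ^ₚ N) K j)) (go j)
  where
  p = power N
  P = X+2 ^ₚ N
  K = negCubic c₀ c₁ M
  term : ∀ c k → + c ℤ.* coeff P k ≡ + (c * p k)
  term c k = trans (cong (ℤ._*_ (+ c)) (coeff-X+2^ N k)) (sym (ℤ.pos-* c (p k)))
  top : ∀ k → coeff ((-[1+ 0 ] ∷ []) *ₚ P) k ≡ ℤ.- + p k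
  top zero    = trans (coeff-*ₚ-zero -[1+ 0 ] [] P) (trans (ℤ.-1*i≡-i _) (cong ℤ.-_ (coeff-X+2^ N 0)))
  top (suc k) = trans (coeff-*ₚ-suc -[1+ 0 ] [] P k) (trans (ℤ.+-identityʳ _)
    (trans (ℤ.-1*i≡-i _) (cong ℤ.-_ (coeff-X+2^ N (suc k)))))
  K₁ = + c₁ ∷ + (2 * M) ∷ -[1+ 0 ] ∷ []
  K₂ = + (2 * M) ∷ -[1+ 0 ] ∷ []
  pad : ∀ x c d → + (x + 0) ℤ.+ 0ℤ ≡ + (x + (c * 0 + d * 0))
  pad x c d = trans (ℤ.+-identityʳ _) (cong (λ t → + (x + t)) (sym (cong₂ _+_ (ℕ.*-zeroʳ c) (ℕ.*-zeroʳ d))))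
  go : ∀ j → coeff (K *ₚ P) j ℤ.+ + shift (shift (shift p)) j ≡
    + (c₀ * p j + (c₁ * shift p j + 2 * M * shift (shift p) j))
  go 0 = trans (cong (ℤ._+ 0ℤ) (trans (coeff-*ₚ-zero (+ c₀) K₁ P) (trans (term c₀ 0) (cong +_ (sym (ℕ.+-identityʳ _))))))
    (pad (c₀ * p 0) c₁ (2 * M))
  go 1 = trans (ℤ.+-identityʳ _) (trans (coeff-*ₚ-suc (+ c₀) K₁ P 0) (cong₂ ℤ._+_ (term c₀ 1)
    (trans (coeff-*ₚ-zero (+ c₁) K₂ P) (trans (term c₁ 0)
      (cong +_ (sym (trans (cong (_+_ (c₁ * p 0)) (ℕ.*-zeroʳ (2 * M))) (ℕ.+-identityʳ _))))))))
  go 2 = trans (ℤ.+-identityʳ _) (trans (coeff-*ₚ-suc (+ c₀) K₁ P 1) (cong₂ ℤ._+_ (term c₀ 2)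
    (trans (coeff-*ₚ-suc (+ c₁) K₂ P 0) (cong₂ ℤ._+_ (term c₁ 1)
      (trans (coeff-*ₚ-zero (+ (2 * M)) (-[1+ 0 ] ∷ []) P) (term (2 * M) 0))))))
  go (suc (suc (suc j))) = trans (cong (ℤ._+ + p j) (trans (coeff-*ₚ-suc (+ c₀) K₁ P (2 + j)) (cong₂ ℤ._+_ (term c₀ (3 + j))
    (trans (coeff-*ₚ-suc (+ c₁) K₂ P (suc j)) (cong₂ ℤ._+_ (term c₁ (2 + j))
      (trans (coeff-*ₚ-suc (+ (2 * M)) (-[1+ 0 ] ∷ []) P j) (cong₂ ℤ._+_ (term (2 * M) (1 + j)) (top j))))))))
    (cancel (+ (c₀ * p (3 + j))) (+ (c₁ * p (2 + j))) (+ (2 * M * p (1 + j))) (+ p j))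
    where
    cancel : ∀ a b c t → a ℤ.+ (b ℤ.+ (c ℤ.+ ℤ.- t)) ℤ.+ t ≡ a ℤ.+ (b ℤ.+ c)
    cancel = ℤ-Solver.solve-∀

-- The −x³ of the cubic is absorbed by its 2N x²: writing pₖ for the coefficients of
-- (x + 2)ᴺ, the sequence 2N pₖ − pₖ₋₁ is monotone in the ranges that matter.
increasing-tail : ∀ k e → 2 * k + 3 ≤ e → let N = k + e in
  2 * N * power N k + power N k ≤ 2 * N * power N (suc k)
increasing-tail k zero    h = contradiction (ℕ.≤-trans (ℕ.m≤n+m 3 (2 * k)) h) λ ()
increasing-tail k (suc f) h = begin
  -- 2N + 1 splits as (2k + 3) + 2f. The first part is at most e, and e r = 2(k + 1)t; the second
  -- uses r ≤ t.
  2 * (k + suc f) * r + r                  ≡⟨ eq₁ k f r ⟩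
  (2 * k + 3) * r + 2 * f * r              ≤⟨ ℕ.+-mono-≤ (ℕ.*-monoˡ-≤ r h) (ℕ.*-monoʳ-≤ (2 * f) r≤t) ⟩
  suc f * r + 2 * f * t                    ≡⟨ cong (_+ 2 * f * t) (power-ratio′ k (suc f)) ⟨
  2 * suc k * t + 2 * f * t                ≡⟨ eq₂ k f t ⟩
  2 * (k + suc f) * t                      ∎
  where
  open ℕ.≤-Reasoning
  r = power (k + suc f) k
  t = power (k + suc f) (suc k)
  r≤t : r ≤ t
  r≤t = power-increasing k (suc f) (ℕ.≤-trans (ℕ.≤-trans (ℕ.n≤1+n _) (ℕ.≤-reflexive (eq k))) h)
    where
    eq : ∀ k → 1 + 2 * (1 + k) ≡ 2 * k + 3
    eq = ℕ-Solver.solve-∀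
  eq₁ : ∀ k f r → 2 * (k + (1 + f)) * r + r ≡ (2 * k + 3) * r + 2 * f * r
  eq₁ = ℕ-Solver.solve-∀
  eq₂ : ∀ k f t → 2 * (1 + k) * t + 2 * f * t ≡ 2 * (k + (1 + f)) * t
  eq₂ = ℕ-Solver.solve-∀

-- With e = f + 1, split 2N as 2(k + 1) + 2f. The first part turns t into e r by the ratio, the
-- second uses t ≤ r, and `core` absorbs the previous coefficient.
decreasing-tail : ∀ k e → 0 < e → e ≤ 2 * suc k → let N = k + e in
  2 * N * power N (suc k) + shift (power N) k ≤ 2 * N * power N k + power N k
decreasing-tail k e@(suc f) _ e≤ = begin
  2 * (k + suc f) * t + q                  ≡⟨ cong (_+ q) (eq₁ k f t) ⟩
  2 * suc k * t + 2 * f * t + q            ≡⟨ cong (λ u → u + 2 * f * t + q) (power-ratio′ k e) ⟩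
  e * r + 2 * f * t + q                    ≡⟨ eq₂ (e * r) (2 * f * t) q ⟩
  e * r + q + 2 * f * t                    ≤⟨ ℕ.+-mono-≤ (core k e e≤) (ℕ.*-monoʳ-≤ (2 * f) (power-decreasing k e e≤)) ⟩
  2 * suc k * r + r + 2 * f * r            ≡⟨ eq₃ k f r ⟩
  2 * (k + suc f) * r + r                  ∎
  where
  open ℕ.≤-Reasoning
  r = power (k + e) k
  t = power (k + e) (suc k)
  q = shift (power (k + e)) k
  eq₁ : ∀ k f t → 2 * (k + (1 + f)) * t ≡ 2 * (1 + k) * t + 2 * f * t
  eq₁ = ℕ-Solver.solve-∀
  eq₂ : ∀ x y z → x + y + z ≡ x + z + y
  eq₂ = ℕ-Solver.solve-∀
  eq₃ : ∀ k f r → 2 * (1 + k) * r + r + 2 * f * r ≡ 2 * (k + (1 + f)) * r + r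
  eq₃ = ℕ-Solver.solve-∀
  core : ∀ k e → e ≤ 2 * suc k → let r = power (k + e) k in
    e * r + shift (power (k + e)) k ≤ 2 * suc k * r + r
  core zero    e e≤ = ℕ.+-mono-≤ (ℕ.*-monoˡ-≤ _ e≤) z≤n
  core (suc h) e e≤ with ℕ.≤-total (power (suc h + e) h) (power (suc h + e) (suc h))
  ... | inj₁ q≤r = ℕ.+-mono-≤ (ℕ.*-monoˡ-≤ _ e≤) q≤r
  -- If the previous coefficient q is the larger one, then e r + q ≤ (e + 1)q, which the ratio one
  -- place lower turns back into a multiple of r.
  ... | inj₂ r≤q = begin
    e * r′ + q′              ≤⟨ ℕ.+-monoˡ-≤ q′ (ℕ.*-monoʳ-≤ e r≤q) ⟩
    e * q′ + q′              ≡⟨ ℕ.+-comm (e * q′) q′ ⟩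
    suc e * q′              ≡⟨ subst (λ N → 2 * suc h * power N (suc h) ≡ suc e * power N h) (ℕ.+-suc h e) (power-ratio′ h (suc e)) ⟨
    2 * suc h * r′          ≤⟨ ℕ.*-monoˡ-≤ r′ (ℕ.*-monoʳ-≤ 2 (ℕ.n≤1+n (suc h))) ⟩
    2 * suc (suc h) * r′    ≤⟨ ℕ.m≤m+n _ r′ ⟩
    2 * suc (suc h) * r′ + r′ ∎
    where
    r′ = power (suc h + e) (suc h)
    q′ = power (suc h + e) h

-- a is the sequence of coefficients of (x + 2)ᴺ (c₀ + c₁ x + 2N x² − x³), with the negative
-- term moved to the left so that everything stays in ℕ.
IsProduct : ℕ → ℕ → ℕ → (ℕ → ℕ) → Set
IsProduct c₀ c₁ N a = ∀ j → j ≤ suc N → a j + shift (shift (shift p)) j ≡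
  c₀ * p j + (c₁ * shift p j + 2 * N * shift (shift p) j)
  where p = power N

private
  regroup : ∀ x y z t → x + (y + z) + t ≡ x + (y + (z + t))
  regroup = ℕ-Solver.solve-∀

-- The three parts are compared separately. At N = 3k + 2 the coefficients `p k` and `p (suc k)`
-- coincide, so strictness is drawn from the c₁ part, which lags one place behind.
product-increasing : ∀ c₀ c₁ N a → 0 < c₁ → IsProduct c₀ c₁ N a →
  ∀ k → 3 * k + 2 ≤ N → a k < a (suc k)
product-increasing c₀ c₁ N a 0<c₁ a≡ k h = ℕ.+-cancelʳ-< (p₃ k + p₃ (suc k)) _ _ (begin-strict
  a k + (p₃ k + p₃ (suc k))
    ≡⟨ ℕ.+-assoc (a k) (p₃ k) (p₃ (suc k)) ⟨
  a k + p₃ k + p₃ (suc k)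
    ≡⟨ cong (_+ p₃ (suc k)) (a≡ k (ℕ.m≤n⇒m≤1+n k≤N)) ⟩
  c₀ * p k + (c₁ * p₁ k + 2 * N * p₂ k) + p₂ k
    ≡⟨ regroup (c₀ * p k) (c₁ * p₁ k) (2 * N * p₂ k) (p₂ k) ⟩
  c₀ * p k + (c₁ * p₁ k + (2 * N * p₂ k + p₂ k))
    <⟨ ℕ.+-mono-≤-< (ℕ.*-monoʳ-≤ c₀ head) (ℕ.+-mono-<-≤ (ℕ.*-monoʳ-< c₁ {{ℕ.>-nonZero 0<c₁}} (middle k h)) (tail k h)) ⟩
  c₀ * p (suc k) + (c₁ * p k + (2 * N * p₁ k + p₃ k))
    ≡⟨ regroup (c₀ * p (suc k)) (c₁ * p k) (2 * N * p₁ k) (p₃ k) ⟨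
  c₀ * p (suc k) + (c₁ * p k + 2 * N * p₁ k) + p₃ k
    ≡⟨ cong (_+ p₃ k) (a≡ (suc k) (s≤s k≤N)) ⟨
  a (suc k) + p₃ (suc k) + p₃ k
    ≡⟨ trans (ℕ.+-assoc (a (suc k)) (p₃ (suc k)) (p₃ k)) (cong (_+_ (a (suc k))) (ℕ.+-comm (p₃ (suc k)) (p₃ k))) ⟩
  a (suc k) + (p₃ k + p₃ (suc k)) ∎)
  where
  open ℕ.≤-Reasoning
  p = power N
  p₁ = shift p
  p₂ = shift p₁
  p₃ = shift p₂
  split : ∀ k c → 3 * k + c ≤ N → ∃[ e ] k + e ≡ N × 2 * k + c ≤ e
  split k c h with ℕ.m≤n⇒∃[o]m+o≡n h
  ... | o , refl = 2 * k + c + o , eq k c o , ℕ.m≤m+n _ o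
    where
    eq : ∀ k c o → k + (2 * k + c + o) ≡ 3 * k + c + o
    eq = ℕ-Solver.solve-∀
  k≤N : k ≤ N
  k≤N with e , refl , _ ← split k 2 h = ℕ.m≤m+n k e
  head : p k ≤ p (suc k)
  head with e , refl , 2k+2≤e ← split k 2 h = power-increasing k e (ℕ.≤-trans (ℕ.≤-reflexive (eq k)) 2k+2≤e)
    where
    eq : ∀ k → 2 * (1 + k) ≡ 2 * k + 2
    eq = ℕ-Solver.solve-∀
  3j+5 : ∀ j → 3 * j + 3 + 2 ≡ 3 * (1 + j) + 2
  3j+5 = ℕ-Solver.solve-∀
  middle : ∀ k → 3 * k + 2 ≤ N → p₁ k < p k
  middle zero    _ = power-positive N 0 z≤n
  middle (suc j) h with e , refl , le ← split j 3 (ℕ.≤-trans (ℕ.≤-trans (ℕ.m≤m+n _ 2) (ℕ.≤-reflexive (3j+5 j))) h) =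
    power-increasing-< j e (ℕ.≤-trans (ℕ.≤-reflexive (eq′ j)) le)
    where
    eq′ : ∀ j → 1 + 2 * (1 + j) ≡ 2 * j + 3
    eq′ = ℕ-Solver.solve-∀
  3i+8 : ∀ i → 3 * i + 3 + 5 ≡ 3 * (2 + i) + 2
  3i+8 = ℕ-Solver.solve-∀
  tail : ∀ k → 3 * k + 2 ≤ N → 2 * N * p₂ k + p₂ k ≤ 2 * N * p₁ k + p₃ k
  tail zero          _ = ℕ.≤-refl
  tail (suc zero)    _ = ℕ.≤-trans (ℕ.≤-reflexive (cong (_+ 0) (ℕ.*-zeroʳ (2 * N)))) z≤n
  tail (suc (suc i)) h with e , refl , le ← split i 3 (ℕ.≤-trans (ℕ.≤-trans (ℕ.m≤m+n _ 5) (ℕ.≤-reflexive (3i+8 i))) h) =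
    ℕ.≤-trans (increasing-tail i e le) (ℕ.m≤m+n _ _)

-- The quadratic part peaks last, being shifted by two: it descends once N - (k - 2) ≤ 2(k - 1),
-- which is the condition N + 4 ≤ 3k. Strictness comes from the c₀ part.
product-decreasing : ∀ c₀ c₁ N a → 0 < c₀ → IsProduct c₀ c₁ N a →
  ∀ k → N + 4 ≤ 3 * k → k ≤ N → a (suc k) < a k
product-decreasing c₀ c₁ N a 0<c₀ a≡ zero h _ = contradiction (ℕ.≤-trans (ℕ.m≤n+m 4 N) h) λ ()
product-decreasing c₀ c₁ N a 0<c₀ a≡ (suc zero) h _ = contradiction (ℕ.≤-trans (ℕ.m≤n+m 4 N) h) λ { (s≤s (s≤s (s≤s ()))) }
product-decreasing c₀ c₁ N a 0<c₀ a≡ k@(suc (suc i)) h k≤N = ℕ.+-cancelʳ-< (p₃ k + p₃ (suc k)) _ _ (begin-strict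
  a (suc k) + (p₃ k + p₃ (suc k))
    ≡⟨ trans (ℕ.+-assoc (a (suc k)) (p₃ (suc k)) (p₃ k)) (cong (_+_ (a (suc k))) (ℕ.+-comm (p₃ (suc k)) (p₃ k))) ⟨
  a (suc k) + p₃ (suc k) + p₃ k
    ≡⟨ cong (_+ p₃ k) (a≡ (suc k) (s≤s k≤N)) ⟩
  c₀ * p (suc k) + (c₁ * p k + 2 * N * p₁ k) + p₃ k
    ≡⟨ regroup (c₀ * p (suc k)) (c₁ * p k) (2 * N * p₁ k) (p₃ k) ⟩
  c₀ * p (suc k) + (c₁ * p k + (2 * N * p₁ k + p₃ k))
    <⟨ ℕ.+-mono-<-≤ (ℕ.*-monoʳ-< c₀ {{ℕ.>-nonZero 0<c₀}} head) (ℕ.+-mono-≤ (ℕ.*-monoʳ-≤ c₁ middle) tail) ⟩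
  c₀ * p k + (c₁ * p₁ k + (2 * N * p₂ k + p₂ k))
    ≡⟨ regroup (c₀ * p k) (c₁ * p₁ k) (2 * N * p₂ k) (p₂ k) ⟨
  c₀ * p k + (c₁ * p₁ k + 2 * N * p₂ k) + p₂ k
    ≡⟨ cong (_+ p₃ (suc k)) (a≡ k (ℕ.m≤n⇒m≤1+n k≤N)) ⟨
  a k + p₃ k + p₃ (suc k)
    ≡⟨ ℕ.+-assoc (a k) (p₃ k) (p₃ (suc k)) ⟩
  a k + (p₃ k + p₃ (suc k)) ∎)
  where
  open ℕ.≤-Reasoning
  p = power N
  p₁ = shift p
  p₂ = shift p₁
  p₃ = shift p₂
  split : ∀ j → j ≤ N → ∃[ e ] j + e ≡ N × j + e + 4 ≤ 3 * k
  split j j≤N with ℕ.m≤n⇒∃[o]m+o≡n j≤N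
  ... | e , refl = e , refl , h
  i≤N : i ≤ N
  i≤N = ℕ.≤-trans (ℕ.≤-trans (ℕ.n≤1+n i) (ℕ.n≤1+n (suc i))) k≤N
  head : p (suc k) < p k
  head with e , refl , le ← split k k≤N = power-decreasing-< k e (ℕ.+-cancelˡ-≤ k _ _ (ℕ.+-cancelʳ-≤ 4 _ _ (begin
    k + suc e + 4          ≡⟨ cong (_+ 4) (ℕ.+-suc k e) ⟩
    suc (k + e + 4)        ≤⟨ s≤s le ⟩
    suc (3 * k)            ≤⟨ ℕ.m≤m+n (suc (3 * k)) 5 ⟩
    suc (3 * k) + 5        ≡⟨ eq i ⟩
    k + 2 * suc k + 4      ∎)))
    where
    eq : ∀ i → 1 + 3 * (2 + i) + 5 ≡ (2 + i) + 2 * (3 + i) + 4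
    eq = ℕ-Solver.solve-∀
  middle : p k ≤ p₁ k
  middle with e , refl , le ← split (suc i) (ℕ.<⇒≤ k≤N) = power-decreasing (suc i) e
    (ℕ.+-cancelˡ-≤ (suc i) _ _ (ℕ.+-cancelʳ-≤ 4 _ _ (ℕ.≤-trans le (ℕ.≤-trans (ℕ.m≤m+n _ 3) (ℕ.≤-reflexive (eq i))))))
    where
    eq : ∀ i → 3 * (2 + i) + 3 ≡ (1 + i) + 2 * (2 + i) + 4
    eq = ℕ-Solver.solve-∀
  tail : 2 * N * p₁ k + p₃ k ≤ 2 * N * p₂ k + p₂ k
  tail with e , refl , le ← split i i≤N = decreasing-tail i e
    (ℕ.+-cancelˡ-< i _ _ (ℕ.<-≤-trans (ℕ.≤-reflexive (cong suc (ℕ.+-identityʳ i))) (ℕ.<⇒≤ k≤N)))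
    (ℕ.+-cancelˡ-≤ i _ _ (ℕ.+-cancelʳ-≤ 4 _ _ (ℕ.≤-trans le (ℕ.≤-reflexive (eq i)))))
    where
    eq : ∀ i → 3 * (2 + i) ≡ i + 2 * (1 + i) + 4
    eq = ℕ-Solver.solve-∀

-- With n = N + 3 the bounds are the two thresholds above. An index below the floor has 3t + 2 ≤ N,
-- so its successor is larger; an index beyond the ceiling has a predecessor k with N + 4 ≤ 3k,
-- which is larger.
product-max-bounds : ∀ c₀ c₁ N a → 0 < c₀ → 0 < c₁ → IsProduct c₀ c₁ N a → ∀ t → IsMaxAt a (suc N) t →
  suc N / 3 ≤ t × t ≤ ⌈ (3 + N + 1) / 3 ⌉
product-max-bounds c₀ c₁ N a 0<c₀ 0<c₁ a≡ t (t≤ , max) = ℕ.≮⇒≥ low , ℕ.≮⇒≥ (high t t≤ max)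
  where
  open ℕ.≤-Reasoning
  low : ¬ t < suc N / 3
  low t< = ℕ.<⇒≱ (product-increasing c₀ c₁ N a 0<c₁ a≡ t (ℕ.s≤s⁻¹ below))
    (max (suc t) (ℕ.≤-trans t< (ℕ.m/n≤m (suc N) 3)))
    where
    below : suc (3 * t + 2) ≤ suc N
    below = begin
      suc (3 * t + 2)    ≡⟨ eq t ⟩
      suc t * 3          ≤⟨ ℕ.*-monoˡ-≤ 3 t< ⟩
      suc N / 3 * 3      ≤⟨ ℕ.m/n*n≤m (suc N) 3 ⟩
      suc N              ∎
      where
      eq : ∀ t → 1 + (3 * t + 2) ≡ (1 + t) * 3
      eq = ℕ-Solver.solve-∀
  high : ∀ t → t ≤ suc N → (∀ k → k ≤ suc N → a k ≤ a t) → ¬ ⌈ (3 + N + 1) / 3 ⌉ < t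
  high (suc k) (s≤s k≤N) max (s≤s q≤k) =
    ℕ.<⇒≱ (product-decreasing c₀ c₁ N a 0<c₀ a≡ k above k≤N) (max k (ℕ.m≤n⇒m≤1+n k≤N))
    where
    M = 3 + N + 1 + 2
    above : N + 4 ≤ 3 * k
    above = ℕ.+-cancelˡ-≤ 2 _ _ (begin
      2 + (N + 4)              ≡⟨ eq N ⟩
      M                        ≡⟨ ℕ.m≡m%n+[m/n]*n M 3 ⟩
      M ℕ.% 3 + M / 3 * 3      ≤⟨ ℕ.+-mono-≤ (ℕ.s≤s⁻¹ (ℕ.m%n<n M 3)) (ℕ.*-monoˡ-≤ 3 q≤k) ⟩
      2 + k * 3                ≡⟨ cong (_+_ 2) (ℕ.*-comm k 3) ⟩
      2 + 3 * k                ∎)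
      where
      eq : ∀ N → 2 + (N + 4) ≡ 3 + N + 1 + 2
      eq = ℕ-Solver.solve-∀

product-shape : ∀ c₀ c₁ N a → 0 < c₀ → 0 < c₁ → c₀ * (2 * N) ≤ c₁ * c₁ →
  (∀ j → a j ≡ ∣ coeff ((X+2 ^ₚ N) *ₚ negCubic c₀ c₁ N) j ∣) →
  Unimodal a (suc N) × LogConcave a (suc N) ×
  (∀ t → IsMaxAt a (suc N) t → suc N / 3 ≤ t × t ≤ ⌈ (3 + N + 1) / 3 ⌉)
product-shape c₀ c₁ N a 0<c₀ 0<c₁ lc a≡ =
  logConcave⇒unimodal a (suc N) pos logConcave′ , logConcave′ , product-max-bounds c₀ c₁ N a 0<c₀ 0<c₁ isProduct
  where
  p = power N
  -- All N factors are spent, so z = 0 and s = N + 1, the last index of the sequence.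
  open Shape (shape-product c₀ c₁ N N 0 0<c₀ 0<c₁ lc (ℕ.+-identityʳ N))
  pos : ∀ j → j ≤ suc N → 0 < a j
  pos j j≤ = subst (0 <_) (sym (a≡ j)) (positive j j≤)
  logConcave′ : LogConcave a (suc N)
  logConcave′ i i< = ≡.subst₂ _≤_ (sym (cong₂ _*_ (a≡ i) (a≡ (2 + i))))
    (trans (sym (cong₂ _*_ (a≡ (suc i)) (a≡ (suc i)))) (cong (_*_ (a (suc i))) (sym (ℕ.*-identityʳ (a (suc i))))))
    (logConcave i (ℕ.<⇒≤ i<))
  isProduct : IsProduct c₀ c₁ N a
  isProduct j j≤ = ℤ.+-injective (trans (cong (ℤ._+ + shift (shift (shift p)) j)
    (trans (cong +_ (a≡ j)) (sym (nonNeg j (ℕ.m≤n⇒m≤1+n j≤))))) (coeff-product c₀ c₁ N N j))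

-- Write c₁ = u + P with u = 4(m - 1) and P = Σ v². Every entry of v is at least d - 1, so m(d - 1)²
-- ≤ P. Hence 2k c₀ = 4k · m(d - 1)² ≤ u P.
coefficients-logConcave : ∀ k d′ g → 2 + k ≡ suc d′ + g →
  constantTerm k d′ * (2 * k) ≤ linearTerm k d′ g * linearTerm k d′ g
coefficients-logConcave k d′ g m≡ = begin
  2 * (2 + k) * (d′ * d′) * (2 * k)       ≡⟨ eq k (d′ * d′) ⟩
  4 * k * ((2 + k) * (d′ * d′))           ≡⟨ cong (λ m → 4 * k * (m * (d′ * d′))) m≡ ⟩
  4 * k * ((suc d′ + g) * (d′ * d′))      ≡⟨ cong (_*_ (4 * k)) (ℕ.*-distribʳ-+ (d′ * d′) (suc d′) g) ⟩
  4 * k * (suc d′ * (d′ * d′) + g * (d′ * d′))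
    ≤⟨ ℕ.*-mono-≤ (ℕ.*-monoʳ-≤ 4 (ℕ.n≤1+n k)) (ℕ.+-monoʳ-≤ (suc d′ * (d′ * d′)) (ℕ.*-monoʳ-≤ g
         (ℕ.*-mono-≤ (ℕ.m≤n+m d′ 2) (ℕ.m≤n+m d′ 2)))) ⟩
  u * P                                   ≤⟨ ℕ.*-mono-≤ (ℕ.m≤m+n u P) (ℕ.m≤n+m P u) ⟩
  (u + P) * (u + P)                       ∎
  where
  open ℕ.≤-Reasoning
  u = 4 * (1 + k)
  P = suc d′ * (d′ * d′) + g * ((2 + d′) * (2 + d′))
  eq : ∀ k x → 2 * (2 + k) * x * (2 * k) ≡ 4 * k * ((2 + k) * x)
  eq = ℕ-Solver.solve-∀

-- Paths in trees

module Paths {n} (T : Tree n) where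
  open Tree T
  open DecMembership (Fin._≟_ {n}) using (_∈?_)

  IsPath : ∀ {u v} → Walk u v → Set
  IsPath w = Unique (vertices w)

  first∈ : ∀ {u v} (w : Walk u v) → u ∈ vertices w
  first∈ ε       = here refl
  first∈ (_ ◅ _) = here refl

  last∈ : ∀ {u v} (w : Walk u v) → v ∈ vertices w
  last∈ ε       = here refl
  last∈ (_ ◅ w) = there (last∈ w)

  length-vertices : ∀ {u v} (w : Walk u v) → List.length (vertices w) ≡ suc (edgeCount w)
  length-vertices ε       = refl
  length-vertices (_ ◅ w) = cong suc (length-vertices w)

  All-∉ : ∀ {x : Fin n} {xs} → x ∉ xs → All (x ≢_) xs
  All-∉ x∉xs = All.tabulate λ {y} y∈xs x≡y → x∉xs (subst (_∈ _) (sym x≡y) y∈xs)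

  record SplitAt {u v} (w : Walk u v) (x : Fin n) : Set where
    field
      front       : Walk u x
      back        : Walk x v
      count       : edgeCount front + edgeCount back ≡ edgeCount w
      back-isPath : IsPath w → IsPath back
      back⊆       : ∀ {y} → y ∈ vertices back → y ∈ vertices w

  splitAt : ∀ {u v x} (w : Walk u v) → x ∈ vertices w → SplitAt w x
  splitAt ε (here refl) = record { front = ε ; back = ε ; count = refl ; back-isPath = id ; back⊆ = id }
  splitAt (e ◅ w) (here refl) = record { front = ε ; back = e ◅ w ; count = refl ; back-isPath = id ; back⊆ = id }
  splitAt (e ◅ w) (there x∈w) = record
    { front = e ◅ front ; back = back ; count = cong suc count
    ; back-isPath = λ { (_ ∷ unique) → back-isPath unique } ; back⊆ = there ∘ back⊆ }
    where open SplitAt (splitAt w x∈w)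

  eraseLoops : ∀ {u v} (w : Walk u v) →
    ∃[ p ] IsPath {u} {v} p × (∀ {y} → y ∈ vertices p → y ∈ vertices w)
  eraseLoops ε = ε , ([] ∷ []) , id
  eraseLoops {u} (e ◅ w) with eraseLoops w
  ... | p , isPath , p⊆w with u ∈? vertices p
  ...   | yes u∈p = back , back-isPath isPath , there ∘ p⊆w ∘ back⊆
    where open SplitAt (splitAt p u∈p)
  ...   | no  u∉p = e ◅ p , (All-∉ u∉p ∷ isPath) , λ { (here y≡u) → here y≡u ; (there y∈p) → there (p⊆w y∈p) }

  backtrack : ∀ {x y z} → Walk x z → Walk y z → Walk x y
  backtrack p ε       = p
  backtrack p (e ◅ q) = backtrack p q ◅◅ (symm e ◅ ε)

  All-snoc : ∀ {x y z} {P : Fin n → Set} (w : Walk x y) (e : Adj y z) →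
    All P (vertices w) → P z → All P (vertices (w ◅◅ (e ◅ ε)))
  All-snoc ε       e (py ∷ []) pz = py ∷ pz ∷ []
  All-snoc (_ ◅ w) e (px ∷ pw) pz = px ∷ All-snoc w e pw pz

  All-backtrack : ∀ {x y z} {P : Fin n → Set} (p : Walk x z) (q : Walk y z) →
    All P (vertices p) → All P (vertices q) → All P (vertices (backtrack p q))
  All-backtrack p ε       pp pq        = pp
  All-backtrack p (e ◅ q) pp (py ∷ pq) = All-snoc (backtrack p q) (symm e) (All-backtrack p q pp pq) py

  -- Two paths that leave u in different directions and meet again close up to a cycle.
  noDetour : ∀ {u x y v} → Adj u x → Adj u y → x ≢ y → (p : Walk x v) (q : Walk y v) →
    All (u ≢_) (vertices p) → All (u ≢_) (vertices q) → ∀ {A : Set} → A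
  noDetour {u} {x} {y} ux uy x≢y p q u∉p u∉q with eraseLoops (backtrack p q)
  ... | c , isPath , c⊆ = contradiction cycle acyclic
    where
    u∉c : u ∉ vertices c
    u∉c u∈c = All.lookup (All-backtrack p q u∉p u∉q) (c⊆ u∈c) refl
    nonTrivial : ∀ {x y} (c : Walk x y) → x ≢ y → 1 ≤ edgeCount c
    nonTrivial ε       x≢x = contradiction refl x≢x
    nonTrivial (_ ◅ _) _   = s≤s z≤n
    cycle : Cycle
    cycle = record
      { path = record { walk = ux ◅ c ; distinct = All-∉ u∉c ∷ isPath }
      ; long = s≤s (nonTrivial c x≢y) ; closing = symm uy }

  -- Vertex lists are compared and not walks, because `Adj` may hold in several ways. Paths whose
  -- first steps differ would close a cycle.
  path-unique : ∀ {u v} (p q : Walk u v) → IsPath p → IsPath q → vertices p ≡ vertices q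
  path-unique ε       ε       _ _ = refl
  path-unique ε       (_ ◅ q) _ unique = contradiction (last∈ q) (Unique.Unique[x∷xs]⇒x∉xs unique)
  path-unique (_ ◅ p) ε       unique _ = contradiction (last∈ p) (Unique.Unique[x∷xs]⇒x∉xs unique)
  path-unique {u} (_◅_ {j = x} ux p) (_◅_ {j = y} uy q) (u∉p ∷ pathᵖ) (u∉q ∷ pathᑫ) with x Fin.≟ y
  ... | yes refl = cong (u ∷_) (path-unique p q pathᵖ pathᑫ)
  ... | no  x≢y  = noDetour ux uy x≢y p q u∉p u∉q

  pathTo : ∀ u v → Walk u v
  pathTo u v = Path.walk (connected u v)

  dist-isPath : ∀ {u v} (p : Walk u v) → IsPath p → dist u v ≡ edgeCount p
  dist-isPath {u} {v} p isPath = ℕ.suc-injective (begin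
    suc (dist u v)                        ≡⟨ length-vertices (pathTo u v) ⟨
    List.length (vertices (pathTo u v))   ≡⟨ cong List.length (path-unique _ p (Path.distinct (connected u v)) isPath) ⟩
    List.length (vertices p)              ≡⟨ length-vertices p ⟩
    suc (edgeCount p)                     ∎)
    where open ≡-Reasoning

-- Rooting a tree: the edges correspond to the vertices other than the root

module Rooted {n} (T : Tree n) (root : Fin n) where
  open Tree T
  open Paths T
  open DecMembership (Fin._≟_ {n}) using (_∈?_)

  ancestors : Fin n → List (Fin n)
  ancestors u = vertices (pathTo u root)

  ancestors-isPath : ∀ u → Unique (ancestors u)
  ancestors-isPath u = Path.distinct (connected u root)

  self∈ : ∀ u → u ∈ ancestors u
  self∈ u = first∈ (pathTo u root)

  ancestors-root : ancestors root ≡ root ∷ []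
  ancestors-root = path-unique (pathTo root root) ε (ancestors-isPath root) ([] ∷ [])

  ancestors-step : ∀ {a b} → Adj a b → a ∉ ancestors b → ancestors a ≡ a ∷ ancestors b
  ancestors-step {a} {b} ab a∉ = path-unique (pathTo a root) (ab ◅ pathTo b root) (ancestors-isPath a)
    (All-∉ a∉ ∷ ancestors-isPath b)

  -- Rules out that two distinct vertices are ancestors of each other, so every edge gets a
  -- direction.
  ancestor-shorter : ∀ {a b} → a ≢ b → a ∈ ancestors b → dist a root < dist b root
  ancestor-shorter {a} {b} a≢b a∈ = begin-strict
    dist a root                        ≡⟨ dist-isPath back (back-isPath (ancestors-isPath b)) ⟩
    edgeCount back                     <⟨ ℕ.m<n+m (edgeCount back) (nonTrivial front) ⟩
    edgeCount front + edgeCount back   ≡⟨ count ⟩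
    dist b root                        ∎
    where
    open ℕ.≤-Reasoning
    open SplitAt (splitAt (pathTo b root) a∈)
    nonTrivial : (w : Walk b a) → 0 < edgeCount w
    nonTrivial ε       = contradiction refl a≢b
    nonTrivial (_ ◅ _) = z<s

  adj⇒≢ : ∀ {a b} → Adj a b → a ≢ b
  adj⇒≢ ab a≡b = irrefl a≡b ab

  Parent : Fin n → Fin n → Set
  Parent c p = ancestors c ≡ c ∷ ancestors p

  parent⇒∉ : ∀ {c p} → Parent c p → c ∉ ancestors p
  parent⇒∉ {c} eq = Unique.Unique[x∷xs]⇒x∉xs (subst Unique eq (ancestors-isPath c))

  parent⇒∈ : ∀ {c p} → Parent c p → p ∈ ancestors c
  parent⇒∈ {c} {p} eq = subst (p ∈_) (sym eq) (there (self∈ p))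

  parent⇒≢root : ∀ {c p} → Parent c p → c ≢ root
  parent⇒≢root {c} {p} eq refl = contradiction
    (subst (p ∈_) (List.∷-injectiveʳ (trans (sym eq) ancestors-root)) (self∈ p)) λ ()

  ancestors-injective : ∀ {u v} → ancestors u ≡ ancestors v → u ≡ v
  ancestors-injective {u} {v} eq = List.∷-injectiveˡ (trans (sym (proj₂ (cons u))) (trans eq (proj₂ (cons v))))
    where
    cons : ∀ u → ∃[ us ] ancestors u ≡ u ∷ us
    cons u with pathTo u root
    ... | ε     = _ , refl
    ... | _ ◅ _ = _ , refl

  parent-unique : ∀ {c p q} → Parent c p → Parent c q → p ≡ q
  parent-unique eqᵖ eqᑫ = ancestors-injective (List.∷-injectiveʳ (trans (sym eqᵖ) eqᑫ))

  -- For adjacent vertices, the end farther from the root. It represents the edge, as each vertex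
  -- but the root has exactly one edge towards the root.
  child : Fin n → Fin n → Fin n
  child a b with a ∈? ancestors b
  ... | yes _ = b
  ... | no  _ = a

  child-up : ∀ {a b} → a ∉ ancestors b → child a b ≡ a
  child-up {a} {b} a∉ with a ∈? ancestors b
  ... | yes a∈ = contradiction a∈ a∉
  ... | no  _  = refl

  child-down : ∀ {a b} → a ∈ ancestors b → child a b ≡ b
  child-down {a} {b} a∈ with a ∈? ancestors b
  ... | yes _  = refl
  ... | no  a∉ = contradiction a∈ a∉

  orient : ∀ {a b} → Adj a b → (child a b ≡ a × Parent a b) ⊎ (child a b ≡ b × Parent b a)
  orient {a} {b} ab with a ∈? ancestors b
  ... | no  a∉ = inj₁ (refl , ancestors-step ab a∉)
  ... | yes a∈ = inj₂ (refl , ancestors-step (symm ab) λ b∈ →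
    ℕ.<-asym (ancestor-shorter (adj⇒≢ ab) a∈) (ancestor-shorter (adj⇒≢ ab ∘ sym) b∈))

  child≢root : ∀ {a b} → Adj a b → child a b ≢ root
  child≢root ab with orient ab
  ... | inj₁ (eq , parent) = subst (_≢ root) (sym eq) (parent⇒≢root parent)
  ... | inj₂ (eq , parent) = subst (_≢ root) (sym eq) (parent⇒≢root parent)

  child-injective : ∀ {a b a′ b′} → Adj a b → Adj a′ b′ → child a b ≡ child a′ b′ →
    (a ≡ a′ × b ≡ b′) ⊎ (a ≡ b′ × b ≡ a′)
  child-injective ab ab′ c≡c′ with orient ab | orient ab′
  ... | inj₁ (c≡ , parent) | inj₁ (c′≡ , parent′) with refl ← trans (sym c≡) (trans c≡c′ c′≡) =
    inj₁ (refl , parent-unique parent parent′)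
  ... | inj₁ (c≡ , parent) | inj₂ (c′≡ , parent′) with refl ← trans (sym c≡) (trans c≡c′ c′≡) =
    inj₂ (refl , parent-unique parent parent′)
  ... | inj₂ (c≡ , parent) | inj₁ (c′≡ , parent′) with refl ← trans (sym c≡) (trans c≡c′ c′≡) =
    inj₂ (parent-unique parent parent′ , refl)
  ... | inj₂ (c≡ , parent) | inj₂ (c′≡ , parent′) with refl ← trans (sym c≡) (trans c≡c′ c′≡) =
    inj₁ (parent-unique parent parent′ , refl)

  child-surjective : ∀ c → c ≢ root → ∃[ p ] Adj c p × child c p ≡ c
  child-surjective c c≢root = go (pathTo c root) (ancestors-isPath c)
    where
    go : (w : Walk c root) → IsPath w → ∃[ p ] Adj c p × child c p ≡ c
    go ε _ = contradiction refl c≢root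
    go w@(_◅_ {j = p} cp w′) isPath@(_ ∷ isPath′) = p , cp , child-up (parent⇒∉ parent)
      where
      parent : Parent c p
      parent = trans (path-unique (pathTo c root) w (ancestors-isPath c) isPath)
        (cong (c ∷_) (path-unique w′ (pathTo p root) isPath′ (ancestors-isPath p)))

  -- side c u tells on which side of the edge above c the vertex u lies.
  side : Fin n → Fin n → Bool
  side c u = does (c ∈? ancestors u)

  side-parent : ∀ {c p w} → Parent c p → w ≢ c → side w c ≡ side w p
  side-parent {c} {p} {w} parent w≢c = does-⇔ (mk⇔ to from) (w ∈? ancestors c) (w ∈? ancestors p)
    where
    to : w ∈ ancestors c → w ∈ ancestors p
    to w∈ with subst (w ∈_) parent w∈
    ... | here w≡c  = contradiction w≡c w≢c
    ... | there w∈p = w∈p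
    from : w ∈ ancestors p → w ∈ ancestors c
    from w∈p = subst (w ∈_) (sym parent) (there w∈p)

  side-self : ∀ c → side c c ≡ true
  side-self c = dec-true (c ∈? ancestors c) (self∈ c)

  side-above : ∀ {c p} → Parent c p → side c p ≡ false
  side-above {c} {p} parent = dec-false (c ∈? ancestors p) (parent⇒∉ parent)

  -- The ancestor lists of two adjacent vertices differ only by the child end, so crossing an edge
  -- changes the side for that edge alone.
  side-step : ∀ {a b w} → Adj a b → w ≢ child a b → side w a ≡ side w b
  side-step ab w≢ with orient ab
  ... | inj₁ (eq , parent) = side-parent parent (subst (_ ≢_) eq w≢)
  ... | inj₂ (eq , parent) = sym (side-parent parent (subst (_ ≢_) eq w≢))

  side-child : ∀ {a b} → Adj a b → side (child a b) a ≡ not (side (child a b) b)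
  side-child {a} {b} ab with orient ab
  ... | inj₁ (eq , parent) rewrite eq | side-self a | side-above parent = refl
  ... | inj₂ (eq , parent) rewrite eq | side-self b | side-above parent = refl

  -- A walk that avoids `u` never uses the edge from `u` to `b`, the only one that could change this
  -- side.
  side-avoids : ∀ {u b x y} → Adj u b → (w : Walk x y) → All (u ≢_) (vertices w) →
    side (child u b) x ≡ side (child u b) y
  side-avoids ub ε       _           = refl
  side-avoids {u} {b} ub (_◅_ {j = z} xz w) (u≢x ∷ u∉w) = trans (side-step xz c≢) (side-avoids ub w u∉w)
    where
    c≢ : child u b ≢ _
    c≢ eq with child-injective ub xz eq
    ... | inj₁ (u≡x , _) = u≢x u≡x
    ... | inj₂ (u≡z , _) = All.lookup u∉w (first∈ w) u≡z

-- Lists without repetition and finite sums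

open CommutativeMonoidSum ℕ.+-0-commutativeMonoid using (∑-distrib-+) renaming (sum to sumℕ; sum-cong-≗ to sumℕ-cong)

lookup-injective : ∀ {A : Set} {xs : List A} → Unique xs → ∀ i j → List.lookup xs i ≡ List.lookup xs j → i ≡ j
lookup-injective (x∉ ∷ _) zero    zero    _  = refl
lookup-injective (x∉ ∷ _) zero    (suc j) eq = contradiction eq (All.lookup x∉ (∈.∈-lookup j))
lookup-injective (x∉ ∷ _) (suc i) zero    eq = contradiction (sym eq) (All.lookup x∉ (∈.∈-lookup i))
lookup-injective (_ ∷ u)  (suc i) (suc j) eq = cong suc (lookup-injective u i j eq)

module _ {A B : Set} (f : A → Maybe B) where

  ∈-mapMaybe⁺ : ∀ {x y xs} → x ∈ xs → f x ≡ just y → y ∈ List.mapMaybe f xs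
  ∈-mapMaybe⁺ {x} (here refl) eq with f x | eq
  ... | just _ | refl = here refl
  ∈-mapMaybe⁺ {xs = x′ ∷ _} (there x∈xs) eq with f x′
  ... | just _  = there (∈-mapMaybe⁺ x∈xs eq)
  ... | nothing = ∈-mapMaybe⁺ x∈xs eq

  ∈-mapMaybe⁻ : ∀ {y} xs → y ∈ List.mapMaybe f xs → ∃[ x ] x ∈ xs × f x ≡ just y
  ∈-mapMaybe⁻ (x ∷ xs) y∈ with f x in eq
  ∈-mapMaybe⁻ (x ∷ xs) (here refl) | just _ = x , here refl , eq
  ∈-mapMaybe⁻ (x ∷ xs) (there y∈)  | just _ with x′ , x′∈ , eq′ ← ∈-mapMaybe⁻ xs y∈ = x′ , there x′∈ , eq′
  ∈-mapMaybe⁻ (x ∷ xs) y∈          | nothing with x′ , x′∈ , eq′ ← ∈-mapMaybe⁻ xs y∈ = x′ , there x′∈ , eq′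

  mapMaybe-unique : (∀ {x x′ y} → f x ≡ just y → f x′ ≡ just y → x ≡ x′) →
    ∀ {xs} → Unique xs → Unique (List.mapMaybe f xs)
  mapMaybe-unique inj {[]}     []         = []
  mapMaybe-unique inj {x ∷ xs} (x∉ ∷ unique) with f x in eq
  ... | nothing = mapMaybe-unique inj unique
  ... | just y  = All.tabulate fresh ∷ mapMaybe-unique inj unique
    where
    fresh : ∀ {z} → z ∈ List.mapMaybe f xs → y ≢ z
    fresh z∈ refl with x′ , x′∈ , eq′ ← ∈-mapMaybe⁻ xs z∈ = All.lookup x∉ x′∈ (inj eq eq′)

open V₂

V₂-≡ : ∀ {n} {e e′ : V₂ n} → fst e ≡ fst e′ → snd e ≡ snd e′ → e ≡ e′
V₂-≡ {e = pair i j i<j} {pair i j i<j′} refl refl = cong (pair i j) (Fin.<-irrelevant i<j i<j′)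

private
  toV₂-endpoints : ∀ {n} {i j : Fin n} {e} → Maybe.map (pair i j) (dec⇒maybe (i Fin.<? j)) ≡ just e →
    (i , j) ≡ (fst e , snd e)
  toV₂-endpoints {i = i} {j} eq with i Fin.<? j | eq
  ... | yes _ | refl = refl

  toV₂-just : ∀ {n} (e : V₂ n) → Maybe.map (pair (fst e) (snd e)) (dec⇒maybe (fst e Fin.<? snd e)) ≡ just e
  toV₂-just (pair i j i<j) with i Fin.<? j
  ... | yes _  = cong just (V₂-≡ refl refl)
  ... | no i≮j = contradiction i<j i≮j

allV₂-unique : ∀ n → Unique (allV₂ n)
allV₂-unique n = mapMaybe-unique _ (λ eq eq′ → trans (toV₂-endpoints eq) (sym (toV₂-endpoints eq′)))
  (Unique.cartesianProduct⁺ (Unique.allFin⁺ n) (Unique.allFin⁺ n))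

∈-allV₂ : ∀ {n} (e : V₂ n) → e ∈ allV₂ n
∈-allV₂ e = ∈-mapMaybe⁺ _ (∈.∈-cartesianProduct⁺ (∈.∈-allFin (fst e)) (∈.∈-allFin (snd e))) (toV₂-just e)

sumℕ-mono-≤ : ∀ {m} (f g : Fin m → ℕ) → (∀ j → f j ≤ g j) → sumℕ f ≤ sumℕ g
sumℕ-mono-≤ {zero}  f g f≤g = z≤n
sumℕ-mono-≤ {suc m} f g f≤g = ℕ.+-mono-≤ (f≤g zero) (sumℕ-mono-≤ (f ∘ suc) (g ∘ suc) (f≤g ∘ suc))

sumℕ-≤ : ∀ {m} (f : Fin m → ℕ) → (∀ j → f j ≤ 1) → sumℕ f ≤ m
sumℕ-≤ {zero}  f f≤1 = z≤n
sumℕ-≤ {suc m} f f≤1 = ℕ.+-mono-≤ (f≤1 zero) (sumℕ-≤ (f ∘ suc) (f≤1 ∘ suc))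

sumℕ-zero : ∀ {m} (f : Fin m → ℕ) → (∀ j → f j ≡ 0) → sumℕ f ≡ 0
sumℕ-zero {zero}  f f≡0 = refl
sumℕ-zero {suc m} f f≡0 = cong₂ _+_ (f≡0 zero) (sumℕ-zero (f ∘ suc) (f≡0 ∘ suc))

sumℕ-suc : ∀ {m} (f g : Fin m → ℕ) j → f j ≡ suc (g j) → (∀ i → i ≢ j → f i ≡ g i) → sumℕ f ≡ suc (sumℕ g)
sumℕ-suc {suc m} f g zero    at off = cong₂ _+_ at (sumℕ-cong λ i → off (suc i) λ ())
sumℕ-suc {suc m} f g (suc j) at off = trans
  (cong₂ _+_ (off zero λ ()) (sumℕ-suc (f ∘ suc) (g ∘ suc) j at λ i i≢j → off (suc i) (i≢j ∘ Fin.suc-injective)))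
  (ℕ.+-suc (g zero) _)

differ : Bool → Bool → ℕ
differ true  true  = 0
differ true  false = 1
differ false true  = 1
differ false false = 0

differ-refl : ∀ x → differ x x ≡ 0
differ-refl true  = refl
differ-refl false = refl

differ-not : ∀ x → differ x (not x) ≡ 1
differ-not true  = refl
differ-not false = refl

differ-comm : ∀ x y → differ x y ≡ differ y x
differ-comm true  true  = refl
differ-comm true  false = refl
differ-comm false true  = refl
differ-comm false false = refl

differ-triangle : ∀ x y z → differ x z ≤ differ x y + differ y z
differ-triangle true  y     true  = z≤n
differ-triangle false y     false = z≤n
differ-triangle true  true  false = ℕ.≤-refl
differ-triangle true  false false = ℕ.≤-refl
differ-triangle false true  true  = ℕ.≤-refl
differ-triangle false false true  = ℕ.≤-refl

differ-≤1 : ∀ x y → differ x y ≤ 1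
differ-≤1 true  true  = z≤n
differ-≤1 true  false = ℕ.≤-refl
differ-≤1 false true  = ℕ.≤-refl
differ-≤1 false false = z≤n

-- Distances as numbers of separating edges, and the entries of the matrix

module Edges {n} (T : Tree n) (root : Fin n) where
  open Tree T
  open Paths T
  open Rooted T root

  m : ℕ
  m = List.length (edges T)

  edge : Fin m → V₂ n
  edge = List.lookup (edges T)

  edge-adj : ∀ j → Adj (fst (edge j)) (snd (edge j))
  edge-adj j = proj₂ (∈.∈-filter⁻ (λ e → adj? (fst e) (snd e)) {xs = allV₂ n} (∈.∈-lookup j))

  edge-injective : ∀ {i j} → edge i ≡ edge j → i ≡ j
  edge-injective = lookup-injective (Unique.filter⁺ (λ e → adj? (fst e) (snd e)) (allV₂-unique n)) _ _

  edge-surjective : ∀ e → IsEdge T e → ∃[ j ] edge j ≡ e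
  edge-surjective e adj = Any.index e∈ , sym (Any.lookup-index e∈)
    where
    e∈ : e ∈ edges T
    e∈ = ∈.∈-filter⁺ (λ e → adj? (fst e) (snd e)) (∈-allV₂ e) adj

  childOf : V₂ n → Fin n
  childOf e = child (fst e) (snd e)

  cut : Fin m → Fin n
  cut j = childOf (edge j)

  cut-injective : ∀ {i j} → cut i ≡ cut j → i ≡ j
  cut-injective {i} {j} eq with child-injective (edge-adj i) (edge-adj j) eq
  ... | inj₁ (f≡f , s≡s′) = edge-injective (V₂-≡ f≡f s≡s′)
  ... | inj₂ (f≡s , s≡f)  = contradiction (fst<snd (edge j))
    (Fin.<-asym (≡.subst₂ Fin._<_ f≡s s≡f (fst<snd (edge i))))

  child-comm : ∀ {a b} → Adj a b → child a b ≡ child b a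
  child-comm ab with orient ab
  ... | inj₁ (eq , parent) = trans eq (sym (child-down (parent⇒∈ parent)))
  ... | inj₂ (eq , parent) = trans eq (sym (child-up (parent⇒∉ parent)))

  cut-surjective : ∀ {a b} → Adj a b → ∃[ j ] cut j ≡ child a b
  cut-surjective {a} {b} ab with Fin.<-cmp a b
  ... | tri< a<b _ _ with j , eq ← edge-surjective (pair a b a<b) ab = j , cong childOf eq
  ... | tri≈ _ a≡b _ = contradiction a≡b (adj⇒≢ ab)
  ... | tri> _ _ b<a with j , eq ← edge-surjective (pair b a b<a) (symm ab) =
    j , trans (cong childOf eq) (sym (child-comm ab))

  separates : Fin n → Fin n → Fin n → ℕ
  separates c u v = differ (side c u) (side c v)

  -- The tree is embedded in a cube with one coordinate per edge, recording the side of that edge;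
  -- this is the distance in the cube.
  hamming : Fin n → Fin n → ℕ
  hamming u v = sumℕ λ j → separates (cut j) u v

  hamming-step : ∀ {u b v} → Adj u b → side (child u b) v ≡ side (child u b) b → hamming v u ≡ suc (hamming v b)
  hamming-step {u} {b} {v} ub same with j , cut≡ ← cut-surjective ub = sumℕ-suc _ _ j
    (begin
      separates (cut j) v u           ≡⟨ cong (λ c → separates c v u) cut≡ ⟩
      differ (side c v) (side c u)    ≡⟨ cong₂ differ same (side-child ub) ⟩
      differ (side c b) (not (side c b))  ≡⟨ differ-not (side c b) ⟩
      1                               ≡⟨ cong suc (differ-refl (side c b)) ⟨
      suc (differ (side c b) (side c b))  ≡⟨ cong (λ s → suc (differ s (side c b))) same ⟨
      suc (separates c v b)           ≡⟨ cong (λ c → suc (separates c v b)) cut≡ ⟨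
      suc (separates (cut j) v b)     ∎)
    λ i i≢j → cong (differ (side (cut i) v)) (side-step ub λ eq → i≢j (cut-injective (trans eq (sym cut≡))))
    where
    open ≡-Reasoning
    c = child u b

  hamming-refl : ∀ u → hamming u u ≡ 0
  hamming-refl u = sumℕ-zero (λ j → separates (cut j) u u) λ j → differ-refl (side (cut j) u)

  hamming-sym : ∀ u v → hamming u v ≡ hamming v u
  hamming-sym u v = sumℕ-cong λ j → differ-comm (side (cut j) u) (side (cut j) v)

  -- After its first step a path avoids `u`, so its end lies on the far side of the first edge and
  -- that step accounts for exactly one coordinate.
  hamming-path : ∀ {u v} (p : Walk u v) → IsPath p → hamming v u ≡ edgeCount p
  hamming-path {u} ε _ = hamming-refl u
  hamming-path {u} {v} (ub ◅ p) (u∉p ∷ isPath) =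
    trans (hamming-step ub (sym (side-avoids ub p u∉p))) (cong suc (hamming-path p isPath))

  dist-hamming : ∀ u v → dist u v ≡ hamming u v
  dist-hamming u v = trans (sym (hamming-path (pathTo u v) (Path.distinct (connected u v)))) (hamming-sym v u)

  dist-refl : ∀ u → dist u u ≡ 0
  dist-refl u = trans (dist-hamming u u) (hamming-refl u)

  dist-sym : ∀ u v → dist u v ≡ dist v u
  dist-sym u v = trans (dist-hamming u v) (trans (hamming-sym u v) (sym (dist-hamming v u)))

  dist-triangle : ∀ u v w → dist u w ≤ dist u v + dist v w
  dist-triangle u v w = begin
    dist u w                  ≡⟨ dist-hamming u w ⟩
    hamming u w               ≤⟨ sumℕ-mono-≤ _ _ (λ j → differ-triangle (side (cut j) u) (side (cut j) v) (side (cut j) w)) ⟩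
    sumℕ (λ j → separates (cut j) u v + separates (cut j) v w)
                              ≡⟨ ∑-distrib-+ _ (λ j → separates (cut j) v w) ⟩
    hamming u v + hamming v w ≡⟨ cong₂ _+_ (dist-hamming u v) (dist-hamming v w) ⟨
    dist u v + dist v w       ∎
    where open ℕ.≤-Reasoning

  dist-adj : ∀ {a b} → Adj a b → dist a b ≡ 1
  dist-adj ab = dist-isPath (ab ◅ ε) ((adj⇒≢ ab ∷ []) ∷ [] ∷ [])

  dist-step : ∀ {k l x} → Adj k l → side (child k l) x ≡ side (child k l) l → dist x k ≡ suc (dist x l)
  dist-step {k} {l} {x} kl same = trans (dist-hamming x k) (trans (hamming-step kl same) (cong suc (sym (dist-hamming x l))))

  dist-neighbour : ∀ {u b} → Adj u b → ∀ x → dist u x ≤ suc (dist b x)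
  dist-neighbour {u} {b} ub x = ℕ.≤-trans (dist-triangle u b x) (ℕ.≤-reflexive (cong (_+ dist b x) (dist-adj ub)))

  dist-≤-edgeCount : ∀ {u v} (w : Walk u v) → dist u v ≤ edgeCount w
  dist-≤-edgeCount {u} ε = ℕ.≤-reflexive (dist-refl u)
  dist-≤-edgeCount {v = v} (ub ◅ w) = ℕ.≤-trans (dist-neighbour ub v) (s≤s (dist-≤-edgeCount w))

  -- A walk from one side of the edge to the other must traverse it, and splitting the walk there
  -- bounds its length. The two alternatives are the two directions of traversal.
  crossing : ∀ {k l u v} → Adj k l → (w : Walk u v) → side (child k l) u ≢ side (child k l) v →
    suc (dist u k + dist l v) ≤ edgeCount w ⊎ suc (dist u l + dist k v) ≤ edgeCount w
  crossing kl ε u≢v = contradiction refl u≢v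
  crossing {k} {l} {u} {v} kl (_◅_ {j = b} ub w) u≢v with child k l Fin.≟ child u b
  ... | yes eq with child-injective kl ub eq
  ...   | inj₁ (refl , refl) = inj₁ (s≤s (≡.subst (λ x → x + dist l v ≤ edgeCount w) (sym (dist-refl k)) (dist-≤-edgeCount w)))
  ...   | inj₂ (refl , refl) = inj₂ (s≤s (≡.subst (λ x → x + dist k v ≤ edgeCount w) (sym (dist-refl l)) (dist-≤-edgeCount w)))
  crossing {k} {l} {u} {v} kl (_◅_ {j = b} ub w) u≢v | no c≢
    with crossing kl w (λ b≡v → u≢v (trans (side-step ub c≢) b≡v))
  ...   | inj₁ le = inj₁ (s≤s (ℕ.≤-trans (ℕ.+-monoˡ-≤ (dist l v) (dist-neighbour ub k)) le))
  ...   | inj₂ le = inj₂ (s≤s (ℕ.≤-trans (ℕ.+-monoˡ-≤ (dist k v) (dist-neighbour ub l)) le))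

  data Near (k l x : Fin n) : Set where
    nearˡ : side (child k l) x ≡ side (child k l) k → dist x l ≡ suc (dist x k) → Near k l x
    nearʳ : side (child k l) x ≡ side (child k l) l → dist x k ≡ suc (dist x l) → Near k l x

  near : ∀ {k l} → Adj k l → ∀ x → Near k l x
  near {k} {l} kl x with side (child k l) x Bool.≟ side (child k l) l
  ... | yes eq = nearʳ eq (dist-step kl eq)
  ... | no neq = nearˡ eq (dist-step (symm kl) (≡.subst (λ c → side c x ≡ side c k) (child-comm kl) eq))
    where
    eq : side (child k l) x ≡ side (child k l) k
    eq = trans (Bool.¬-not neq) (sym (side-child kl))

  opposite : ∀ {k l} → Adj k l → side (child k l) k ≢ side (child k l) l
  opposite kl eq = Bool.not-¬ {x = side (child _ _) _} refl (trans (sym eq) (side-child kl))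

  -- If `i` and `j` lie on the same side of the edge, both crossed sums are at least d(i,j) + 1,
  -- which is the third sum. If the edge separates them, the smaller crossed sum misses just the
  -- edge and equals d(i,j) - 1. Adding twice the indicator avoids subtraction.
  min-edge : ∀ {k l} → Adj k l → ∀ i j →
    ((dist i l + dist j k) ⊓ (dist i k + dist j l) ⊓ (dist i j + dist k l)) + 2 * separates (child k l) i j
    ≡ suc (dist i j)
  min-edge {k} {l} kl i j = go (near kl i) (near kl j)
    where
    c = child k l
    A = dist i l + dist j k
    B = dist i k + dist j l
    C = dist i j + dist k l

    C≡ : C ≡ suc (dist i j)
    C≡ = trans (cong (_+_ (dist i j)) (dist-adj kl)) (ℕ.+-comm (dist i j) 1)

    same : side c i ≡ side c j → suc (dist i j) ≤ A → suc (dist i j) ≤ B → (A ⊓ B ⊓ C) + 2 * separates c i j ≡ suc (dist i j)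
    same eq ≤A ≤B = begin
      (A ⊓ B ⊓ C) + 2 * separates c i j   ≡⟨ cong (λ x → (A ⊓ B ⊓ C) + 2 * x) (trans (cong (λ s → differ s (side c j)) eq) (differ-refl (side c j))) ⟩
      (A ⊓ B ⊓ C) + 0                     ≡⟨ ℕ.+-identityʳ _ ⟩
      A ⊓ B ⊓ C                           ≡⟨ ℕ.m≥n⇒m⊓n≡n (ℕ.⊓-glb (subst (_≤ A) (sym C≡) ≤A) (subst (_≤ B) (sym C≡) ≤B)) ⟩
      C                                   ≡⟨ C≡ ⟩
      suc (dist i j)                      ∎
      where open ≡-Reasoning

    other : side c i ≡ not (side c j) → ∀ M → suc M ≡ dist i j → A ⊓ B ≡ M → (A ⊓ B ⊓ C) + 2 * separates c i j ≡ suc (dist i j)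
    other eq M M≡ A⊓B≡ = begin
      (A ⊓ B ⊓ C) + 2 * separates c i j   ≡⟨ cong₂ (λ x y → x ⊓ C + 2 * y) A⊓B≡ (trans (cong (λ s → differ s (side c j)) eq) (trans (differ-comm _ (side c j)) (differ-not (side c j)))) ⟩
      M ⊓ C + 2                           ≡⟨ cong (_+ 2) (ℕ.m≤n⇒m⊓n≡m (subst (M ≤_) (sym C≡) (ℕ.m≤n⇒m≤1+n (subst (M ≤_) M≡ (ℕ.n≤1+n M))))) ⟩
      M + 2                               ≡⟨ ℕ.+-comm M 2 ⟩
      suc (suc M)                         ≡⟨ cong suc M≡ ⟩
      suc (dist i j)                      ∎
      where open ≡-Reasoning

    via : ∀ x → dist i j ≤ dist i x + dist j x
    via x = ℕ.≤-trans (dist-triangle i x j) (ℕ.≤-reflexive (cong (_+_ (dist i x)) (dist-sym x j)))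

    apart : side c i ≢ side c j → suc (dist i k + dist j l) ≤ dist i j ⊎ suc (dist i l + dist j k) ≤ dist i j
    apart i≢j = ≡.subst₂ (λ x y → suc (dist i k + x) ≤ dist i j ⊎ suc (dist i l + y) ≤ dist i j)
      (dist-sym l j) (dist-sym k j) (crossing kl (pathTo i j) i≢j)

    go : Near k l i → Near k l j → (A ⊓ B ⊓ C) + 2 * separates c i j ≡ suc (dist i j)
    go (nearˡ i~k il≡) (nearˡ j~k jl≡) = same (trans i~k (sym j~k))
      (ℕ.≤-trans (s≤s (via k)) (ℕ.≤-reflexive (cong (_+ dist j k) (sym il≡))))
      (ℕ.≤-trans (s≤s (via k)) (ℕ.≤-reflexive (trans (sym (ℕ.+-suc _ _)) (cong (_+_ (dist i k)) (sym jl≡)))))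
    go (nearʳ i~l ik≡) (nearʳ j~l jk≡) = same (trans i~l (sym j~l))
      (ℕ.≤-trans (s≤s (via l)) (ℕ.≤-reflexive (trans (sym (ℕ.+-suc _ _)) (cong (_+_ (dist i l)) (sym jk≡)))))
      (ℕ.≤-trans (s≤s (via l)) (ℕ.≤-reflexive (cong (_+ dist j l) (sym ik≡))))
    go (nearˡ i~k il≡) (nearʳ j~l jk≡) = other (trans i~k (trans (side-child kl) (cong not (sym j~l)))) B
      (ℕ.≤-antisym lower (ℕ.≤-trans (via k) (ℕ.≤-reflexive (trans (cong (_+_ (dist i k)) jk≡) (ℕ.+-suc _ _)))))
      (ℕ.m≥n⇒m⊓n≡n B≤A)
      where
      B≤A : B ≤ A
      B≤A = ℕ.+-mono-≤ (ℕ.≤-trans (ℕ.n≤1+n _) (ℕ.≤-reflexive (sym il≡))) (ℕ.≤-trans (ℕ.n≤1+n _) (ℕ.≤-reflexive (sym jk≡)))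
      lower : suc B ≤ dist i j
      -- The direction in which the path crosses the edge is left open; B ≤ A makes either answer
      -- sufficient.
      lower with apart (λ eq → opposite kl (trans (sym i~k) (trans eq j~l)))
      ... | inj₁ le = le
      ... | inj₂ le = ℕ.≤-trans (s≤s B≤A) le
    go (nearʳ i~l ik≡) (nearˡ j~k jl≡) = other (trans i~l (trans (sym (Bool.not-involutive _)) (cong not (sym (trans j~k (side-child kl)))))) A
      (ℕ.≤-antisym lower (ℕ.≤-trans (via l) (ℕ.≤-reflexive (trans (cong (_+_ (dist i l)) jl≡) (ℕ.+-suc _ _)))))
      (ℕ.m≤n⇒m⊓n≡m A≤B)
      where
      A≤B : A ≤ B
      A≤B = ℕ.+-mono-≤ (ℕ.≤-trans (ℕ.n≤1+n _) (ℕ.≤-reflexive (sym ik≡))) (ℕ.≤-trans (ℕ.n≤1+n _) (ℕ.≤-reflexive (sym jl≡)))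
      lower : suc A ≤ dist i j
      lower with apart (λ eq → opposite kl (trans (sym j~k) (trans (sym eq) i~l)))
      ... | inj₁ le = ℕ.≤-trans (s≤s A≤B) le
      ... | inj₂ le = le

  distOf : V₂ n → ℕ
  distOf f = dist (fst f) (snd f)

  onPath : V₂ n → Fin m → ℕ
  onPath f j = separates (cut j) (fst f) (snd f)

  Min4PC-edge : ∀ f j → Min4PC T f (edge j) + 2 * onPath f j ≡ suc (distOf f)
  Min4PC-edge f j = min-edge (edge-adj j) (fst f) (snd f)

  Min4PC-sym : ∀ e f → Min4PC T e f ≡ Min4PC T f e
  Min4PC-sym (pair i j _) (pair k l _) = cong₂ _⊓_ (cong₂ _⊓_
    (trans (ℕ.+-comm (dist i l) (dist j k)) (cong₂ _+_ (dist-sym j k) (dist-sym i l)))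
    (cong₂ _+_ (dist-sym i k) (dist-sym j l)))
    (ℕ.+-comm (dist i j) (dist k l))

  Min4PC-diag : ∀ f → Min4PC T f f ≡ 0
  Min4PC-diag (pair i j _) = trans (cong (λ x → (dist i j + dist j i) ⊓ x ⊓ (dist i j + dist i j))
    (cong₂ _+_ (dist-refl i) (dist-refl j))) (cong (_⊓ (dist i j + dist i j)) (ℕ.⊓-zeroʳ (dist i j + dist j i)))

  onPath-edge : ∀ i j → i ≢ j → onPath (edge i) j ≡ 0
  onPath-edge i j i≢j = trans (cong (differ (side (cut j) (fst (edge i)))) (sym (side-step (edge-adj i) λ eq → i≢j (sym (cut-injective eq)))))
    (differ-refl (side (cut j) (fst (edge i))))

  -- The case d = 1 of `Min4PC-edge`: the path of an edge contains no other edge.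
  Min4PC-offDiag : ∀ i j → i ≢ j → Min4PC T (edge i) (edge j) ≡ 2
  Min4PC-offDiag i j i≢j = begin
    Min4PC T (edge i) (edge j)                              ≡⟨ ℕ.+-identityʳ _ ⟨
    Min4PC T (edge i) (edge j) + 0                          ≡⟨ cong (λ x → Min4PC T (edge i) (edge j) + 2 * x) (onPath-edge i j i≢j) ⟨
    Min4PC T (edge i) (edge j) + 2 * onPath (edge i) j      ≡⟨ Min4PC-edge (edge i) j ⟩
    suc (distOf (edge i))                                   ≡⟨ cong suc (dist-adj (edge-adj i)) ⟩
    2                                                       ∎
    where open ≡-Reasoning

  sum-onPath : ∀ f → sumℕ (onPath f) ≡ distOf f
  sum-onPath f = sym (dist-hamming (fst f) (snd f))

  distOf-≤ : ∀ f → distOf f ≤ m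
  distOf-≤ f = subst (_≤ m) (sum-onPath f) (sumℕ-≤ (onPath f) λ j → differ-≤1 (side (cut j) (fst f)) (side (cut j) (snd f)))

  nonEdge-dist : ∀ f → ¬ IsEdge T f → 2 ≤ distOf f
  nonEdge-dist (pair i j i<j) ¬adj = go (pathTo i j) (ℕ.<⇒≢ i<j ∘ cong toℕ) ¬adj
    where
    go : ∀ {i j} (w : Walk i j) → i ≢ j → ¬ Adj i j → 2 ≤ edgeCount w
    go ε             i≢j _    = contradiction refl i≢j
    go (ij ◅ ε)      _   ¬adj = contradiction ij ¬adj
    go (_ ◅ (_ ◅ _)) _   _    = s≤s (s≤s z≤n)

-- Sending an edge to its child end matches the edges with the vertices other than the root; the
-- count follows from injections both ways.
edges-length : ∀ {n} (T : Tree (suc n)) → List.length (edges T) ≡ n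
edges-length {n} T = ℕ.≤-antisym
  (Fin.injective⇒≤ {f = λ j → Fin.punchOut (root≢ j)} λ {i} {j} eq → cut-injective (Fin.punchOut-injective (root≢ i) (root≢ j) eq))
  (Fin.injective⇒≤ {f = λ i → proj₁ (edgeAbove i)} λ {i} {j} eq →
    Fin.suc-injective (trans (sym (proj₂ (edgeAbove i))) (trans (cong cut eq) (proj₂ (edgeAbove j)))))
  where
  open Edges T zero
  open Rooted T zero
  root≢ : ∀ j → zero ≢ cut j
  root≢ j eq = child≢root (edge-adj j) (sym eq)
  edgeAbove : ∀ i → ∃[ j ] cut j ≡ suc i
  edgeAbove i with p , adj , child≡ ← child-surjective (suc i) (λ ()) with j , cut≡ ← cut-surjective adj =
    j , trans cut≡ child≡

-- From the tree to the characteristic polynomial, and the conclusion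

sumℤ-pos : ∀ {m} (f : Fin m → ℕ) → sumℤ (λ i → + f i) ≡ + sumℕ f
sumℤ-pos {zero}  f = refl
sumℤ-pos {suc m} f = cong (ℤ._+_ (+ f zero)) (sumℤ-pos (f ∘ suc))

differ-idem : ∀ x y → + differ x y ℤ.* + differ x y ≡ + differ x y
differ-idem x y with differ x y | differ-≤1 x y
... | 0 | _       = refl
... | 1 | _       = refl
... | suc (suc _) | s≤s ()

module _ {n} (T : Tree n) (f : V₂ n) (root : Fin n) where
  open Edges T root

  min4PC-charPoly : ∀ k d′ g → m ≡ 2 + k → m ≡ suc d′ + g → distOf f ≡ suc d′ →
    charPoly (principalSubmatrix (Min4PC T) (edgesAnd T f)) ≋
    -ₚ ((X+2 ^ₚ k) *ₚ negCubic (constantTerm k d′) (linearTerm k d′ g) k)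
  min4PC-charPoly k d′ g m≡2+k m≡d+g d≡ = charPoly-factored k (principalSubmatrix (Min4PC T) (edgesAnd T f))
    (λ j → + Min4PC T f (edge j)) (λ j → + onPath f j) d′ g
    (cong +_ (Min4PC-diag f)) (λ _ → refl) (λ i → cong +_ (Min4PC-sym (edge i) f))
    (λ i → cong +_ (Min4PC-diag (edge i))) (λ i j i≢j → cong +_ (Min4PC-offDiag i j i≢j))
    border (λ i → differ-idem _ _)
    (trans (sumℤ-pos (onPath f)) (cong +_ (trans (sum-onPath f) d≡))) m≡2+k m≡d+g
    where
    open ≡-Reasoning
    solveFor : ∀ v δ → v ≡ v ℤ.+ + 2 ℤ.* δ ℤ.- + 2 ℤ.* δ
    solveFor = ℤ-Solver.solve-∀
    border : ∀ j → + Min4PC T f (edge j) ≡ + suc d′ ℤ.+ 1ℤ ℤ.- + 2 ℤ.* + onPath f j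
    border j = begin
      + v                                                   ≡⟨ solveFor (+ v) (+ δ) ⟩
      + v ℤ.+ + 2 ℤ.* + δ ℤ.- + 2 ℤ.* + δ                   ≡⟨ cong (λ x → + v ℤ.+ x ℤ.- + 2 ℤ.* + δ) (ℤ.pos-* 2 δ) ⟨
      + (v + 2 * δ) ℤ.- + 2 ℤ.* + δ                         ≡⟨ cong (λ x → + x ℤ.- + 2 ℤ.* + δ) (Min4PC-edge f j) ⟩
      + suc (distOf f) ℤ.- + 2 ℤ.* + δ                      ≡⟨ cong (λ x → + suc x ℤ.- + 2 ℤ.* + δ) d≡ ⟩
      + suc (suc d′) ℤ.- + 2 ℤ.* + δ                        ≡⟨ cong (λ x → + x ℤ.- + 2 ℤ.* + δ) (ℕ.+-comm 1 (suc d′)) ⟩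
      + suc d′ ℤ.+ 1ℤ ℤ.- + 2 ℤ.* + δ                       ∎
      where
      v = Min4PC T f (edge j)
      δ = onPath f j

theorem1p3 : ∀ (n : ℕ) (T : Tree n) (f : V₂ n) → ¬ IsEdge T f →
    let N = principalSubmatrix (Min4PC T) (edgesAnd T f)
        ∣a∣ = absCoeff N
    in Unimodal ∣a∣ (n ∸ 2)
       × LogConcave ∣a∣ (n ∸ 2)
       × (∀ t → IsMaxAt ∣a∣ (n ∸ 2) t →
           (n ∸ 2) / 3 ≤ t × t ≤ ⌈ (n + 1) / 3 ⌉)
theorem1p3 zero    T (pair () _ _)
theorem1p3 (suc n) T f ¬edge
  with d″ , d≡ ← ℕ.m≤n⇒∃[o]m+o≡n (Edges.nonEdge-dist T zero f ¬edge)
  with g , d+g≡m ← ℕ.m≤n⇒∃[o]m+o≡n (Edges.distOf-≤ T zero f) =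
  subst (λ n → Unimodal a (n ∸ 2) × LogConcave a (n ∸ 2) ×
      (∀ t → IsMaxAt a (n ∸ 2) t → (n ∸ 2) / 3 ≤ t × t ≤ ⌈ (n + 1) / 3 ⌉))
    (cong suc (trans (sym m≡2+k) (edges-length T)))
    -- Both coefficients are positive by computation; for the constant term 2m(d - 1)² this rests on
    -- d ≥ 2, which makes `d′` a successor.
    (product-shape (constantTerm k d′) (linearTerm k d′ g) k a z<s z<s
      (coefficients-logConcave k d′ g (trans (sym m≡2+k) m≡d+g)) coefficients)
  where
  open Edges T zero
  d′ = suc d″
  -- From m = d + g and d = d″ + 2 this is m - 2, obtained without subtraction.
  k = d″ + g
  a = absCoeff (principalSubmatrix (Min4PC T) (edgesAnd T f))
  m≡d+g : m ≡ suc d′ + g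
  m≡d+g = trans (sym d+g≡m) (cong (_+ g) (sym d≡))
  m≡2+k : m ≡ 2 + k
  m≡2+k = m≡d+g
  Q = (X+2 ^ₚ k) *ₚ negCubic (constantTerm k d′) (linearTerm k d′ g) k
  coefficients : ∀ j → a j ≡ ∣ coeff Q j ∣
  coefficients j = trans (cong ∣_∣ (trans (min4PC-charPoly T f zero k d′ g m≡2+k m≡d+g (sym d≡) j) (coeff--ₚ Q j)))
    (ℤ.∣-i∣≡∣i∣ (coeff Q j))
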